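{- For integers $n\ge1$ and $x\ge1$, let $P_1^n$ denote the graph consisting of $n$ disjoint copies of $P_1$ (i.e. $n$ isolated vertices) and $P_x^n$ the graph consisting of $n$ disjoint copies of $P_x$. Then $$\mu(P_1^n,P_x^n)=\begin{cases}(-1)^{x+n}, & \text{if } n=1 \text{ or } x=4,\\ 1, & \text{if } x=1 \text{ or } x=3,\\ 0, & \text{if } x=2 \text{ and } n>1,\\ \mathcal{F}_{x-2}, & \text{if } n=2,\\ \mathcal{C}_n, & \text{if } x=5,\end{cases}$$ where $\mathcal{F}_i$ is the $i$-th Fibonacci number and $\mathcal{C}_n$ the $n$-th Catalan number.
   Context: $\mathcal{G}$ is the poset of all finite unlabelled graphs (loops and multiple edges allowed), up to isomorphism, with $H\le G$ iff $H$ is isomorphic to an induced subgraph of $G$. $\mu$ is the Möbius function of $\mathcal{G}$: $\mu(a,a)=1$, $\mu(a,b)=0$ if $a\not\le b$, and $\mu(a,b)=-\sum_{a\le c<b}\mu(a,c)$ if $a<b$. $P_a$ denotes the path graph with $a$ vertices. Fibonacci numbers: $\mathcal{F}_0=0,\mathcal{F}_1=1,\mathcal{F}_{i}=\mathcal{F}_{i-1}+\mathcal{F}_{i-2}$. Catalan numbers: $\mathcal{C}_n=\frac{1}{n+1}\binom{2n}{n}$. -}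

module Defs where

open import Data.Nat as ℕ using (ℕ; zero; suc; _≡ᵇ_)
open import Data.Nat.Properties using (+-comm)
open import Data.Nat.Combinatorics using (_C_)
open import Data.Nat.DivMod using (_/_)
open import Data.Fin using (Fin; toℕ; splitAt)
open import Data.Sum using (_⊎_; inj₁; inj₂)
open import Data.Product using (Σ; ∃; _×_; _,_)
open import Data.Bool using (if_then_else_)
open import Data.Integer as ℤ using (ℤ)
open import Data.List using (List; []; _∷_; map)
open import Data.List.Membership.Propositional using (_∈_)
open import Data.List.Relation.Unary.AllPairs using (AllPairs)
open import Function.Bundles using (_⤖_; Bijection)
open import Function.Definitions using (Injective)
open import Relation.Binary.PropositionalEquality using (_≡_; refl)
open import Relation.Nullary using (¬_)

-- Finite graphs with loops and multiple edges, on vertex set Fin n.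
-- adj i j = number of edges between i and j (adj i i = number of loops).

record Graph : Set where
  constructor mkGraph
  field
    size : ℕ
    adj  : Fin size → Fin size → ℕ
    sym  : ∀ i j → adj i j ≡ adj j i
open Graph public

_≅_ : Graph → Graph → Set
G ≅ H = Σ (Fin (size G) ⤖ Fin (size H)) λ f →
          ∀ i j → adj G i j ≡ adj H (Bijection.to f i) (Bijection.to f j)

_≤ᴳ_ : Graph → Graph → Set
H ≤ᴳ G = Σ (Fin (size H) → Fin (size G)) λ f →
           Injective _≡_ _≡_ f × (∀ i j → adj H i j ≡ adj G (f i) (f j))

_<ᴳ_ : Graph → Graph → Set
H <ᴳ G = H ≤ᴳ G × ¬ (G ≤ᴳ H)

sumℤ : List ℤ → ℤ
sumℤ []       = ℤ.+ 0
sumℤ (z ∷ zs) = z ℤ.+ sumℤ zs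

-- Möbius function of the poset 𝒢 (graphs up to isomorphism).
-- A list L is a complete, irredundant list of representatives of the
-- isomorphism classes c with a ≤ c < b.

IsIntervalReps : Graph → Graph → List Graph → Set
IsIntervalReps a b L =
  (∀ c → c ∈ L → a ≤ᴳ c × c <ᴳ b) ×
  (∀ c → a ≤ᴳ c → c <ᴳ b → ∃ λ d → d ∈ L × c ≅ d) ×
  AllPairs (λ c d → ¬ (c ≅ d)) L

IsMobius : (Graph → Graph → ℤ) → Set
IsMobius m =
  (∀ a b → a ≅ b → m a b ≡ ℤ.+ 1) ×
  (∀ a b → ¬ (a ≤ᴳ b) → m a b ≡ ℤ.+ 0) ×
  (∀ a b → a <ᴳ b → ∀ L → IsIntervalReps a b L →
     m a b ≡ ℤ.- sumℤ (map (m a) L))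

edgeIf : ℕ → ℕ → ℕ
edgeIf a b = if suc b ≡ᵇ a then 1 else 0

Path : ℕ → Graph
Path x = mkGraph x (λ i j → edgeIf (toℕ i) (toℕ j) ℕ.+ edgeIf (toℕ j) (toℕ i))
                   (λ i j → +-comm (edgeIf (toℕ i) (toℕ j)) (edgeIf (toℕ j) (toℕ i)))

emptyGraph : Graph
emptyGraph = mkGraph 0 (λ ()) (λ ())

private
  unionAdj : ∀ {m n} (A : Fin m → Fin m → ℕ) (B : Fin n → Fin n → ℕ) →
             Fin m ⊎ Fin n → Fin m ⊎ Fin n → ℕ
  unionAdj A B (inj₁ i) (inj₁ j) = A i j
  unionAdj A B (inj₂ i) (inj₂ j) = B i j
  unionAdj A B (inj₁ _) (inj₂ _) = 0
  unionAdj A B (inj₂ _) (inj₁ _) = 0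

  unionSym : ∀ {m n} (A : Fin m → Fin m → ℕ) (B : Fin n → Fin n → ℕ) →
             (∀ i j → A i j ≡ A j i) → (∀ i j → B i j ≡ B j i) →
             ∀ u v → unionAdj A B u v ≡ unionAdj A B v u
  unionSym A B sA sB (inj₁ i) (inj₁ j) = sA i j
  unionSym A B sA sB (inj₂ i) (inj₂ j) = sB i j
  unionSym A B sA sB (inj₁ _) (inj₂ _) = refl
  unionSym A B sA sB (inj₂ _) (inj₁ _) = refl

_⊕_ : Graph → Graph → Graph
G ⊕ H = mkGraph (size G ℕ.+ size H)
          (λ i j → unionAdj (adj G) (adj H) (splitAt (size G) i) (splitAt (size G) j))
          (λ i j → unionSym (adj G) (adj H) (sym G) (sym H)
                              (splitAt (size G) i) (splitAt (size G) j))

copies : ℕ → Graph → Graph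
copies zero    G = emptyGraph
copies (suc n) G = G ⊕ copies n G

PathPow : ℕ → ℕ → Graph
PathPow x n = copies n (Path x)

fib : ℕ → ℕ
fib zero          = 0
fib (suc zero)    = 1
fib (suc (suc i)) = fib (suc i) ℕ.+ fib i

catalan : ℕ → ℕ
catalan n = ((2 ℕ.* n) C n) / suc n

{-# OPTIONS --safe #-}
module Submission where

-- Induced subgraphs of linear forests are linear forests, and G ≤ H becomes a
-- bin packing problem for the sizes of the paths.  The numbers μ(P₁ⁿ, c) are
-- characterised by ∑_{c ≤ b} μ(P₁ⁿ, c) = [b = P₁ⁿ]; collect them in the series
-- F_c = ∑ₙ μ(P₁ⁿ, c) tⁿ.  If r has only paths with at least three vertices, then
-- adding k copies of P₂ multiplies F_r by 1, −t, 0, 0, … and adding j copies of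
-- P₁ multiplies it by 1, t − 1, t(t − 1), t²(t − 1), …, so that sums over j
-- telescope.  Hence F_r is divisible by t^#r, where #r is the number of paths,
-- and the coefficients top r of t^#r satisfy
--     ∑ top r′ = ∑ top r″      (r nonempty),
-- where r′ runs over the forests with #r′ = #r that fit into r but leave no room
-- for a further vertex, and r″ over those with #r″ = #r − 1 such that P₂ ⊕ r″
-- fits into r but leaves no room for a further vertex.
-- For T(a,b,c) = top(P₅ᵃ P₄ᵇ P₃ᶜ) this gives T(0,0,c) = 1, T(0,n+1,0) = −T(0,n,0)
-- and the ballot recursion T(a+1,0,c) = T(a,0,c+1) + T(a+1,0,c−1), hence the
-- Catalan numbers.  For one path it gives top(P_{x+1}) = −top(P_x), and for two
-- paths the Fibonacci recursion.

open import Defs hiding (sym)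
open import Data.Bool using (Bool; true; false)
open import Data.Empty using (⊥)
open import Data.Fin as Fin using (Fin; zero; suc; toℕ; fromℕ<; splitAt; join; inject₁)
import Data.Fin.Properties as Fin
open import Data.Fin.Induction using (<-weakInduction)
open import Data.Integer as ℤ using (ℤ; -_; _-_; _^_; 0ℤ; 1ℤ) renaming (_+_ to _⊹_)
import Data.Integer.Properties as ℤ
open import Data.Integer.Tactic.RingSolver using (solve-∀)
open import Data.List using (List; []; _∷_; _++_; length; replicate; map; filter; upTo; cartesianProduct; cartesianProductWith; deduplicate)
import Data.List.Properties as List
open import Data.List.Membership.Propositional using (_∈_)
open import Data.List.Membership.Propositional.Properties
open import Data.List.Membership.Propositional.Properties.WithK using (unique∧set⇒bag)
open import Data.List.Relation.Binary.BagAndSetEquality using (∼bag⇒↭)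
open import Data.List.Relation.Binary.Permutation.Propositional using (_↭_; ↭-sym; ↭-trans; ↭-refl; ↭-prep; ↭-swap; ↭⇒↭ₛ)
open import Data.List.Relation.Binary.Permutation.Propositional.Properties using (∈-resp-↭; All-resp-↭; drop-∷; shift; ↭-length; map⁺; ++⁺ˡ)
open import Data.List.Relation.Binary.Pointwise using (Pointwise-≡⇒≡)
open import Data.List.Relation.Unary.All as All using (All; []; _∷_)
open import Data.List.Relation.Unary.AllPairs using (AllPairs; []; _∷_)
import Data.List.Relation.Unary.AllPairs.Properties as AllPairs
open import Data.List.Relation.Unary.Any using (here; there)
open import Data.List.Relation.Unary.Linked as Linked using ([]; [-]; _∷_)
open import Data.List.Relation.Unary.Sorted.TotalOrder using (Sorted; sorted?)
open import Data.List.Relation.Unary.Sorted.TotalOrder.Properties using (↗↭↗⇒≋)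
open import Data.List.Relation.Unary.Unique.Propositional using (Unique)
import Data.List.Relation.Unary.Unique.Propositional.Properties as Unique
open import Data.Nat hiding (_^_)
open import Data.Nat.Combinatorics using (_C_; nCk≡nC[n∸k]; nCk+nC[k+1]≡[n+1]C[k+1]; nC1≡n)
open import Data.Nat.DivMod using (m*n/n≡m; /-congˡ)
open import Data.Nat.ListAction using (sum)
open import Data.Nat.ListAction.Properties using (sum-↭)
open import Data.Nat.Properties
import Data.Nat.Tactic.RingSolver as ℕ-Solver
open import Data.List.Relation.Unary.Unique.DecPropositional.Properties (List.≡-dec _≟_) using (deduplicate-!)
open import Data.List.Sort ≤-decTotalOrder using (sort; sort-↭; sort-↗)
open import Data.Product using (Σ; ∃; ∃₂; _×_; _,_; proj₁; proj₂)
open import Data.Sum as Sum using (_⊎_; inj₁; inj₂)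
open import Data.Sum.Properties using (inj₁-injective; inj₂-injective)
open import Data.Unit using (⊤; tt)
open import Function.Base using (_∘_; id)
open import Function.Bundles using (Bijection; mk⇔; mk⤖)
open import Function.Definitions using (Injective)
open import Relation.Binary.Definitions using (DecidableEquality; tri<; tri≈; tri>)
open import Relation.Binary.PropositionalEquality using (_≡_; _≢_; refl; sym; trans; cong; cong₂; subst; subst₂; module ≡-Reasoning)
open import Relation.Nullary using (¬_; Dec; yes; no; does; contradiction; ¬?)
open import Relation.Nullary.Decidable using (map′; _×-dec_; _→-dec_; does-⇔; dec-true; dec-false; decidable-stable; True; toWitness)
open import Relation.Unary using (Decidable)

-- Series in t are natural here because an isolated vertex added to the larger forest is matched by
-- one more in P₁ⁿ, so it acts as multiplication by t. The factors for the copies of P₁ and P₂ are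
-- verified rather than derived: sums over principal ideals determine a function on forests, and
-- `model` is shown to have the required sums. This rests on exchange arguments for packings. Next
-- to a P₂ in the larger forest, for instance, P₂ together with i copies of P₁ fits exactly when i +
-- 1 copies of P₁ do. The threshold of three vertices comes from P₃ being the shortest path with
-- room for two isolated vertices. If a forest leaves some paths of r free, each of these takes two
-- isolated vertices, and the telescoping sum over j then rises in degree faster than the number of
-- paths drops. Only forests with #r or #r - 1 paths can therefore contribute to the coefficient of
-- t^#r. Deciding which of them leave no room means proving that packings do not exist. The main
-- tool for this is a weight on path sizes that no placement can increase.

private variable
  A B A' B' : Set
  a m m' k : ℕ
  b b' c c' d r : List ℕ
  xs ys : List A

-- Packings of paths

-- A packing names its bin only up to permutation, so every argument about a fixed bin has to
-- compare it with the bin that `place` used. This is that case distinction.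
split-↭ : m ∷ b ↭ m' ∷ b' →
          (m ≡ m' × b ↭ b') ⊎ (∃ λ e → b ↭ m' ∷ e × b' ↭ m ∷ e)
split-↭ {m} {b} {m'} p with ∈-resp-↭ (↭-sym p) (here refl)
... | here refl = inj₁ (refl , drop-∷ p)
... | there i with u , v , refl ← ∈-∃++ i =
  inj₂ (u ++ v , shift m' u v ,
        drop-∷ (↭-trans (↭-sym p) (↭-trans (↭-prep m (shift m' u v)) (↭-swap m m' ↭-refl))))

-- c ⊑ b says that paths of sizes c pack into paths of sizes b: a path of
-- size a is put at the end of a path of size m, and since it has to be
-- separated from the rest, a path of size m ∸ suc a remains available.

infix 4 _⊑_

data _⊑_ : List ℕ → List ℕ → Set where
  empty : [] ⊑ b
  place : 0 < a → b ↭ m ∷ d → a ≤ m → c ⊑ m ∸ suc a ∷ d → a ∷ c ⊑ b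

⊑-resp-↭ : b ↭ b' → c ⊑ b → c ⊑ b'
⊑-resp-↭ p empty             = empty
⊑-resp-↭ p (place a>0 e l q) = place a>0 (↭-trans (↭-sym p) e) l q

⊑-swapBins : c ⊑ m ∷ k ∷ b → c ⊑ k ∷ m ∷ b
⊑-swapBins {m = m} {k} = ⊑-resp-↭ (↭-swap m k ↭-refl)

⊑-positive : c ⊑ b → All (0 <_) c
⊑-positive empty             = []
⊑-positive (place a>0 _ _ q) = a>0 ∷ ⊑-positive q

push-↭ : b ↭ k ∷ d → m ∷ b ↭ k ∷ m ∷ d
push-↭ {k = k} {m = m} e = ↭-trans (↭-prep m e) (↭-swap m k ↭-refl)

⊑-addBin : ∀ m → c ⊑ b → c ⊑ m ∷ b
⊑-addBin m empty             = empty
⊑-addBin m (place a>0 e l q) = place a>0 (push-↭ e) l (⊑-swapBins (⊑-addBin m q))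

⊑-growBin : m ≤ m' → c ⊑ m ∷ b → c ⊑ m' ∷ b
⊑-growBin {c = []}    m≤m' q = empty
⊑-growBin {c = a ∷ c} m≤m' (place a>0 e l q) with split-↭ e
... | inj₁ (refl , p) =
  place a>0 ↭-refl (≤-trans l m≤m')
        (⊑-growBin (∸-monoˡ-≤ (suc a) m≤m') (⊑-resp-↭ (↭-prep _ (↭-sym p)) q))
... | inj₂ (_ , p , p') =
  place a>0 (push-↭ p) l
        (⊑-swapBins (⊑-growBin m≤m' (⊑-swapBins (⊑-resp-↭ (↭-prep _ p') q))))

-- Often applied with `m` equal to 0 and the positivity of the parts, to discard the empty leftovers
-- that truncated subtraction produces.
⊑-dropBin : All (m <_) c → c ⊑ m ∷ b → c ⊑ b
⊑-dropBin []        q = empty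
⊑-dropBin (m<a ∷ h) (place a>0 e l q) with split-↭ e
... | inj₁ (refl , _) = contradiction l (<⇒≱ m<a)
... | inj₂ (_ , p , p') =
  place a>0 p l (⊑-dropBin h (⊑-swapBins (⊑-resp-↭ (↭-prep _ p') q)))

private
  -- The induction hypothesis is passed as an argument because the same step serves both merged
  -- bins, with `m` and `m'` exchanged.
  mergeFirst : (∀ m m' → c ⊑ m ∷ m' ∷ b → c ⊑ suc (m + m') ∷ b) →
               ∀ m m' → 0 < a → a ≤ m → c ⊑ m ∸ suc a ∷ m' ∷ b → a ∷ c ⊑ suc (m + m') ∷ b
  mergeFirst {c} {b} {a} merge m m' a>0 l q with m≤n⇒m<n∨m≡n l
  ... | inj₁ a<m =
    place a>0 ↭-refl (≤-trans l (≤-trans (m≤m+n m m') (n≤1+n _)))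
          (subst (λ z → c ⊑ z ∷ b) (sym eq) (merge (m ∸ suc a) m' q))
    where
    eq : m + m' ∸ a ≡ suc (m ∸ suc a + m')
    eq = trans (+-∸-comm m' l) (cong (_+ m') (+-∸-assoc 1 a<m))
  -- The part fills its bin exactly, so the joining vertex becomes its separator and all of `m'`
  -- stays available.
  ... | inj₂ refl =
    place a>0 ↭-refl (≤-trans (m≤m+n m m') (n≤1+n _))
          (subst (λ z → c ⊑ z ∷ b) (sym (m+n∸m≡n a m'))
            (⊑-dropBin (⊑-positive q) (subst (λ z → c ⊑ z ∷ m' ∷ b) (m≤n⇒m∸n≡0 (n≤1+n a)) q)))

-- Two paths joined by one new vertex contain their disjoint union as an induced subgraph; the new
-- vertex accounts for the `suc`.
⊑-mergeBins : ∀ m m' → c ⊑ m ∷ m' ∷ b → c ⊑ suc (m + m') ∷ b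
⊑-mergeBins {c = []}        m m' q = empty
⊑-mergeBins {c = a ∷ c} {b} m m' (place a>0 e l q) with split-↭ e
... | inj₁ (refl , p) =
  mergeFirst ⊑-mergeBins m m' a>0 l (⊑-resp-↭ (↭-prep _ (↭-sym p)) q)
... | inj₂ (f , p , p') with split-↭ p
... | inj₁ (refl , r) =
  subst (λ z → a ∷ c ⊑ suc z ∷ b) (+-comm m' m)
    (mergeFirst ⊑-mergeBins m' m a>0 l
      (⊑-resp-↭ (↭-prep _ (↭-trans p' (↭-prep m (↭-sym r)))) q))
... | inj₂ (g , r , r') =
  place a>0 (push-↭ r) l
    (⊑-swapBins (⊑-mergeBins m m'
      (⊑-resp-↭ (↭-trans (↭-prep _ (↭-trans p' (↭-prep m r')))
                         (↭-trans (↭-swap _ m ↭-refl) (↭-prep m (↭-swap _ m' ↭-refl)))) q)))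

-- Only two parts in the same bin need an argument. Since `a'` is positive and fits after `a`, the
-- subtraction of `suc a` was not truncated, so both parts and their separator fit in either order.
⊑-swapParts : ∀ {a a'} → a ∷ a' ∷ c ⊑ b → a' ∷ a ∷ c ⊑ b
⊑-swapParts {c} {b} {a} {a'} (place {m = m} {d = d} a>0 e l (place a'>0 e' l' q)) with split-↭ e'
... | inj₁ (refl , p) =
  place a'>0 e (≤-trans l' (m∸n≤m m (suc a)))
    (place a>0 ↭-refl
      (subst (_≤ m ∸ suc a') (m+n∸m≡n (suc a') a) (∸-monoˡ-≤ (suc a') room))
      (subst (λ z → c ⊑ z ∷ d) exchange (⊑-resp-↭ (↭-prep _ (↭-sym p)) q)))
  where
  room : suc a' + a ≤ m
  room = subst (_≤ m) (cong suc (+-comm a a'))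
           (subst (_≤ m) (+-comm a' (suc a))
             (m≤n∸o⇒m+o≤n a' (m∸n≢0⇒n<m (λ z → n≮0 (subst (0 <_) z (≤-trans a'>0 l')))) l'))
    where
    m≤n∸o⇒m+o≤n : ∀ x {y z} → y < z → x ≤ z ∸ y → x + y ≤ z
    m≤n∸o⇒m+o≤n x {y} y<z h = subst (x + y ≤_) (m∸n+n≡m (<⇒≤ y<z)) (+-monoˡ-≤ y h)
  exchange : m ∸ suc a ∸ suc a' ≡ m ∸ suc a' ∸ suc a
  exchange = trans (∸-+-assoc m (suc a) (suc a'))
    (trans (cong (m ∸_) (+-comm (suc a) (suc a'))) (sym (∸-+-assoc m (suc a') (suc a))))
... | inj₂ (f , p , p') =
  place a'>0 (↭-trans e (push-↭ p)) l'
    (place a>0 (↭-swap _ _ ↭-refl) l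
      (⊑-swapBins (⊑-resp-↭ (↭-prep _ p') q)))

⊑-permute : c ↭ c' → c ⊑ b → c' ⊑ b
⊑-permute _↭_.refl         q                 = q
⊑-permute (_↭_.prep x p)   (place x>0 e l q) = place x>0 e l (⊑-permute p q)
⊑-permute (_↭_.swap x y p) q with ⊑-swapParts q
... | place y>0 e l (place x>0 e' l' q') = place y>0 e l (place x>0 e' l' (⊑-permute p q'))
⊑-permute (_↭_.trans p p') q                 = ⊑-permute p' (⊑-permute p q)

⊑-tail : a ∷ c ⊑ b → c ⊑ b
⊑-tail {a} (place {m = m} _ e _ q) = ⊑-resp-↭ (↭-sym e) (⊑-growBin (m∸n≤m m (suc a)) q)

⊑-shrinkPart : ∀ {a a'} → 0 < a' → a' ≤ a → a ∷ c ⊑ b → a' ∷ c ⊑ b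
⊑-shrinkPart a'>0 a'≤a (place {m = m} _ e l q) =
  place a'>0 e (≤-trans a'≤a l) (⊑-growBin (∸-monoʳ-≤ m (s≤s a'≤a)) q)

⊑-∷ : 0 < a → a ≤ m → c ⊑ b → a ∷ c ⊑ m ∷ b
⊑-∷ a>0 l q = place a>0 ↭-refl l (⊑-addBin _ q)

⊑-refl : All (0 <_) b → b ⊑ b
⊑-refl []        = empty
⊑-refl (m>0 ∷ h) = ⊑-∷ m>0 ≤-refl (⊑-refl h)

-- Several parts may share a bin, but each part needs at most one bin of its own. After the first
-- part is placed, induction finds a bin that the other parts avoid.
⊑-freeBin : c ⊑ b → length c < length b → ∃₂ λ m d → b ↭ m ∷ d × c ⊑ d
⊑-freeBin {b = m ∷ b} empty _ = m , b , ↭-refl , empty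
⊑-freeBin {a ∷ c} {b} (place {m = m} {d = d} a>0 e l q) c<b
  with c<d ← s<s⁻¹ (subst (suc (length c) <_) (↭-length e) c<b)
  with ⊑-freeBin q (m≤n⇒m≤1+n c<d)
... | u , f , p , q' with split-↭ p
... | inj₂ (g , p₁ , p₂) =
  u , m ∷ g , ↭-trans e (push-↭ p₁) , place a>0 ↭-refl l (⊑-resp-↭ p₂ q')
-- The avoided bin is what `a` left over, so the other parts lie in `d` alone. A second application
-- finds a bin of `d` that is really free.
... | inj₁ (refl , p₁) with ⊑-freeBin (⊑-resp-↭ (↭-sym p₁) q') c<d
... | v , g , p₂ , q'' = v , m ∷ g , ↭-trans e (push-↭ p₂) , ⊑-∷ a>0 l q''

-- Such weights are certificates that a packing does not exist: placing a path together with its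
-- separator never gains weight.
Superadditive : (ℕ → ℕ) → Set
Superadditive w = ∀ a m → a ≤ m → w a + w (m ∸ suc a) ≤ w m

⊑⇒weight-≤ : ∀ {w} → Superadditive w → c ⊑ b → sum (map w c) ≤ sum (map w b)
⊑⇒weight-≤         sup empty = z≤n
⊑⇒weight-≤ {a ∷ c} {b} {w} sup (place {m = m} {d = d} _ e l q) = begin
  w a + sum (map w c)                          ≤⟨ +-monoʳ-≤ (w a) (⊑⇒weight-≤ sup q) ⟩
  w a + (w (m ∸ suc a) + sum (map w d))        ≡⟨ +-assoc (w a) _ _ ⟨
  w a + w (m ∸ suc a) + sum (map w d)          ≤⟨ +-monoˡ-≤ _ (sup a m l) ⟩
  w m + sum (map w d)                          ≡⟨ sum-↭ (map⁺ w e) ⟨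
  sum (map w b)                                ∎
  where open ≤-Reasoning

⊑⇒sum-≤ : c ⊑ b → sum c ≤ sum b
⊑⇒sum-≤ empty = z≤n
⊑⇒sum-≤ {a ∷ c} {b} (place {m = m} {d = d} _ e l q) = begin
  a + sum c                     ≤⟨ +-monoʳ-≤ a (⊑⇒sum-≤ q) ⟩
  a + (m ∸ suc a + sum d)       ≡⟨ +-assoc a _ _ ⟨
  a + (m ∸ suc a) + sum d       ≤⟨ +-monoˡ-≤ (sum d) (+-monoʳ-≤ a (∸-monoʳ-≤ m (n≤1+n a))) ⟩
  a + (m ∸ a) + sum d           ≡⟨ cong (_+ sum d) (m+[n∸m]≡n l) ⟩
  m + sum d                     ≡⟨ sum-↭ e ⟨
  sum b                         ∎
  where open ≤-Reasoning

-- A part shorter than its bin loses a vertex to the separator. With no vertex to lose, every part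
-- fills a bin.
⊑∧sum-≡⇒↭ : All (0 <_) b → c ⊑ b → sum b ≤ sum c → c ↭ b
⊑∧sum-≡⇒↭ []        empty _ = ↭-refl
⊑∧sum-≡⇒↭ {m ∷ b} (m>0 ∷ _) empty le = contradiction (≤-trans (m≤m+n m (sum b)) le) (<⇒≱ m>0)
⊑∧sum-≡⇒↭ {b} {a ∷ c} pos (place {m = m} {d = d} a>0 e l q) le with m≤n⇒m<n∨m≡n l
... | inj₂ refl =
  ↭-trans (↭-prep a (⊑∧sum-≡⇒↭ (All.tail (All-resp-↭ e pos)) q'
             (+-cancelˡ-≤ a _ _ (subst (_≤ a + sum c) (sum-↭ e) le))))
          (↭-sym e)
  where
  q' : c ⊑ d
  q' = ⊑-dropBin (⊑-positive q) (subst (λ z → c ⊑ z ∷ d) (m≤n⇒m∸n≡0 (n≤1+n a)) q)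
... | inj₁ a<m = contradiction le (<⇒≱ (begin-strict
  a + sum c                     ≤⟨ +-monoʳ-≤ a (⊑⇒sum-≤ q) ⟩
  a + (m ∸ suc a + sum d)       <⟨ n<1+n _ ⟩
  suc a + (m ∸ suc a + sum d)   ≡⟨ +-assoc (suc a) _ _ ⟨
  suc a + (m ∸ suc a) + sum d   ≡⟨ cong (_+ sum d) (m+[n∸m]≡n a<m) ⟩
  m + sum d                     ≡⟨ sum-↭ e ⟨
  sum b                         ∎))
  where open ≤-Reasoning

Pick : (ℕ → List ℕ → Set) → List ℕ → Set
Pick P b = ∃₂ λ m d → b ↭ m ∷ d × P m d

-- The condition `b ↭ m ∷ d` leaves the order of `d` open. Invariance under permutations of `d`
-- makes a search over the positions of `b` exhaustive.
pick? : ∀ {P : ℕ → List ℕ → Set} → (∀ m d → Dec (P m d)) →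
        (∀ {m d d'} → d ↭ d' → P m d → P m d') → ∀ b → Dec (Pick P b)
pick? P? resp [] = no λ (m , d , e , _) → contradiction (↭-length e) λ ()
pick? {P} P? resp (x ∷ b) with P? x b
... | yes p = yes (x , b , ↭-refl , p)
... | no ¬p with pick? (λ m d → P? m (x ∷ d)) (λ e → resp (↭-prep x e)) b
... | yes (m , d , e , p) = yes (m , x ∷ d , push-↭ e , p)
... | no ¬q = no λ (m , d , e , p) → case (split-↭ e) p
  where
  case : ∀ {m d} → (x ≡ m × b ↭ d) ⊎ (∃ λ f → b ↭ m ∷ f × d ↭ x ∷ f) → ¬ P m d
  case (inj₁ (refl , e)) p      = ¬p (resp (↭-sym e) p)
  case (inj₂ (f , e , e')) p    = ¬q (_ , f , e , resp e' p)

abstract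
  -- Opaque, so that `does (c ⊑? b)` does not unfold into the search; later arguments use only
  -- whether `c ⊑ b` holds.
  _⊑?_ : ∀ c b → Dec (c ⊑ b)
  [] ⊑? b = yes empty
  (zero ∷ c) ⊑? b = no λ { (place () _ _ _) }
  (a@(suc _) ∷ c) ⊑? b =
    map′ (λ (m , d , e , l , q) → place z<s e l q)
         (λ { (place _ e l q) → _ , _ , e , l , q })
         (pick? (λ m d → (a ≤? m) ×-dec (c ⊑? (m ∸ suc a ∷ d)))
                (λ e (l , q) → l , ⊑-resp-↭ (↭-prep _ e) q) b)

-- Linear forests as graphs

infix 4 _↪_
infixr 5 _⊞_

-- Vertex sets are arbitrary types, so that disjoint unions live on sum types and `splitAt` is
-- confined to `⊕↪⊞` and `⊞↪⊕`.
record _↪_ {A B : Set} (E : A → A → ℕ) (F : B → B → ℕ) : Set where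
  constructor emb
  field
    to        : A → B
    injective : Injective _≡_ _≡_ to
    edges     : ∀ i j → E i j ≡ F (to i) (to j)

retraction⇒injective : (f : A → B) (g : B → A) → (∀ x → g (f x) ≡ x) → Injective _≡_ _≡_ f
retraction⇒injective f g gf {x} {y} e = trans (sym (gf x)) (trans (cong g e) (gf y))

↪-refl : {E : A → A → ℕ} → E ↪ E
↪-refl = emb id id λ _ _ → refl

↪-trans : {E : A → A → ℕ} {F : B → B → ℕ} {G : A' → A' → ℕ} → E ↪ F → F ↪ G → E ↪ G
↪-trans (emb f fi fe) (emb g gi ge) = emb (g ∘ f) (fi ∘ gi) λ i j → trans (fe i j) (ge (f i) (f j))

_⊞_ : (A → A → ℕ) → (B → B → ℕ) → A ⊎ B → A ⊎ B → ℕ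
(E ⊞ F) (inj₁ i) (inj₁ j) = E i j
(E ⊞ F) (inj₂ i) (inj₂ j) = F i j
(E ⊞ F) (inj₁ _) (inj₂ _) = 0
(E ⊞ F) (inj₂ _) (inj₁ _) = 0

⊞-map : {E : A → A → ℕ} {E' : B → B → ℕ} {F : A' → A' → ℕ} {F' : B' → B' → ℕ} →
        E ↪ E' → F ↪ F' → E ⊞ F ↪ E' ⊞ F'
⊞-map (emb f fi fe) (emb g gi ge) = emb (Sum.map f g) inj edges
  where
  inj : Injective _≡_ _≡_ (Sum.map f g)
  inj {inj₁ x} {inj₁ y} e = cong inj₁ (fi (inj₁-injective e))
  inj {inj₂ x} {inj₂ y} e = cong inj₂ (gi (inj₂-injective e))
  edges : ∀ i j → _
  edges (inj₁ x) (inj₁ y) = fe x y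
  edges (inj₂ x) (inj₂ y) = ge x y
  edges (inj₁ x) (inj₂ y) = refl
  edges (inj₂ x) (inj₁ y) = refl

⊞-exchange : {E : A → A → ℕ} {F : B → B → ℕ} {G : A' → A' → ℕ} → E ⊞ F ⊞ G ↪ F ⊞ E ⊞ G
⊞-exchange {A} {B} {A'} {E} {F} {G} = emb f (retraction⇒injective f g gf) edges
  where
  f : A ⊎ B ⊎ A' → B ⊎ A ⊎ A'
  f (inj₁ x)        = inj₂ (inj₁ x)
  f (inj₂ (inj₁ x)) = inj₁ x
  f (inj₂ (inj₂ x)) = inj₂ (inj₂ x)
  g : B ⊎ A ⊎ A' → A ⊎ B ⊎ A'
  g (inj₁ x)        = inj₂ (inj₁ x)
  g (inj₂ (inj₁ x)) = inj₁ x
  g (inj₂ (inj₂ x)) = inj₂ (inj₂ x)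
  gf : ∀ x → g (f x) ≡ x
  gf (inj₁ _)        = refl
  gf (inj₂ (inj₁ _)) = refl
  gf (inj₂ (inj₂ _)) = refl
  edges : ∀ i j → (E ⊞ F ⊞ G) i j ≡ (F ⊞ E ⊞ G) (f i) (f j)
  edges (inj₁ _)        (inj₁ _)        = refl
  edges (inj₁ _)        (inj₂ (inj₁ _)) = refl
  edges (inj₁ _)        (inj₂ (inj₂ _)) = refl
  edges (inj₂ (inj₁ _)) (inj₁ _)        = refl
  edges (inj₂ (inj₁ _)) (inj₂ (inj₁ _)) = refl
  edges (inj₂ (inj₁ _)) (inj₂ (inj₂ _)) = refl
  edges (inj₂ (inj₂ _)) (inj₁ _)        = refl
  edges (inj₂ (inj₂ _)) (inj₂ (inj₁ _)) = refl
  edges (inj₂ (inj₂ _)) (inj₂ (inj₂ _)) = refl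

⊞-assocˡ : {E : A → A → ℕ} {F : B → B → ℕ} {G : A' → A' → ℕ} → E ⊞ F ⊞ G ↪ (E ⊞ F) ⊞ G
⊞-assocˡ {A} {B} {A'} {E} {F} {G} = emb f (retraction⇒injective f g gf) edges
  where
  f : A ⊎ B ⊎ A' → (A ⊎ B) ⊎ A'
  f (inj₁ x)        = inj₁ (inj₁ x)
  f (inj₂ (inj₁ x)) = inj₁ (inj₂ x)
  f (inj₂ (inj₂ x)) = inj₂ x
  g : (A ⊎ B) ⊎ A' → A ⊎ B ⊎ A'
  g (inj₁ (inj₁ x)) = inj₁ x
  g (inj₁ (inj₂ x)) = inj₂ (inj₁ x)
  g (inj₂ x)        = inj₂ (inj₂ x)
  gf : ∀ x → g (f x) ≡ x
  gf (inj₁ _)        = refl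
  gf (inj₂ (inj₁ _)) = refl
  gf (inj₂ (inj₂ _)) = refl
  edges : ∀ i j → (E ⊞ F ⊞ G) i j ≡ ((E ⊞ F) ⊞ G) (f i) (f j)
  edges (inj₁ _)        (inj₁ _)        = refl
  edges (inj₁ _)        (inj₂ (inj₁ _)) = refl
  edges (inj₁ _)        (inj₂ (inj₂ _)) = refl
  edges (inj₂ (inj₁ _)) (inj₁ _)        = refl
  edges (inj₂ (inj₁ _)) (inj₂ (inj₁ _)) = refl
  edges (inj₂ (inj₁ _)) (inj₂ (inj₂ _)) = refl
  edges (inj₂ (inj₂ _)) (inj₁ _)        = refl
  edges (inj₂ (inj₂ _)) (inj₂ (inj₁ _)) = refl
  edges (inj₂ (inj₂ _)) (inj₂ (inj₂ _)) = refl

⊕↪⊞ : ∀ G H → adj (G ⊕ H) ↪ adj G ⊞ adj H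
⊕↪⊞ G H =
  emb (splitAt (size G)) (retraction⇒injective _ (join _ _) (Fin.join-splitAt (size G) (size H))) edges
  where
  edges : ∀ i j → adj (G ⊕ H) i j ≡ (adj G ⊞ adj H) (splitAt (size G) i) (splitAt (size G) j)
  edges i j with splitAt (size G) i | splitAt (size G) j
  ... | inj₁ _ | inj₁ _ = refl
  ... | inj₁ _ | inj₂ _ = refl
  ... | inj₂ _ | inj₁ _ = refl
  ... | inj₂ _ | inj₂ _ = refl

⊞↪⊕ : ∀ G H → adj G ⊞ adj H ↪ adj (G ⊕ H)
⊞↪⊕ G H =
  emb (join (size G) (size H)) (retraction⇒injective _ (splitAt _) (Fin.splitAt-join (size G) (size H))) edges
  where
  edges : ∀ i j → (adj G ⊞ adj H) i j ≡ adj (G ⊕ H) (join (size G) (size H) i) (join (size G) (size H) j)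
  edges i j rewrite Fin.splitAt-join (size G) (size H) i | Fin.splitAt-join (size G) (size H) j
    with i | j
  ... | inj₁ _ | inj₁ _ = refl
  ... | inj₁ _ | inj₂ _ = refl
  ... | inj₂ _ | inj₁ _ = refl
  ... | inj₂ _ | inj₂ _ = refl

Forest : List ℕ → Graph
Forest []      = emptyGraph
Forest (m ∷ b) = Path m ⊕ Forest b

V : List ℕ → Set
V []      = ⊥
V (m ∷ b) = Fin m ⊎ V b

E : ∀ b → V b → V b → ℕ
E []      = λ ()
E (m ∷ b) = adj (Path m) ⊞ E b

Forest↪E : ∀ b → adj (Forest b) ↪ E b
Forest↪E []      = emb (λ ()) (λ {}) λ ()
Forest↪E (m ∷ b) = ↪-trans (⊕↪⊞ (Path m) (Forest b)) (⊞-map ↪-refl (Forest↪E b))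

E↪Forest : ∀ b → E b ↪ adj (Forest b)
E↪Forest []      = emb (λ ()) (λ {}) λ ()
E↪Forest (m ∷ b) = ↪-trans (⊞-map ↪-refl (E↪Forest b)) (⊞↪⊕ (Path m) (Forest b))

edge : ℕ → ℕ → ℕ
edge p q = edgeIf p q + edgeIf q p

edge-sym : ∀ p q → edge p q ≡ edge q p
edge-sym p q = +-comm (edgeIf p q) (edgeIf q p)

edge-next : ∀ p → edge p (suc p) ≡ 1
edge-next zero    = refl
edge-next (suc p) = edge-next p

edge-far : ∀ {p q} → suc p < q → edge p q ≡ 0
edge-far {zero}  (s≤s (s≤s _)) = refl
edge-far {suc p} (s≤s lt)      = edge-far lt

edge-+ : ∀ k {p q} → edge (k + p) (k + q) ≡ edge p q
edge-+ zero    = refl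
edge-+ (suc k) = edge-+ k

edge-∸ : ∀ k {p q} → k ≤ p → k ≤ q → edge p q ≡ edge (p ∸ k) (q ∸ k)
edge-∸ zero    _       _       = refl
edge-∸ (suc k) (s≤s l) (s≤s h) = edge-∸ k l h

edge≡1⇒consecutive : ∀ p q → edge p q ≡ 1 → q ≡ suc p ⊎ p ≡ suc q
edge≡1⇒consecutive zero          (suc zero)    _ = inj₁ refl
edge≡1⇒consecutive (suc zero)    zero          _ = inj₂ refl
edge≡1⇒consecutive (suc p)       (suc q)       e = Sum.map (cong suc) (cong suc) (edge≡1⇒consecutive p q e)

↪Path : {E : A → A → ℕ} (g : A → ℕ) → (∀ x → g x < m) → Injective _≡_ _≡_ g →
        (∀ x y → E x y ≡ edge (g x) (g y)) → E ↪ adj (Path m)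
↪Path g g< gi ge = 
  emb (λ x → fromℕ< (g< x)) (λ e → gi (Fin.fromℕ<-injective _ _ (g< _) (g< _) e))
  λ x y → trans (ge x y) (sym (cong₂ edge (Fin.toℕ-fromℕ< (g< x)) (Fin.toℕ-fromℕ< (g< y))))

+-<-∸ : ∀ s {p m} → p < m ∸ s → s + p < m
+-<-∸ s {p} {m} lt = subst (_≤ m) (cong suc (+-comm p s)) (m≤n∸o⇒m+o≤n (suc p) (<⇒≤ (m∸n≢0⇒n<m (m<n⇒n≢0 lt))) lt)
  where
  m≤n∸o⇒m+o≤n : ∀ x {y z} → y ≤ z → x ≤ z ∸ y → x + y ≤ z
  m≤n∸o⇒m+o≤n x {y} y≤z h = subst (x + y ≤_) (m∸n+n≡m y≤z) (+-monoˡ-≤ y h)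

-- The vertex numbered `a` is left out as the separator. If `a` equals `m` there is none, and
-- truncation makes the second path empty.
splitPath : a ≤ m → adj (Path a) ⊞ adj (Path (m ∸ suc a)) ↪ adj (Path m)
splitPath {a} {m} a≤m = ↪Path pos pos< pos-inj edges
  where
  pos : Fin a ⊎ Fin (m ∸ suc a) → ℕ
  pos (inj₁ i) = toℕ i
  pos (inj₂ j) = suc a + toℕ j
  pos< : ∀ x → pos x < m
  pos< (inj₁ i) = ≤-trans (Fin.toℕ<n i) a≤m
  pos< (inj₂ j) = +-<-∸ (suc a) (Fin.toℕ<n j)
  gap : ∀ (i : Fin a) j → suc (toℕ i) < suc a + j
  gap i j = s≤s (≤-trans (Fin.toℕ<n i) (m≤m+n a j))
  pos-inj : Injective _≡_ _≡_ pos
  pos-inj {inj₁ i} {inj₁ j} e = cong inj₁ (Fin.toℕ-injective e)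
  pos-inj {inj₂ i} {inj₂ j} e = cong inj₂ (Fin.toℕ-injective (+-cancelˡ-≡ (suc a) _ _ e))
  pos-inj {inj₁ i} {inj₂ j} e = contradiction e (<⇒≢ (<⇒≤ (gap i (toℕ j))))
  pos-inj {inj₂ i} {inj₁ j} e = contradiction (sym e) (<⇒≢ (<⇒≤ (gap j (toℕ i))))
  edges : ∀ x y → (adj (Path a) ⊞ adj (Path (m ∸ suc a))) x y ≡ edge (pos x) (pos y)
  edges (inj₁ i) (inj₁ j) = refl
  edges (inj₂ i) (inj₂ j) = sym (edge-+ (suc a))
  edges (inj₁ i) (inj₂ j) = sym (edge-far (gap i (toℕ j)))
  edges (inj₂ i) (inj₁ j) = sym (trans (edge-sym (suc a + toℕ i) (toℕ j)) (edge-far (gap j (toℕ i))))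

↭⇒↪ : b ↭ b' → E b ↪ E b'
↭⇒↪ _↭_.refl         = ↪-refl
↭⇒↪ (_↭_.prep x p)   = ⊞-map ↪-refl (↭⇒↪ p)
↭⇒↪ (_↭_.swap x y p) = ↪-trans ⊞-exchange (⊞-map ↪-refl (⊞-map ↪-refl (↭⇒↪ p)))
↭⇒↪ (_↭_.trans p q)  = ↪-trans (↭⇒↪ p) (↭⇒↪ q)

⊑⇒↪ : c ⊑ b → E c ↪ E b
⊑⇒↪ empty = emb (λ ()) (λ {}) λ ()
⊑⇒↪ (place a>0 e l q) =
  ↪-trans (⊞-map ↪-refl (⊑⇒↪ q))
    (↪-trans ⊞-assocˡ (↪-trans (⊞-map (splitPath l) ↪-refl) (↭⇒↪ (↭-sym e))))

open _↪_

locate : ∀ b (v : V b) → ∃₂ λ m d → b ↭ m ∷ d × Σ (E b ↪ E (m ∷ d)) λ g → ∃ λ p → to g v ≡ inj₁ p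
locate (m ∷ b) (inj₁ p) = m , b , ↭-refl , ↪-refl , p , refl
locate (x ∷ b) (inj₂ v) with m , d , e , g , p , eq ← locate b v =
  m , x ∷ d , push-↭ e , ↪-trans (⊞-map ↪-refl g) ⊞-exchange , p ,
  cong (to (⊞-exchange {E = adj (Path x)} {adj (Path m)} {E d}) ∘ inj₂) eq

-- A self-avoiding walk on a line never turns back. The invariant is that it starts at an end of the
-- interval it covers: a new first vertex next to that end either extends the interval or repeats a
-- position.
walk-interval : ∀ n (q : Fin (suc n) → ℕ) → Injective _≡_ _≡_ q →
                (∀ i → edge (q (inject₁ i)) (q (suc i)) ≡ 1) →
                ∃ λ s → (∀ t → t ≤ n → ∃ λ i → q i ≡ s + t) × (q zero ≡ s ⊎ q zero ≡ s + n)
walk-interval zero q _ _ = q zero , (λ { zero _ → zero , sym (+-identityʳ _) }) , inj₁ refl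
walk-interval (suc n) q qi step
  with s , cover , end ← walk-interval n (q ∘ suc) (Fin.suc-injective ∘ qi) (step ∘ suc) =
  cases (edge≡1⇒consecutive _ _ (step zero)) end
  where
  Goal = ∃ λ s → (∀ t → t ≤ suc n → ∃ λ i → q i ≡ s + t) × (q zero ≡ s ⊎ q zero ≡ s + suc n)
  top : q zero ≡ s + suc n → Goal
  top e = s , cover' , inj₂ e
    where
    cover' : ∀ t → t ≤ suc n → ∃ λ i → q i ≡ s + t
    cover' t t≤ with m≤n⇒m<n∨m≡n t≤
    ... | inj₁ t<  = let i , h = cover t (s≤s⁻¹ t<) in suc i , h
    ... | inj₂ refl = zero , e
  bottom : s ≡ suc (q zero) → Goal
  bottom e = q zero , cover' , inj₁ refl
    where
    cover' : ∀ t → t ≤ suc n → ∃ λ i → q i ≡ q zero + t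
    cover' zero    _        = zero , sym (+-identityʳ _)
    cover' (suc t) (s≤s t≤) =
      let i , h = cover t t≤ in suc i , trans h (trans (cong (_+ t) e) (sym (+-suc (q zero) t)))
  fresh : ∀ {t} → t ≤ n → q zero ≢ s + t
  fresh t≤ e with i , h ← cover _ t≤ = contradiction (qi (trans e (sym h))) λ ()
  cases : q (suc zero) ≡ suc (q zero) ⊎ q zero ≡ suc (q (suc zero)) →
          q (suc zero) ≡ s ⊎ q (suc zero) ≡ s + n → Goal
  cases (inj₁ e) (inj₁ e') = bottom (trans (sym e') e)
  cases (inj₂ e) (inj₂ e') = top (trans e (trans (cong suc e') (sym (+-suc s n))))
  cases (inj₁ e) (inj₂ e') with m≤n⇒m<n∨m≡n (z≤n {n})
  ... | inj₂ 0≡n = bottom (trans (sym (+-identityʳ s)) (trans (cong (s +_) 0≡n) (trans (sym e') e)))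
  -- The walk would turn back: `q zero` would be `s + (n ∸ 1)`, which is already covered.
  ... | inj₁ 0<n = contradiction
    (suc-injective (trans (sym e) (trans e' (trans (cong (s +_) (sym (m+[n∸m]≡n 0<n))) (+-suc s (n ∸ 1))))))
    (fresh (m∸n≤m n 1))
  cases (inj₂ e) (inj₁ e') with m≤n⇒m<n∨m≡n (z≤n {n})
  ... | inj₂ 0≡n = top (trans above (cong (λ z → s + suc z) 0≡n))
    where
    above : q zero ≡ s + 1
    above = trans e (trans (cong suc e') (sym (+-comm s 1)))
  ... | inj₁ 0<n = contradiction (trans e (trans (cong suc e') (sym (+-comm s 1)))) (fresh 0<n)

away-from-interval : ∀ n s p → (∀ t → t ≤ n → p ≢ s + t) → (∀ t → t ≤ n → edge p (s + t) ≢ 1) →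
                     suc p < s ⊎ s + suc n < p
away-from-interval n s p p≢ e≢ with p <? s
... | yes p<s = inj₁ (≤∧≢⇒< p<s λ { refl → e≢ 0 z≤n (trans (cong (edge p) (+-identityʳ (suc p))) (edge-next p)) })
... | no p≮s with s≤p ← ≮⇒≥ p≮s | p <? s + suc n
... | yes p< = contradiction (sym (m+[n∸m]≡n s≤p))
                 (p≢ (p ∸ s) (s≤s⁻¹ (+-cancelˡ-< s _ _ (subst (_< s + suc n) (sym (m+[n∸m]≡n s≤p)) p<))))
... | no p≮ = inj₂ (≤∧≢⇒< (≮⇒≥ p≮) λ { refl →
                e≢ n ≤-refl (trans (edge-sym (s + suc n) (s + n)) (trans (edge-+ s) (edge-next n))) })

-- Positions to the right of the interval move down by `suc a`, for the interval and one boundary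
-- vertex. The other boundary vertex remains as a gap, so no edge is created. An induced path in the
-- middle of its host thus costs no more than one at the end.
module Excise (s a : ℕ) {m : ℕ} (s+a≤m : s + a ≤ m) {B : Set} (F : B → B → ℕ) where

  Away : ℕ → Set
  Away p = suc p < s ⊎ s + a < p

  close : ∀ {p} → Away p → ℕ
  close {p} (inj₁ _) = p
  close {p} (inj₂ _) = p ∸ suc a

  private
    a<-right : ∀ {p} → s + a < p → suc a ≤ p
    a<-right gt = ≤-trans (s≤s (m≤n+m a s)) gt

    s≤-right : ∀ {p} → s + a < p → s ≤ p ∸ suc a
    s≤-right {p} gt = subst (_≤ p ∸ suc a) (m+n∸n≡m s (suc a))
                        (∸-monoˡ-≤ (suc a) (subst (_≤ p) (sym (+-suc s a)) gt))

  close-< : ∀ {p} (g : Away p) → p < m → close g < m ∸ suc a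
  close-< {p} (inj₁ lt) _ = subst (_≤ m ∸ suc a) (m+n∸n≡m (suc p) (suc a))
    (∸-monoˡ-≤ (suc a) (≤-trans (subst (_≤ s + a) (sym (+-suc (suc p) a)) (+-monoˡ-≤ a lt)) s+a≤m))
  close-< (inj₂ gt) p<m = ∸-monoˡ-< p<m (a<-right gt)

  close-injective : ∀ {p q} (g : Away p) (h : Away q) → close g ≡ close h → p ≡ q
  close-injective (inj₁ _)  (inj₁ _)  e = e
  close-injective (inj₂ gt) (inj₂ ht) e = ∸-cancelʳ-≡ (a<-right gt) (a<-right ht) e
  close-injective (inj₁ lt) (inj₂ gt) e = contradiction e (<⇒≢ (≤-trans (<⇒≤ lt) (s≤-right gt)))
  close-injective (inj₂ gt) (inj₁ lt) e = contradiction (sym e) (<⇒≢ (≤-trans (<⇒≤ lt) (s≤-right gt)))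

  close-edge : ∀ {p q} (g : Away p) (h : Away q) → edge p q ≡ edge (close g) (close h)
  close-edge (inj₁ _)  (inj₁ _)  = refl
  close-edge (inj₂ gt) (inj₂ ht) = edge-∸ (suc a) (a<-right gt) (a<-right ht)
  close-edge (inj₁ lt) (inj₂ gt) =
    trans (edge-far (≤-trans lt (≤-trans (m≤m+n s a) (<⇒≤ gt)))) (sym (edge-far (≤-trans lt (s≤-right gt))))
  close-edge {p} {q} (inj₂ gt) (inj₁ lt) =
    trans (edge-sym p q) (trans (close-edge (inj₁ lt) (inj₂ gt)) (edge-sym q (p ∸ suc a)))

  Away⊎ : Fin m ⊎ B → Set
  Away⊎ (inj₁ p) = Away (toℕ p)
  Away⊎ (inj₂ _) = ⊤

  close⊎ : ∀ y → Away⊎ y → Fin (m ∸ suc a) ⊎ B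
  close⊎ (inj₁ p) g = inj₁ (fromℕ< (close-< g (Fin.toℕ<n p)))
  close⊎ (inj₂ y) _ = inj₂ y

  close⊎-injective : ∀ y y' g g' → close⊎ y g ≡ close⊎ y' g' → y ≡ y'
  close⊎-injective (inj₁ p) (inj₁ p') g g' e = cong inj₁ (Fin.toℕ-injective
    (close-injective g g' (Fin.fromℕ<-injective _ _ _ _ (inj₁-injective e))))
  close⊎-injective (inj₂ y) (inj₂ y') g g' e = cong inj₂ (inj₂-injective e)

  close⊎-edge : ∀ y y' g g' → (adj (Path m) ⊞ F) y y' ≡
                (adj (Path (m ∸ suc a)) ⊞ F) (close⊎ y g) (close⊎ y' g')
  close⊎-edge (inj₁ p) (inj₁ p') g g' =
    trans (close-edge g g') (sym (cong₂ edge (Fin.toℕ-fromℕ< (close-< g (Fin.toℕ<n p)))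
                                                (Fin.toℕ-fromℕ< (close-< g' (Fin.toℕ<n p')))))
  close⊎-edge (inj₁ _) (inj₂ _)  _ _ = refl
  close⊎-edge (inj₂ _) (inj₁ _)  _ _ = refl
  close⊎-edge (inj₂ _) (inj₂ _)  _ _ = refl

-- A connected graph stays within one component, and a path inside a path occupies an interval. The
-- rest avoids this interval and its neighbours, so `Excise` applies. This is why `place` may put
-- each part at the end of a path.
extract : ∀ {n} {F : B → B → ℕ} {G : A' → A' → ℕ} (f : adj (Path (suc n)) ⊞ F ↪ adj (Path m) ⊞ G) →
          ∀ {p} → to f (inj₁ zero) ≡ inj₁ p → suc n ≤ m × (F ↪ adj (Path (m ∸ suc (suc n))) ⊞ G)
extract {B = B} {A' = A'} {m = m} {n} {F} {G} f start = n<m , rest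
  where
  pathStep : ∀ i → adj (Path (suc n)) (inject₁ i) (suc i) ≡ 1
  pathStep i = trans (cong (λ z → edge z (suc (toℕ i))) (Fin.toℕ-inject₁ i)) (edge-next (toℕ i))
  Stays : Fin (suc n) → Set
  Stays i = ∃ λ p → to f (inj₁ i) ≡ inj₁ p
  next : ∀ i → Stays (inject₁ i) → Stays (suc i)
  next i (p , e) with to f (inj₁ (suc i)) | edges f (inj₁ (inject₁ i)) (inj₁ (suc i))
  ... | inj₁ p' | _ = p' , refl
  ... | inj₂ y  | h rewrite e = contradiction (trans (sym (pathStep i)) h) λ ()
  stays : ∀ i → Stays i
  stays = <-weakInduction Stays (_ , start) next
  q : Fin (suc n) → ℕ
  q i = toℕ (proj₁ (stays i))
  q-injective : Injective _≡_ _≡_ q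
  q-injective {i} {j} e = inj₁-injective (injective f
    (trans (proj₂ (stays i)) (trans (cong inj₁ (Fin.toℕ-injective e)) (sym (proj₂ (stays j))))))
  q-step : ∀ i → edge (q (inject₁ i)) (q (suc i)) ≡ 1
  q-step i = trans (sym (trans (edges f (inj₁ (inject₁ i)) (inj₁ (suc i)))
    (cong₂ (adj (Path m) ⊞ G) (proj₂ (stays (inject₁ i))) (proj₂ (stays (suc i)))))) (pathStep i)
  interval = walk-interval n q q-injective q-step
  s = proj₁ interval
  cover = proj₁ (proj₂ interval)
  s+n<m : s + suc n ≤ m
  s+n<m = let i , e = cover n ≤-refl in subst (_≤ m) (trans (cong suc e) (sym (+-suc s n))) (Fin.toℕ<n (proj₁ (stays i)))
  n<m : suc n ≤ m
  n<m = ≤-trans (m≤n+m (suc n) s) s+n<m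
  open Excise s (suc n) s+n<m G
  away' : ∀ x y → to f (inj₂ x) ≡ y → Away⊎ y
  away' x (inj₂ y) eq = tt
  away' x (inj₁ p) eq = away-from-interval n s (toℕ p) avoid nonadjacent
    where
    avoid : ∀ t → t ≤ n → toℕ p ≢ s + t
    avoid t t≤ e = let i , h = cover t t≤ in
      contradiction (injective f {inj₂ x} {inj₁ i} (trans eq
        (trans (cong inj₁ (Fin.toℕ-injective (trans e (sym h)))) (sym (proj₂ (stays i)))))) λ ()
    nonadjacent : ∀ t → t ≤ n → edge (toℕ p) (s + t) ≢ 1
    nonadjacent t t≤ e = let i , h = cover t t≤ in
      contradiction (trans (trans (edges f (inj₂ x) (inj₁ i)) (cong₂ (adj (Path m) ⊞ G) eq (proj₂ (stays i))))
                           (trans (cong (edge (toℕ p)) h) e)) λ ()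
  away : ∀ x → Away⊎ (to f (inj₂ x))
  away x = away' x _ refl
  rest : F ↪ adj (Path (m ∸ suc (suc n))) ⊞ G
  rest = emb (λ x → close⊎ (to f (inj₂ x)) (away x))
             (λ {x} {y} e → inj₂-injective (injective f (close⊎-injective _ _ (away x) (away y) e)))
             (λ x y → trans (edges f (inj₂ x) (inj₂ y)) (close⊎-edge _ _ (away x) (away y)))

↪⇒⊑ : All (0 <_) c → E c ↪ E b → c ⊑ b
↪⇒⊑ []                             f = empty
↪⇒⊑ {c = suc n ∷ c} {b} (a>0 ∷ pos) f with locate b (to f (inj₁ zero))
... | m , d , e , g , p , eq =
  let n<m , h = extract (↪-trans f g) eq in place a>0 e n<m (↪⇒⊑ pos h)

factor : {F : A → A → ℕ} {G : B → B → ℕ} {H : A' → A' → ℕ} (f : F ↪ H) (g : G ↪ H) →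
         (∀ i → ∃ λ j → to g j ≡ to f i) → F ↪ G
factor {H = H} f g h = emb (proj₁ ∘ h)
  (λ {x} {y} e → injective f (trans (sym (proj₂ (h x))) (trans (cong (to g) e) (proj₂ (h y)))))
  (λ x y → trans (edges f x y) (trans (sym (cong₂ H (proj₂ (h x)) (proj₂ (h y)))) (sym (edges g _ _))))

splitPath-hits : ∀ (p₀ p : Fin m) → p ≢ p₀ → ∃ λ x → to (splitPath (<⇒≤ (Fin.toℕ<n p₀))) x ≡ p
splitPath-hits {m} p₀ p p≢p₀ with <-cmp (toℕ p) (toℕ p₀)
... | tri< lt _ _ = inj₁ (fromℕ< lt) , Fin.toℕ-injective (trans (Fin.toℕ-fromℕ< _) (Fin.toℕ-fromℕ< lt))
... | tri≈ _ e _  = contradiction (Fin.toℕ-injective e) p≢p₀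
... | tri> _ _ gt = inj₂ (fromℕ< lt) , Fin.toℕ-injective
      (trans (Fin.toℕ-fromℕ< _) (trans (cong (suc (toℕ p₀) +_) (Fin.toℕ-fromℕ< lt)) (m+[n∸m]≡n gt)))
  where
  lt : toℕ p ∸ suc (toℕ p₀) < m ∸ suc (toℕ p₀)
  lt = ∸-monoˡ-< (Fin.toℕ<n p) gt

deleteVertex : ∀ {d} {F : A → A → ℕ} (f : F ↪ E (m ∷ d)) (p₀ : Fin m) → (∀ i → to f i ≢ inj₁ p₀) →
               F ↪ E (toℕ p₀ ∷ m ∸ suc (toℕ p₀) ∷ d)
deleteVertex {m = m} {d} f p₀ avoids =
  factor f (↪-trans ⊞-assocˡ (⊞-map (splitPath (<⇒≤ (Fin.toℕ<n p₀))) ↪-refl)) (λ i → hit (to f i) (avoids i))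
  where
  hit : ∀ y → y ≢ inj₁ p₀ → ∃ λ x →
        to (↪-trans ⊞-assocˡ (⊞-map (splitPath (<⇒≤ (Fin.toℕ<n p₀))) (↪-refl {E = E d}))) x ≡ y
  hit (inj₂ y) _ = inj₂ (inj₂ y) , refl
  hit (inj₁ p) p≢ with splitPath-hits p₀ p (p≢ ∘ cong inj₁)
  ... | inj₁ x , e = inj₁ x , cong inj₁ e
  ... | inj₂ x , e = inj₂ (inj₁ x) , cong inj₁ e

-- An embedding that misses a vertex factors through the forest without it, in which one path has
-- broken into two. One that misses no vertex can be inverted. `N` bounds the number of vertices and
-- carries the recursion.
subgraph-of-forest : ∀ N G b → sum b ≤ N → adj G ↪ adj (Forest b) →
                     ∃ λ c → (adj G ↪ E c) × (E c ↪ adj G)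
subgraph-of-forest N G b b≤N f
  with Fin.any? (λ v → ¬? (Fin.any? (λ i → to f i Fin.≟ v)))
... | no ¬missed = b , ↪-trans f (Forest↪E b) , ↪-trans (E↪Forest b) (factor ↪-refl f hit)
  where
  hit : ∀ v → ∃ λ i → to f i ≡ v
  hit v = decidable-stable (Fin.any? (λ i → to f i Fin.≟ v)) (λ ¬h → ¬missed (v , ¬h))
... | yes (v , ¬hit) with locate b (to (Forest↪E b) v)
... | m , d , e , g , p₀ , eq = recurse N b≤N
  where
  avoids : ∀ i → to g (to (Forest↪E b) (to f i)) ≢ inj₁ p₀
  avoids i h = ¬hit (i , injective (Forest↪E b) (injective g (trans h (sym eq))))
  pieces : List ℕ
  pieces = toℕ p₀ ∷ m ∸ suc (toℕ p₀) ∷ d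
  f' : adj G ↪ adj (Forest pieces)
  f' = ↪-trans (deleteVertex (↪-trans f (↪-trans (Forest↪E b) g)) p₀ avoids) (E↪Forest pieces)
  smaller : suc (sum pieces) ≡ sum b
  smaller = trans (sym (+-assoc (suc (toℕ p₀)) (m ∸ suc (toℕ p₀)) (sum d)))
              (trans (cong (_+ sum d) (m+[n∸m]≡n (Fin.toℕ<n p₀))) (sym (sum-↭ e)))
  recurse : ∀ N → sum b ≤ N → ∃ λ c → (adj G ↪ E c) × (E c ↪ adj G)
  recurse zero    b≤0 = contradiction (subst (_≤ 0) (sym smaller) b≤0) λ ()
  recurse (suc N) b≤N = subgraph-of-forest N G pieces (s≤s⁻¹ (subst (_≤ suc N) (sym smaller) b≤N)) f'

injective⇒surjective : ∀ {n m} (f : Fin n → Fin m) → Injective _≡_ _≡_ f → m ≤ n → ∀ v → ∃ λ i → f i ≡ v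
injective⇒surjective {n} {suc m} f fi m<n v with Fin.any? (λ i → f i Fin.≟ v)
... | yes h = h
... | no ¬h = contradiction m<n (<⇒≱ (s≤s (Fin.injective⇒≤ {f = λ i → Fin.punchOut (v≢ i)}
                (λ {x} {y} e → fi (Fin.punchOut-injective (v≢ x) (v≢ y) e)))))
  where
  v≢ : ∀ i → v ≢ f i
  v≢ i e = ¬h (i , sym e)

-- The second embedding bounds the size of `H` by that of `G`, so the first one is already onto.
↪-antisym : ∀ {G H} → adj G ↪ adj H → adj H ↪ adj G → G ≅ H
↪-antisym {G} {H} f g = mk⤖ (injective f , surj) , edges f
  where
  surj : ∀ v → ∃ λ i → ∀ {j} → j ≡ i → to f j ≡ v
  surj v with i , e ← injective⇒surjective (to f) (injective f) (Fin.injective⇒≤ (injective g)) v =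
    i , λ { refl → e }

↪⇒≤ᴳ : ∀ {G H} → adj G ↪ adj H → G ≤ᴳ H
↪⇒≤ᴳ (emb f fi fe) = f , fi , fe

≤ᴳ⇒↪ : ∀ {G H} → G ≤ᴳ H → adj G ↪ adj H
≤ᴳ⇒↪ (f , fi , fe) = emb f fi fe

⊑⇒≤ᴳ : c ⊑ b → Forest c ≤ᴳ Forest b
⊑⇒≤ᴳ {c} {b} q = ↪⇒≤ᴳ {Forest c} {Forest b} (↪-trans (Forest↪E c) (↪-trans (⊑⇒↪ q) (E↪Forest b)))

≤ᴳ⇒⊑ : All (0 <_) c → Forest c ≤ᴳ Forest b → c ⊑ b
≤ᴳ⇒⊑ {c} {b} pos h =
  ↪⇒⊑ pos (↪-trans (E↪Forest c) (↪-trans (≤ᴳ⇒↪ {Forest c} {Forest b} h) (Forest↪E b)))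

≅⇒≤ᴳ : ∀ G H → G ≅ H → G ≤ᴳ H × H ≤ᴳ G
≅⇒≤ᴳ G H (f , fe) = ↪⇒≤ᴳ {G} {H} f↪ , ↪⇒≤ᴳ {H} {G} (factor ↪-refl f↪ hit)
  where
  f↪ : adj G ↪ adj H
  f↪ = emb (Bijection.to f) (Bijection.injective f) fe
  hit : ∀ v → ∃ λ i → Bijection.to f i ≡ v
  hit v = let i , h = Bijection.surjective f v in i , h refl

PathPow≡Forest : ∀ x n → PathPow x n ≡ Forest (replicate n x)
PathPow≡Forest x zero    = refl
PathPow≡Forest x (suc n) = cong (Path x ⊕_) (PathPow≡Forest x n)

-- Normal forms of linear forests

Ascending : List ℕ → Set
Ascending = Sorted ≤-totalOrder

-- Paths with one or two vertices are kept as multiplicities because the series depends on them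
-- through explicit factors. With the large parts sorted, isomorphic forests have equal canonical
-- codes.
record Code : Set where
  constructor code
  field
    large : List ℕ
    twos  : ℕ
    ones  : ℕ
open Code public

toList : Code → List ℕ
toList (code r k j) = replicate j 1 ++ replicate k 2 ++ r

Canonical : List ℕ → Set
Canonical r = Ascending r × All (3 ≤_) r

canonical-[] : Canonical []
canonical-[] = [] , []

ascending-∷ : All (a ≤_) b → Ascending b → Ascending (a ∷ b)
ascending-∷ []      _ = [-]
ascending-∷ (l ∷ _) s = l ∷ s

all-++-replicate : ∀ {P : ℕ → Set} n {x} → P x → All P b → All P (replicate n x ++ b)
all-++-replicate zero    px pb = pb
all-++-replicate (suc n) px pb = px ∷ all-++-replicate n px pb

ascending-replicate-++ : ∀ n {x} → All (x ≤_) b → Ascending b → Ascending (replicate n x ++ b)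
ascending-replicate-++ zero    _ s = s
ascending-replicate-++ (suc n) h s =
  ascending-∷ (all-++-replicate n ≤-refl h) (ascending-replicate-++ n h s)

replicate-++-injective : ∀ n n' {x} → All (x <_) b → All (x <_) b' →
  replicate n x ++ b ≡ replicate n' x ++ b' → n ≡ n' × b ≡ b'
replicate-++-injective zero    zero     _ _ e = refl , e
replicate-++-injective (suc n) (suc n') h h' e =
  let e₁ , e₂ = replicate-++-injective n n' h h' (List.∷-injectiveʳ e) in cong suc e₁ , e₂
replicate-++-injective zero    (suc n') (lt ∷ _) _ refl = contradiction lt (<-irrefl refl)
replicate-++-injective (suc n) zero     _ (lt ∷ _) refl = contradiction lt (<-irrefl refl)

toList-positive : ∀ x → Canonical (large x) → All (0 <_) (toList x)
toList-positive (code r k j) (_ , h) =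
  all-++-replicate j z<s (all-++-replicate k z<s (All.map (≤-trans (s≤s z≤n)) h))

toList-ascending : ∀ x → Canonical (large x) → Ascending (toList x)
toList-ascending (code r k j) (s , h) =
  ascending-replicate-++ j (all-++-replicate k (s≤s z≤n) (All.map (≤-trans (s≤s z≤n)) h))
    (ascending-replicate-++ k (All.map (≤-trans (s≤s (s≤s z≤n))) h) s)

no-ones : ∀ k → All (3 ≤_) b → All (1 <_) (replicate k 2 ++ b)
no-ones k h = all-++-replicate k ≤-refl (All.map (≤-trans (s≤s (s≤s z≤n))) h)

toList-injective : ∀ {x y} → Canonical (large x) → Canonical (large y) → toList x ≡ toList y → x ≡ y
toList-injective {code r k j} {code r' k' j'} (_ , h) (_ , h') e
  with e₁ , e₂ ← replicate-++-injective j j' (no-ones k h) (no-ones k' h') e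
  with e₃ , e₄ ← replicate-++-injective k k' h h' e₂
  = trans (cong (λ z → code z k j) e₄) (cong₂ (code r') e₃ e₁)

-- The vertex counts force a permutation, and sorted lists that are permutations of each other are
-- equal.
⊑-antisym : ∀ {x y} → Canonical (large x) → Canonical (large y) →
            toList x ⊑ toList y → sum (toList y) ≤ sum (toList x) → x ≡ y
⊑-antisym {x} {y} cx cy q le = toList-injective cx cy
  (Pointwise-≡⇒≡ (↗↭↗⇒≋ ≤-totalOrder (toList-ascending x cx) (toList-ascending y cy)
    (↭⇒↭ₛ (⊑∧sum-≡⇒↭ (toList-positive y cy) q le))))

-- The second alternative absorbs paths without vertices, which `deleteVertex` produces when the
-- missed vertex is an end of its path.
insertCode : ∀ a x → Canonical (large x) →
             ∃ λ y → Canonical (large y) × (a ∷ toList x ↭ toList y ⊎ a ≡ 0 × x ≡ y)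
insertCode 0 x cx = x , cx , inj₂ (refl , refl)
insertCode 1 (code r k j) cx = code r k (suc j) , cx , inj₁ ↭-refl
insertCode 2 (code r k j) cx = code r (suc k) j , cx , inj₁ (↭-sym (shift 2 (replicate j 1) _))
insertCode a@(suc (suc (suc _))) (code r k j) (s , h) =
  code (sort (a ∷ r)) k j , (sort-↗ (a ∷ r) , All-resp-↭ (↭-sym (sort-↭ (a ∷ r))) (s≤s (s≤s (s≤s z≤n)) ∷ h)) ,
  inj₁ (↭-trans (↭-sym (shift a (replicate j 1) _))
         (++⁺ˡ (replicate j 1) (↭-trans (↭-sym (shift a (replicate k 2) r))
           (++⁺ˡ (replicate k 2) (↭-sym (sort-↭ (a ∷ r)))))))

codeOf : ∀ c → ∃ λ x → Canonical (large x) × (E c ↪ E (toList x)) × (E (toList x) ↪ E c)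
codeOf []      = code [] 0 0 , canonical-[] , ↪-refl , ↪-refl
codeOf (a ∷ c) with x , cx , f , g ← codeOf c with insertCode a x cx
... | y , cy , inj₁ p = y , cy , ↪-trans (⊞-map ↪-refl f) (↭⇒↪ p) , ↪-trans (↭⇒↪ (↭-sym p)) (⊞-map ↪-refl g)
... | y , cy , inj₂ (refl , refl) =
  y , cy , ↪-trans (emb (λ { (inj₂ v) → v }) (λ { {inj₂ _} {inj₂ _} → cong inj₂ }) (λ { (inj₂ _) (inj₂ _) → refl })) f ,
           ↪-trans g (emb inj₂ inj₂-injective (λ _ _ → refl))

classify : ∀ {G} → G ≤ᴳ Forest b → ∃ λ x → Canonical (large x) × G ≅ Forest (toList x)
classify {b} {G} h with c , f , g ← subgraph-of-forest (sum b) G b ≤-refl (≤ᴳ⇒↪ {G} {Forest b} h)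
  with x , cx , f' , g' ← codeOf c =
  x , cx , ↪-antisym {G} {Forest (toList x)}
    (↪-trans f (↪-trans f' (E↪Forest _))) (↪-trans (Forest↪E _) (↪-trans g' g))

-- Finite sums and power series

infixr 7 _·_

-- An Iverson bracket. Taking booleans instead of decisions lets equivalent conditions be exchanged
-- by `does-⇔`.
_·_ : Bool → ℤ → ℤ
true  · z = z
false · z = 0ℤ

·-zero : ∀ p → p · 0ℤ ≡ 0ℤ
·-zero true  = refl
·-zero false = refl

·-neg : ∀ p z → p · (- z) ≡ - (p · z)
·-neg true  z = refl
·-neg false z = refl

·-+ : ∀ p y z → p · (y ⊹ z) ≡ p · y ⊹ p · z
·-+ true  y z = refl
·-+ false y z = refl

∑ : List A → (A → ℤ) → ℤ
∑ xs f = sumℤ (map f xs)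

module _ {f g : A → ℤ} where

  ∑-cong : (∀ {x} → x ∈ xs → f x ≡ g x) → ∑ xs f ≡ ∑ xs g
  ∑-cong {xs = []}     h = refl
  ∑-cong {xs = x ∷ xs} h = cong₂ _⊹_ (h (here refl)) (∑-cong (h ∘ there))

∑-zero : {f : A → ℤ} → (∀ {x} → x ∈ xs → f x ≡ 0ℤ) → ∑ xs f ≡ 0ℤ
∑-zero {xs = []}     h = refl
∑-zero {xs = x ∷ xs} h = cong₂ _⊹_ (h (here refl)) (∑-zero (h ∘ there))

∑-+ : ∀ xs (f g : A → ℤ) → ∑ xs (λ x → f x ⊹ g x) ≡ ∑ xs f ⊹ ∑ xs g
∑-+ []       f g = refl
∑-+ (x ∷ xs) f g = trans (cong (f x ⊹ g x ⊹_) (∑-+ xs f g)) (interchange (f x) (g x) _ _)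
  where
  interchange : ∀ a b c d → (a ⊹ b) ⊹ (c ⊹ d) ≡ (a ⊹ c) ⊹ (b ⊹ d)
  interchange = solve-∀

∑-neg : ∀ xs (f : A → ℤ) → ∑ xs (λ x → - f x) ≡ - ∑ xs f
∑-neg []       f = refl
∑-neg (x ∷ xs) f = trans (cong (- f x ⊹_) (∑-neg xs f)) (sym (ℤ.neg-distrib-+ (f x) _))

∑-++ : ∀ xs ys (f : A → ℤ) → ∑ (xs ++ ys) f ≡ ∑ xs f ⊹ ∑ ys f
∑-++ []       ys f = sym (ℤ.+-identityˡ _)
∑-++ (x ∷ xs) ys f = trans (cong (f x ⊹_) (∑-++ xs ys f)) (sym (ℤ.+-assoc (f x) _ _))

∑-map : ∀ xs (g : A → B) (f : B → ℤ) → ∑ (map g xs) f ≡ ∑ xs (f ∘ g)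
∑-map xs g f = cong sumℤ (sym (List.map-∘ xs))

∑-filter : ∀ {P : A → Set} (P? : Decidable P) xs (f : A → ℤ) →
           ∑ (filter P? xs) f ≡ ∑ xs (λ x → does (P? x) · f x)
∑-filter P? []       f = refl
∑-filter P? (x ∷ xs) f with P? x
... | yes _ = cong (f x ⊹_) (∑-filter P? xs f)
... | no _  = trans (∑-filter P? xs f) (sym (ℤ.+-identityˡ _))

∑-cartesianProduct : ∀ (xs : List A) (ys : List B) f →
                     ∑ (cartesianProduct xs ys) f ≡ ∑ xs (λ x → ∑ ys (λ y → f (x , y)))
∑-cartesianProduct []       ys f = refl
∑-cartesianProduct (x ∷ xs) ys f = trans (∑-++ (map (x ,_) ys) _ f)
  (cong₂ _⊹_ (∑-map ys (x ,_) f) (∑-cartesianProduct xs ys f))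

∑-single : ∀ {x} {f : A → ℤ} → Unique xs → x ∈ xs → (∀ {y} → y ∈ xs → y ≢ x → f y ≡ 0ℤ) → ∑ xs f ≡ f x
∑-single {f = f} (x∉ ∷ u) (here refl) h =
  trans (cong (f _ ⊹_) (∑-zero (λ y∈ → h (there y∈) (λ { refl → All.lookup x∉ y∈ refl })))) (ℤ.+-identityʳ _)
∑-single (y∉ ∷ u) (there x∈) h =
  trans (cong₂ _⊹_ (h (here refl) (λ { refl → All.lookup y∉ x∈ refl })) (∑-single u x∈ (h ∘ there))) (ℤ.+-identityˡ _)

∑-↭ : ∀ {f : A → ℤ} → xs ↭ ys → ∑ xs f ≡ ∑ ys f
∑-↭ _↭_.refl = refl
∑-↭ {f = f} (_↭_.prep x p) = cong (f x ⊹_) (∑-↭ p)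
∑-↭ {f = f} (_↭_.swap x y p) = trans (cong (λ z → f x ⊹ (f y ⊹ z)) (∑-↭ p)) (exchange (f x) (f y) _)
  where
  exchange : ∀ a b c → a ⊹ (b ⊹ c) ≡ b ⊹ (a ⊹ c)
  exchange = solve-∀
∑-↭ (_↭_.trans p q) = trans (∑-↭ p) (∑-↭ q)

∑-unique : ∀ {f : A → ℤ} → Unique xs → Unique ys →
           (∀ {x} → x ∈ xs → x ∈ ys) → (∀ {x} → x ∈ ys → x ∈ xs) → ∑ xs f ≡ ∑ ys f
∑-unique u v xs⊆ys ys⊆xs = ∑-↭ (∼bag⇒↭ (unique∧set⇒bag u v (mk⇔ xs⊆ys ys⊆xs)))

∑-upTo-first : ∀ n f → ∑ (upTo (suc n)) f ≡ f 0 ⊹ ∑ (upTo n) (f ∘ suc)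
∑-upTo-first n f = cong (λ z → f 0 ⊹ sumℤ z)
  (trans (List.map-applyUpTo suc f n) (sym (List.map-applyUpTo (λ z → z) (f ∘ suc) n)))

∑-upTo-last : ∀ n f → ∑ (upTo (suc n)) f ≡ ∑ (upTo n) f ⊹ f n
∑-upTo-last zero    f = ℤ.+-comm (f 0) 0ℤ
∑-upTo-last (suc n) f = begin
  ∑ (upTo (suc (suc n))) f                      ≡⟨ ∑-upTo-first (suc n) f ⟩
  f 0 ⊹ ∑ (upTo (suc n)) (f ∘ suc)              ≡⟨ cong (f 0 ⊹_) (∑-upTo-last n (f ∘ suc)) ⟩
  f 0 ⊹ (∑ (upTo n) (f ∘ suc) ⊹ f (suc n))      ≡⟨ ℤ.+-assoc (f 0) _ _ ⟨
  f 0 ⊹ ∑ (upTo n) (f ∘ suc) ⊹ f (suc n)        ≡⟨ cong (_⊹ f (suc n)) (∑-upTo-first n f) ⟨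
  ∑ (upTo (suc n)) f ⊹ f (suc n)                ∎
  where open ≡-Reasoning

-- Sequences stand for power series in t, with sh the multiplication by t.

Seq : Set
Seq = ℕ → ℤ

sh : Seq → Seq
sh h zero    = 0ℤ
sh h (suc n) = h n

sh-cong : ∀ {g h} n → (∀ i → g i ≡ h i) → sh g n ≡ sh h n
sh-cong zero    e = refl
sh-cong (suc n) e = e n

sh-zero : ∀ n → sh (λ _ → 0ℤ) n ≡ 0ℤ
sh-zero zero    = refl
sh-zero (suc n) = refl

-- Multiplication by 1 , t − 1 , t(t − 1) , t²(t − 1) , …, whose partial sums are 1 , t , t² , …

ladder : ℕ → Seq → Seq
ladder zero          h   = h
ladder (suc zero)    h n = sh h n - h n
ladder (suc (suc j)) h   = sh (ladder (suc j) h)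

-- The inner part of an ideal sum, over the number `j` of isolated vertices; `P j` will say whether
-- the forest with `j` of them fits.
tally : ℕ → (ℕ → Bool) → Seq → Seq
tally M P h n = ∑ (upTo M) (λ j → P j · ladder j h n)

tally-cong : ∀ M {P Q h n} → (∀ j → P j ≡ Q j) → tally M P h n ≡ tally M Q h n
tally-cong M {h = h} {n} e = ∑-cong {xs = upTo M} (λ {j} _ → cong (_· ladder j h n) (e j))

tally-none : ∀ M {P h n} → (∀ j → P j ≡ false) → tally M P h n ≡ 0ℤ
tally-none M {h = h} {n} e = ∑-zero {xs = upTo M} (λ {j} _ → cong (_· ladder j h n) (e j))

tally-extend : ∀ M P h n → P M ≡ false → tally (suc M) P h n ≡ tally M P h n
tally-extend M P h n e = trans (∑-upTo-last M _)
  (trans (cong (λ p → tally M P h n ⊹ p · ladder M h n) e) (ℤ.+-identityʳ _))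

-- `ladder (suc j)` is `sh` of `ladder j` except at `j ≡ 0`, where an extra `- h` appears. Pulling
-- out one `sh` therefore leaves only the difference of the first two brackets.
tally-peel : ∀ M P h n → tally (suc (suc M)) P h n ≡
             sh (tally (suc M) (P ∘ suc) h) n ⊹ (P 0 · h n - P 1 · h n)
tally-peel M P h n = trans (∑-upTo-first (suc M) (λ j → P j · ladder j h n))
  (trans (cong (P 0 · h n ⊹_) (∑-upTo-first M (λ j → P (suc j) · ladder (suc j) h n))) (step n))
  where
  alg : ∀ x y r → x ⊹ ((0ℤ ⊹ - y) ⊹ r) ≡ r ⊹ (x - y)
  alg = solve-∀
  alg' : ∀ x y z r → x ⊹ ((z ⊹ - y) ⊹ r) ≡ (z ⊹ r) ⊹ (x - y)
  alg' = solve-∀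
  step : ∀ n → P 0 · h n ⊹ (P 1 · (sh h n - h n) ⊹ ∑ (upTo M) (λ j → P (suc (suc j)) · sh (ladder (suc j) h) n)) ≡
               sh (tally (suc M) (P ∘ suc) h) n ⊹ (P 0 · h n - P 1 · h n)
  step zero = trans (cong₂ (λ u v → P 0 · h 0 ⊹ (u ⊹ v))
      (trans (·-+ (P 1) 0ℤ (- h 0)) (cong₂ _⊹_ (·-zero (P 1)) (·-neg (P 1) (h 0))))
      (∑-zero {xs = upTo M} (λ {j} _ → ·-zero (P (suc (suc j))))))
    (alg (P 0 · h 0) (P 1 · h 0) 0ℤ)
  step (suc n) = trans (cong (λ u → P 0 · h (suc n) ⊹ (u ⊹ rest))
      (trans (·-+ (P 1) (h n) (- h (suc n))) (cong (P 1 · h n ⊹_) (·-neg (P 1) (h (suc n))))))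
    (trans (alg' (P 0 · h (suc n)) (P 1 · h (suc n)) (P 1 · h n) rest)
      (cong (_⊹ (P 0 · h (suc n) - P 1 · h (suc n))) (sym (∑-upTo-first M (λ j → P (suc j) · ladder j h n)))))
    where
    rest = ∑ (upTo M) (λ j → P (suc (suc j)) · ladder (suc j) h n)

-- `Q` is `P` with its first value repeated, so the difference left by `tally-peel` cancels.
tally-shift : ∀ M P Q h → Q 0 ≡ P 0 → (∀ j → Q (suc j) ≡ P j) →
              ∀ n → tally (suc (suc M)) Q h n ≡ sh (tally (suc M) P h) n
tally-shift M P Q h e₀ e n = trans (tally-peel M Q h n)
  (trans (cong₂ _⊹_ (sh-cong n (λ _ → tally-cong (suc M) e)) (trans (cong₂ (λ p q → p · h n - q · h n) e₀ (e 0)) (ℤ.+-inverseʳ (P 0 · h n)))) (ℤ.+-identityʳ _))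

Vanishes : ℕ → Seq → Set
Vanishes s h = ∀ {i} → i < s → h i ≡ 0ℤ

ladder-vanishes : ∀ j {s h} → Vanishes s h → Vanishes s (ladder j h)
ladder-vanishes zero          v n<s = v n<s
ladder-vanishes (suc zero)    v {zero}  n<s = trans (ℤ.+-identityˡ _) (cong -_ (v n<s))
ladder-vanishes (suc zero)    v {suc n} n<s = cong₂ _-_ (v (<⇒≤ n<s)) (v n<s)
ladder-vanishes (suc (suc j)) v {zero}  n<s = refl
ladder-vanishes (suc (suc j)) v {suc n} n<s = ladder-vanishes (suc j) v (<⇒≤ n<s)

tally-vanishes : ∀ M P {s h} → Vanishes s h → Vanishes s (tally M P h)
tally-vanishes M P v n<s = ∑-zero {xs = upTo M}
  (λ {j} _ → trans (cong (P j ·_) (ladder-vanishes j v n<s)) (·-zero (P j)))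

sh-vanishes : ∀ {s h} → Vanishes s h → Vanishes (suc s) (sh h)
sh-vanishes v {zero}  _         = refl
sh-vanishes v {suc n} (s≤s n<s) = v n<s

tally-lowest : ∀ M P {s h} → Vanishes s h → tally (suc (suc M)) P h s ≡ P 0 · h s - P 1 · h s
tally-lowest M P {s} {h} v = trans (tally-peel M P h s)
  (trans (cong (_⊹ (P 0 · h s - P 1 · h s)) (sh-vanishes (tally-vanishes (suc M) (P ∘ suc) v) ≤-refl)) (ℤ.+-identityˡ _))

-- The ladder factors with indices up to `k` add up to t^k, and every later one is divisible by t^k.
tally-true : ∀ k M {P s h} → Vanishes s h → (∀ {j} → j ≤ k → P j ≡ true) → k < M →
             Vanishes (s + k) (tally M P h)
tally-true zero    M {P} {s} v t _ n< = tally-vanishes M P v (subst (_ <_) (+-identityʳ s) n<)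
tally-true (suc k) (suc (suc M)) {P} {s} {h} v t (s≤s k<M) {n} n< = trans (tally-peel M P h n)
  (cong₂ _⊹_
    (sh-vanishes (tally-true k (suc M) v (t ∘ s≤s) k<M) (subst (n <_) (+-suc s k) n<))
    (trans (cong₂ (λ p q → p · h n - q · h n) (t z≤n) (t (s≤s z≤n))) (ℤ.+-inverseʳ (h n))))

-- The Möbius function of linear forests

-- A single vertex placed in `m` leaves `m ∸ 2`; joined to a path with one vertex, this gives `m`
-- back. For `m ≡ 1` the leftover is truncated to 0 and is simply dropped.
restore-two : 0 < m → c ⊑ m ∸ 2 ∷ 1 ∷ b → c ⊑ m ∷ b
restore-two {suc zero}    _ q = ⊑-dropBin (⊑-positive q) q
restore-two {suc (suc m)} {c} {b} _ q =
  subst (λ z → c ⊑ suc z ∷ b) (+-comm m 1) (⊑-mergeBins m 1 q)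

-- An exchange argument: if the vertex sits in another path, whatever uses the bin 1 can move to
-- where that vertex was.
one-in-one : 1 ∷ c ⊑ 1 ∷ b → c ⊑ b
one-in-one (place {m = m} _ e l q) with split-↭ e
... | inj₁ (refl , p)   = ⊑-resp-↭ (↭-sym p) (⊑-dropBin (⊑-positive q) q)
... | inj₂ (_ , p , p') = ⊑-resp-↭ (↭-sym p) (restore-two l (⊑-resp-↭ (↭-prep _ p') q))

-- A path with two vertices has no room for two isolated ones, so without parts 2 it serves only as
-- a single vertex.
two-as-one : All (_≢ 2) c → c ⊑ 2 ∷ b → c ⊑ 1 ∷ b
two-as-one [] q = empty
two-as-one {a ∷ c} (a≢2 ∷ h) (place a>0 e l q) with split-↭ e
... | inj₂ (_ , p , p') =
  place a>0 (push-↭ p) l (⊑-swapBins (two-as-one h (⊑-swapBins (⊑-resp-↭ (↭-prep _ p') q))))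
... | inj₁ (refl , p) with a | a>0 | l | a≢2
... | suc zero          | _ | _             | _   = place z<s ↭-refl ≤-refl (⊑-resp-↭ (↭-prep _ (↭-sym p)) q)
... | suc (suc zero)    | _ | _             | 2≢2 = contradiction refl 2≢2
... | suc (suc (suc _)) | _ | s≤s (s≤s ()) | _

one-in-two : All (_≢ 2) c → 1 ∷ c ⊑ 2 ∷ b → c ⊑ b
one-in-two h (place {m = m} _ e l q) with split-↭ e
... | inj₁ (refl , p)   = ⊑-resp-↭ (↭-sym p) (⊑-dropBin (⊑-positive q) q)
... | inj₂ (_ , p , p') = ⊑-resp-↭ (↭-sym p) (restore-two l
        (⊑-swapBins (two-as-one h (⊑-swapBins (⊑-resp-↭ (↭-prep _ p') q)))))

≤ᴳ-trans : ∀ {G H K} → G ≤ᴳ H → H ≤ᴳ K → G ≤ᴳ K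
≤ᴳ-trans (f , fi , fe) (g , gi , ge) = g ∘ f , fi ∘ gi , λ i j → trans (fe i j) (ge (f i) (f j))

-- Composing packings directly would mean regrouping parts and separators; composing graph
-- embeddings avoids this.
⊑-trans : c ⊑ b → b ⊑ d → c ⊑ d
⊑-trans {c} {b} {d} p q = ≤ᴳ⇒⊑ (⊑-positive p)
  (≤ᴳ-trans {Forest c} {Forest b} {Forest d} (⊑⇒≤ᴳ p) (⊑⇒≤ᴳ q))

-- Finite enumerations of codes

boundedLists : ℕ → ℕ → List (List ℕ)
boundedLists zero    M = [] ∷ []
boundedLists (suc L) M = [] ∷ cartesianProductWith _∷_ (upTo (suc M)) (boundedLists L M)

∈-boundedLists : ∀ L {M} → All (0 <_) c → sum c ≤ L → L ≤ M → c ∈ boundedLists L M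
∈-boundedLists zero    []  _ _ = here refl
∈-boundedLists (suc L) []  _ _ = here refl
∈-boundedLists zero    (a>0 ∷ _) s≤0 _ = contradiction (≤-trans (m≤m+n _ _) s≤0) (<⇒≱ a>0)
∈-boundedLists {a ∷ c} (suc L) (a>0 ∷ pos) s≤L L≤M = there (∈-cartesianProductWith⁺ _∷_
  (∈-upTo⁺ (s≤s (≤-trans (≤-trans (m≤m+n a (sum c)) s≤L) L≤M)))
  (∈-boundedLists L pos (s≤s⁻¹ (≤-trans (+-monoˡ-≤ (sum c) a>0) s≤L)) (≤-trans (n≤1+n L) L≤M)))

canonical? : ∀ r → Dec (Canonical r)
canonical? r = sorted? ≤-totalOrder _≤?_ r ×-dec All.all? (3 ≤?_) r

larges : ℕ → List (List ℕ)
larges N = deduplicate (List.≡-dec _≟_) (filter canonical? (boundedLists N N))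

larges-unique : ∀ N → Unique (larges N)
larges-unique N = deduplicate-! _

∈-larges⁻ : ∀ N → r ∈ larges N → Canonical r
∈-larges⁻ N r∈ =
  proj₂ (∈-filter⁻ canonical? {xs = boundedLists N N} (∈-deduplicate⁻ (List.≡-dec _≟_) _ r∈))

∈-larges⁺ : ∀ N → Canonical r → sum r ≤ N → r ∈ larges N
∈-larges⁺ N cr@(_ , h) s≤N = ∈-deduplicate⁺ (List.≡-dec _≟_)
  (∈-filter⁺ canonical? (∈-boundedLists N (All.map (≤-trans (s≤s z≤n)) h) s≤N ≤-refl) cr)

-- One value more than a forest with at most `N` vertices can use. The term at `suc N` vanishes by
-- `fits-bounded`, which makes shifting the index by one possible.
range : ℕ → List ℕ
range N = upTo (suc (suc N))

private
  uncurryCode : List ℕ × ℕ × ℕ → Code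
  uncurryCode (r , k , j) = code r k j

universe : ℕ → List Code
universe N = map uncurryCode (cartesianProduct (larges N) (cartesianProduct (range N) (range N)))

∑-universe : ∀ N f → ∑ (universe N) f ≡
             ∑ (larges N) (λ r → ∑ (range N) (λ k → ∑ (range N) (λ j → f (code r k j))))
∑-universe N f = trans (∑-map (cartesianProduct (larges N) _) uncurryCode f)
  (trans (∑-cartesianProduct (larges N) (cartesianProduct (range N) (range N)) (f ∘ uncurryCode))
    (∑-cong {xs = larges N} (λ {r} _ → ∑-cartesianProduct (range N) (range N) (λ (k , j) → f (code r k j)))))

universe-unique : ∀ N → Unique (universe N)
universe-unique N = Unique.map⁺ (λ { {_ , _ , _} {_ , _ , _} refl → refl })
  (Unique.cartesianProduct⁺ (larges-unique N) (Unique.cartesianProduct⁺ (Unique.upTo⁺ (suc (suc N))) (Unique.upTo⁺ (suc (suc N)))))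

∈-universe⁻ : ∀ N {x} → x ∈ universe N → Canonical (large x)
∈-universe⁻ N x∈ with (r , k , j) , rkj∈ , refl ← ∈-map⁻ uncurryCode x∈ =
  ∈-larges⁻ N (proj₁ (∈-cartesianProduct⁻ (larges N) _ rkj∈))

≤-sum-replicate : ∀ n a b → n ≤ sum (replicate n (suc a) ++ b)
≤-sum-replicate zero    a b = z≤n
≤-sum-replicate (suc n) a b = s≤s (≤-trans (≤-sum-replicate n a b) (m≤n+m _ a))

sum-++-≥ : ∀ n a b → sum b ≤ sum (replicate n a ++ b)
sum-++-≥ zero    a b = ≤-refl
sum-++-≥ (suc n) a b = ≤-trans (sum-++-≥ n a b) (m≤n+m _ a)

∈-universe⁺ : ∀ N x → Canonical (large x) → sum (toList x) ≤ N → x ∈ universe N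
∈-universe⁺ N (code r k j) cx s≤N = ∈-map⁺ uncurryCode
  (∈-cartesianProduct⁺ (∈-larges⁺ N cx (≤-trans (sum-++-≥ k 2 r) rest))
    (∈-cartesianProduct⁺ (∈-upTo⁺ (m≤n⇒m≤1+n (s≤s (≤-trans (≤-sum-replicate k 1 r) rest))))
                         (∈-upTo⁺ (m≤n⇒m≤1+n (s≤s (≤-trans (≤-sum-replicate j 0 (replicate k 2 ++ r)) s≤N))))))
  where
  rest : sum (replicate k 2 ++ r) ≤ N
  rest = ≤-trans (sum-++-≥ j 1 (replicate k 2 ++ r)) s≤N

_≟ᶜ_ : DecidableEquality Code
code r k j ≟ᶜ code r' k' j' with List.≡-dec _≟_ r r' | k ≟ k' | j ≟ j'
... | yes refl | yes refl | yes refl = yes refl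
... | no ≢     | _        | _        = no λ { refl → ≢ refl }
... | _        | no ≢     | _        = no λ { refl → ≢ refl }
... | _        | _        | no ≢     = no λ { refl → ≢ refl }

infix 4 _⊑ᶜ_ _⊑ᶜ?_

_⊑ᶜ_ : Code → Code → Set
x ⊑ᶜ y = toList x ⊑ toList y

_⊑ᶜ?_ : ∀ x y → Dec (x ⊑ᶜ y)
x ⊑ᶜ? y = toList x ⊑? toList y

≤ᴳ⇒⊑ᶜ : ∀ x y → Canonical (large x) → Forest (toList x) ≤ᴳ Forest (toList y) → x ⊑ᶜ y
≤ᴳ⇒⊑ᶜ x y cx = ≤ᴳ⇒⊑ {toList x} {toList y} (toList-positive x cx)

bot : ℕ → Code
bot n = code [] 0 n

-- As a series, t^j for the forest of `j` isolated vertices and 0 for any other canonical code;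
-- these are the prescribed ideal sums.
δ : Code → Seq
δ x n = does (x ≟ᶜ bot n) · 1ℤ

δ-≢ : ∀ {x n} → x ≢ bot n → δ x n ≡ 0ℤ
δ-≢ {x} {n} x≢ = cong (_· 1ℤ) (dec-false (x ≟ᶜ bot n) x≢)

δ-sh : ∀ r j n → sh (δ (code r 0 j)) n ≡ δ (code r 0 (suc j)) n
δ-sh r j zero    = sym (δ-≢ {code r 0 (suc j)} {0} λ ())
δ-sh r j (suc n) = cong (_· 1ℤ) (does-⇔ (mk⇔ (λ { refl → refl }) (λ { refl → refl }))
                     (code r 0 j ≟ᶜ bot n) (code r 0 (suc j) ≟ᶜ bot (suc n)))

≅-refl : ∀ {G} → G ≅ G
≅-refl = mk⤖ (id , λ y → y , id) , λ _ _ → refl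

allPairs-map : ∀ {A : Set} {P : A → Set} {R S : A → A → Set} {xs : List A} →
               (∀ {x y} → P x → P y → R x y → S x y) → All P xs → AllPairs R xs → AllPairs S xs
allPairs-map f []       []        = []
allPairs-map f (p ∷ ps) (rs ∷ rss) =
  All.map (λ (q , r) → f p q r) (All.zip (ps , rs)) ∷ allPairs-map f ps rss

⊑ᶜ-strict : ∀ {x y} → Canonical (large x) → Canonical (large y) → y ⊑ᶜ x → y ≢ x →
            sum (toList y) < sum (toList x)
⊑ᶜ-strict cx cy q y≢x = ≰⇒> λ le → y≢x (⊑-antisym cy cx q le)

∑-agree : ∀ {X : Set} {xs : List X} {x} {f g : X → ℤ} → Unique xs → x ∈ xs →
          (∀ {y} → y ∈ xs → y ≢ x → f y ≡ g y) → ∑ xs f ≡ ∑ xs g → f x ≡ g x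
∑-agree {xs = xs} {x} {f} {g} u x∈ h e = ℤ.i-j≡0⇒i≡j (f x) (g x) (begin
  f x - g x                    ≡⟨ ∑-single {f = λ y → f y - g y} u x∈ (λ y∈ y≢ → ℤ.i≡j⇒i-j≡0 (h y∈ y≢)) ⟨
  ∑ xs (λ y → f y - g y)       ≡⟨ ∑-+ xs f (λ y → - g y) ⟩
  ∑ xs f ⊹ ∑ xs (λ y → - g y)  ≡⟨ cong (∑ xs f ⊹_) (∑-neg xs g) ⟩
  ∑ xs f - ∑ xs g              ≡⟨ ℤ.i≡j⇒i-j≡0 e ⟩
  0ℤ                           ∎)
  where open ≡-Reasoning

-- Adding paths with one or two vertices to the larger forest

fits : List ℕ → ℕ → Code → ℕ → Bool
fits r k x j = does (code r k j ⊑ᶜ? x)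

two-first : ∀ r k j → toList (code r (suc k) j) ↭ 2 ∷ toList (code r k j)
two-first r k j = shift 2 (replicate j 1) (replicate k 2 ++ r)

fits-⇔ : ∀ x y x' y' → (x ⊑ᶜ y → x' ⊑ᶜ y') → (x' ⊑ᶜ y' → x ⊑ᶜ y) → does (x ⊑ᶜ? y) ≡ does (x' ⊑ᶜ? y')
fits-⇔ x y x' y' f g = does-⇔ (mk⇔ f g) (x ⊑ᶜ? y) (x' ⊑ᶜ? y')

module _ {r' : List ℕ} (cr' : Canonical r') where

  private
    no-twos : ∀ j → All (_≢ 2) (toList (code r' 0 j))
    no-twos j = all-++-replicate j (λ ()) (All.map (λ l → <⇒≢ l ∘ sym) (proj₂ cr'))

  -- In one direction the part 2 shrinks to 1. In the other, `one-in-two` frees the bin 2 at the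
  -- cost of one isolated vertex, and that bin then takes the part 2.
  fits-two : ∀ r k j i → fits r' 1 (code r (suc k) j) i ≡ fits r' 0 (code r (suc k) j) (suc i)
  fits-two r k j i = fits-⇔ (code r' 1 i) x (code r' 0 (suc i)) x
    (λ q → ⊑-shrinkPart z<s (n≤1+n 1) (⊑-permute (two-first r' 0 i) q))
    (λ q → ⊑-permute (↭-sym (two-first r' 0 i)) (⊑-resp-↭ (↭-sym (two-first r k j))
             (⊑-∷ z<s ≤-refl (one-in-two (no-twos i) (⊑-resp-↭ (two-first r k j) q)))))
    where
    x = code r (suc k) j

  -- The bin 2 is too short for large parts, hence free for one more vertex.
  fits-two-first : ∀ r k j → fits r' 0 (code r (suc k) j) 0 ≡ fits r' 0 (code r (suc k) j) 1
  fits-two-first r k j = fits-⇔ (code r' 0 0) x (code r' 0 1) x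
    (λ q → ⊑-resp-↭ (↭-sym (two-first r k j))
             (⊑-∷ z<s (n≤1+n 1) (⊑-dropBin (proj₂ cr') (⊑-resp-↭ (two-first r k j) q))))
    ⊑-tail
    where
    x = code r (suc k) j

  fits-one-first : ∀ k r j → fits r' k (code r 0 (suc j)) 0 ≡ fits r' k (code r 0 j) 0
  fits-one-first k r j = fits-⇔ (code r' k 0) (code r 0 (suc j)) (code r' k 0) (code r 0 j)
    (⊑-dropBin (no-ones k (proj₂ cr'))) (⊑-addBin 1)

fits-one : ∀ r' k r j i → fits r' k (code r 0 (suc j)) (suc i) ≡ fits r' k (code r 0 j) i
fits-one r' k r j i = fits-⇔ (code r' k (suc i)) (code r 0 (suc j)) (code r' k i) (code r 0 j)
  one-in-one (⊑-∷ z<s ≤-refl)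

fits-bounded : ∀ r k x {N} → sum (toList x) ≤ N → fits r k x (suc N) ≡ false
fits-bounded r k x {N} x≤N = dec-false (code r k (suc N) ⊑ᶜ? x) λ q →
  <⇒≱ (s≤s x≤N) (≤-trans (≤-sum-replicate (suc N) 0 (replicate k 2 ++ r)) (⊑⇒sum-≤ q))

twist : ℕ → Seq → Seq
twist zero          h   = h
twist (suc zero)    h n = - sh h n
twist (suc (suc _)) h n = 0ℤ

-- The contribution of all codes with large part r to an ideal sum, if f (code r k j) = twist k (ladder j h).

share : ℕ → List ℕ → Seq → Code → Seq
share N r h x n = tally (suc (suc N)) (fits r 0 x) h n - sh (tally (suc (suc N)) (fits r 1 x) h) n

∑-twist : ∀ N r h x n → ∑ (range N) (λ k → ∑ (range N) (λ j → fits r k x j · twist k (ladder j h) n)) ≡ share N r h x n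
∑-twist N r h x n = begin
  ∑ (range N) g                              ≡⟨ ∑-upTo-first (suc N) g ⟩
  g 0 ⊹ ∑ (upTo (suc N)) (g ∘ suc)           ≡⟨ cong (g 0 ⊹_) (∑-upTo-first N (g ∘ suc)) ⟩
  g 0 ⊹ (g 1 ⊹ ∑ (upTo N) (λ k → g (2 + k)))   ≡⟨ cong₂ (λ u v → g 0 ⊹ (u ⊹ v)) (second n) rest ⟩
  g 0 ⊹ (- sh (tally (suc (suc N)) (fits r 1 x) h) n ⊹ 0ℤ) ≡⟨ cong (g 0 ⊹_) (ℤ.+-identityʳ _) ⟩
  share N r h x n                            ∎
  where
  open ≡-Reasoning
  g : ℕ → ℤ
  g k = ∑ (range N) (λ j → fits r k x j · twist k (ladder j h) n)
  rest : ∑ (upTo N) (λ k → g (2 + k)) ≡ 0ℤ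
  rest = ∑-zero {xs = upTo N} (λ {k} _ → ∑-zero {xs = range N} (λ {j} _ → ·-zero (fits r (suc (suc k)) x j)))
  second : ∀ n → ∑ (range N) (λ j → fits r 1 x j · (- sh (ladder j h) n)) ≡ - sh (tally (suc (suc N)) (fits r 1 x) h) n
  second zero    = ∑-zero {xs = range N} (λ {j} _ → ·-zero (fits r 1 x j))
  second (suc n) = trans (∑-cong {xs = range N} (λ {j} _ → ·-neg (fits r 1 x j) (ladder j h n)))
                         (∑-neg (range N) (λ j → fits r 1 x j · ladder j h n))

-- Contributions with one part 2 cancel those with none: by `fits-two` the brackets agree after an
-- index shift, and the factor -t supplies the matching shift in degree.
share-two : ∀ N {r'} h r k j n → Canonical r' → sum (toList (code r (suc k) j)) ≤ N →
            share N r' h (code r (suc k) j) n ≡ 0ℤ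
share-two N {r'} h r k j n cr' x≤N = ℤ.i≡j⇒i-j≡0 (begin
  tally (suc (suc N)) (fits r' 0 x) h n
    ≡⟨ tally-peel N (fits r' 0 x) h n ⟩
  sh (tally (suc N) (fits r' 0 x ∘ suc) h) n ⊹ (fits r' 0 x 0 · h n - fits r' 0 x 1 · h n)
    ≡⟨ cong₂ _⊹_ (shifted n) (ℤ.i≡j⇒i-j≡0 (cong (_· h n) (fits-two-first cr' r k j))) ⟩
  sh (tally (suc (suc N)) (fits r' 1 x) h) n ⊹ 0ℤ
    ≡⟨ ℤ.+-identityʳ _ ⟩
  sh (tally (suc (suc N)) (fits r' 1 x) h) n ∎)
  where
  open ≡-Reasoning
  x = code r (suc k) j
  shifted : ∀ n → sh (tally (suc N) (fits r' 0 x ∘ suc) h) n ≡ sh (tally (suc (suc N)) (fits r' 1 x) h) n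
  shifted zero    = refl
  shifted (suc n) = trans (tally-cong (suc N) (λ i → sym (fits-two cr' r k j i)))
                          (sym (tally-extend (suc N) (fits r' 1 x) h n (fits-bounded r' 1 x x≤N)))

-- `fits-one` and `fits-one-first` say that the fitting predicate gets its first value repeated,
-- which is the situation of `tally-shift`.
share-one : ∀ N {r'} h r j n → Canonical r' → sum (toList (code r 0 j)) ≤ N →
            share N r' h (code r 0 (suc j)) n ≡ sh (share N r' h (code r 0 j)) n
share-one N {r'} h r j n cr' x≤N =
  trans (cong₂ _-_ (shifted 0 n) (sh-cong n (shifted 1))) (regroup n)
  where
  x = code r 0 j
  shifted : ∀ k n → tally (suc (suc N)) (fits r' k (code r 0 (suc j))) h n ≡ sh (tally (suc (suc N)) (fits r' k x) h) n
  shifted k n = trans (tally-shift N (fits r' k x) (fits r' k (code r 0 (suc j))) h (fits-one-first cr' k r j) (fits-one r' k r j) n)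
                      (sh-cong n (λ n → sym (tally-extend (suc N) (fits r' k x) h n (fits-bounded r' k x x≤N))))
  regroup : ∀ n → sh (tally (suc (suc N)) (fits r' 0 x) h) n - sh (sh (tally (suc (suc N)) (fits r' 1 x) h)) n ≡
                  sh (share N r' h x) n
  regroup zero    = refl
  regroup (suc n) = refl

-- Lowest coefficients of the contributions

Tight : List ℕ → List ℕ → Set
Tight r' r = length r' ≡ length r × r' ⊑ r × ¬ (1 ∷ r' ⊑ r)

Tight₂ : List ℕ → List ℕ → Set
Tight₂ r' r = suc (length r') ≡ length r × 2 ∷ r' ⊑ r × ¬ (1 ∷ 2 ∷ r' ⊑ r)

tight? : ∀ r' r → Dec (Tight r' r)
tight? r' r = length r' ≟ length r ×-dec r' ⊑? r ×-dec ¬? ((1 ∷ r') ⊑? r)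

tight₂? : ∀ r' r → Dec (Tight₂ r' r)
tight₂? r' r = suc (length r') ≟ length r ×-dec (2 ∷ r') ⊑? r ×-dec ¬? ((1 ∷ 2 ∷ r') ⊑? r)

⊑-drop-++ : ∀ c → c ++ d ⊑ b → d ⊑ b
⊑-drop-++ []      q = q
⊑-drop-++ (a ∷ c) q = ⊑-drop-++ c (⊑-tail q)

⊑-fewer : ∀ {i j} → i ≤ j → replicate j 1 ++ c ⊑ b → replicate i 1 ++ c ⊑ b
⊑-fewer {j = zero}  z≤n q = q
⊑-fewer {j = suc j} i≤j q with m≤n⇒m<n∨m≡n i≤j
... | inj₁ i<j  = ⊑-fewer (s≤s⁻¹ i<j) (⊑-tail q)
... | inj₂ refl = q

-- A path with at least three vertices left free has room for two more isolated vertices.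

⊑-add-ones : ∀ κ → length c + κ ≤ length b → All (3 ≤_) b → c ⊑ b → replicate (κ * 2) 1 ++ c ⊑ b
⊑-add-ones zero    _ _ q = q
⊑-add-ones {c} {b} (suc κ) le h q
  with m , d , e , q' ← ⊑-freeBin q (≤-trans (s≤s (m≤m+n (length c) κ)) (subst (_≤ length b) (+-suc (length c) κ) le))
  with m≥3 ∷ h' ← All-resp-↭ e h =
  ⊑-resp-↭ (↭-sym e) (place z<s ↭-refl (≤-trans (s≤s z≤n) m≥3)
    (⊑-∷ z<s (∸-monoˡ-≤ 2 m≥3) (⊑-add-ones κ le' h' q')))
  where
  le' : length c + κ ≤ length d
  le' = s≤s⁻¹ (subst (suc (length c + κ) ≤_) (↭-length e) (subst (_≤ length b) (+-suc (length c) κ) le))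

-- One free path takes the part 2, and each of the other `κ` takes two isolated vertices.
⊑-add-two : ∀ κ → length c + suc κ ≤ length b → All (3 ≤_) b → c ⊑ b → replicate (κ * 2) 1 ++ 2 ∷ c ⊑ b
⊑-add-two {c} {b} κ le h q
  with m , d , e , q' ← ⊑-freeBin q (≤-trans (s≤s (m≤m+n (length c) κ)) (subst (_≤ length b) (+-suc (length c) κ) le))
  with m≥3 ∷ h' ← All-resp-↭ e h =
  ⊑-permute (↭-sym (shift 2 (replicate (κ * 2) 1) c))
    (⊑-resp-↭ (↭-sym e) (⊑-∷ z<s (≤-trans (n≤1+n 2) m≥3) (⊑-add-ones κ le' h' q')))
  where
  le' : length c + κ ≤ length d
  le' = s≤s⁻¹ (subst (suc (length c + κ) ≤_) (↭-length e) (subst (_≤ length b) (+-suc (length c) κ) le))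

length≤sum : All (0 <_) b → length b ≤ sum b
length≤sum []        = z≤n
length≤sum (m>0 ∷ h) = +-mono-≤ m>0 (length≤sum h)

share-none : ∀ N h n → ¬ (c ⊑ r) → share N c h (code r 0 0) n ≡ 0ℤ
share-none {c} {r} N h n c⋢r = cong₂ _-_ (tally-none (suc (suc N)) (none 0))
  (trans (sh-cong n (λ _ → tally-none (suc (suc N)) (none 1))) (sh-zero n))
  where
  none : ∀ k j → fits c k (code r 0 0) j ≡ false
  none k j = dec-false (code c k j ⊑ᶜ? code r 0 0)
    (λ q → c⋢r (⊑-drop-++ (replicate k 2) (⊑-drop-++ (replicate j 1) q)))

share-self : ∀ N h n → Canonical r → share N r h (code r 0 0) n ≡ h n
share-self {r} N h n (_ , r≥3) = begin
  share N r h (code r 0 0) n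
    ≡⟨ cong₂ _-_ (tally-peel N (fits r 0 x) h n)
         (trans (sh-cong n (λ _ → tally-none (suc (suc N)) (too-big 1 (s≤s z≤n)))) (sh-zero n)) ⟩
  (sh (tally (suc N) (fits r 0 x ∘ suc) h) n ⊹ (fits r 0 x 0 · h n - fits r 0 x 1 · h n)) - 0ℤ
    ≡⟨ cong₂ (λ u v → (u ⊹ v) - 0ℤ)
         (trans (sh-cong n (λ _ → tally-none (suc N) (λ j → too-big' j))) (sh-zero n))
         (cong₂ (λ p q → p · h n - q · h n) (dec-true (r ⊑? r) (⊑-refl pos)) (too-big' 0)) ⟩
  (0ℤ ⊹ (h n - 0ℤ)) - 0ℤ
    ≡⟨ trans (ℤ.+-identityʳ _) (trans (ℤ.+-identityˡ _) (ℤ.+-identityʳ _)) ⟩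
  h n ∎
  where
  open ≡-Reasoning
  x = code r 0 0
  pos : All (0 <_) r
  pos = All.map (≤-trans (s≤s z≤n)) r≥3
  too-big : ∀ k → 1 ≤ k → ∀ j → fits r k x j ≡ false
  too-big (suc k) _ j = dec-false (code r (suc k) j ⊑ᶜ? x) (λ q →
    1+n≰n (≤-trans (s≤s (≤-trans (sum-++-≥ k 2 r) (n≤1+n _))) (⊑⇒sum-≤ (⊑-drop-++ (replicate j 1) q))))
  too-big' : ∀ j → fits r 0 x (suc j) ≡ false
  too-big' j = dec-false (code r 0 (suc j) ⊑ᶜ? x) (λ q → 1+n≰n (≤-trans (s≤s (sum-++-≥ j 1 r)) (⊑⇒sum-≤ q)))

module _ (N : ℕ) {r r' : List ℕ} (cr : Canonical r) (r≤N : sum r ≤ N)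
         {h : Seq} (v : Vanishes (length r') h) where

  private
    x = code r 0 0
    s = length r'

    room : length r ≤ N
    room = ≤-trans (length≤sum (All.map (≤-trans (s≤s z≤n)) (proj₂ cr))) r≤N

    sub-zero : ∀ {y z} → y ≡ 0ℤ → z ≡ 0ℤ → y - z ≡ 0ℤ
    sub-zero refl refl = refl

    ·-dead : ∀ {P : Set} (P? : Dec P) {z} → ¬ P → does P? · z ≡ 0ℤ
    ·-dead P? {z} ¬p = cong (_· z) (dec-false P? ¬p)

    ·-null : ∀ p {z} → z ≡ 0ℤ → p · z ≡ 0ℤ
    ·-null p refl = ·-zero p

    peel-term : ∀ {P Q T : Set} (p? : Dec P) (q? : Dec Q) (t? : Dec T) {z} →
                P → (¬ Q → T) → (T → ¬ Q) → does p? · z - does q? · z ≡ does t? · z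
    peel-term p? q? t? {z} p f g rewrite dec-true p? p with q? | t?
    ... | yes q | yes t = contradiction q (g t)
    ... | yes q | no _  = ℤ.+-inverseʳ z
    ... | no ¬q | yes _ = ℤ.+-identityʳ _
    ... | no ¬q | no ¬t = contradiction (f ¬q) ¬t

  tight-term : r' ⊑ r → length r' ≡ length r → ∀ n → n ≤ length r →
               tally (suc (suc N)) (fits r' 0 x) h n ≡ does (tight? r' r) · h n
  tight-term q e n n≤ with m≤n⇒m<n∨m≡n (subst (n ≤_) (sym e) n≤)
  ... | inj₁ n<s  = trans (tally-vanishes (suc (suc N)) (fits r' 0 x) v n<s) (sym (·-null (does (tight? r' r)) (v n<s)))
  ... | inj₂ refl = trans (tally-lowest N (fits r' 0 x) v)
    (peel-term (r' ⊑? r) ((1 ∷ r') ⊑? r) (tight? r' r) q (λ ¬p → e , q , ¬p) (proj₂ ∘ proj₂))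

  tight₂-term : r' ⊑ r → suc (length r') ≡ length r → ∀ n → n ≤ length r' →
                tally (suc (suc N)) (fits r' 1 x) h n ≡ does (tight₂? r' r) · h n
  tight₂-term q e n n≤ with m≤n⇒m<n∨m≡n n≤
  ... | inj₁ n<s  = trans (tally-vanishes (suc (suc N)) (fits r' 1 x) v n<s) (sym (·-null (does (tight₂? r' r)) (v n<s)))
  ... | inj₂ refl = trans (tally-lowest N (fits r' 1 x) v)
    (peel-term ((2 ∷ r') ⊑? r) ((1 ∷ 2 ∷ r') ⊑? r) (tight₂? r' r) q₂ (λ ¬p → e , q₂ , ¬p) (proj₂ ∘ proj₂))
    where
    q₂ : 2 ∷ r' ⊑ r
    q₂ = ⊑-add-two 0 (≤-reflexive (trans (+-comm (length r') 1) e)) (proj₂ cr) q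

  -- The `suc κ` free paths hold `suc κ * 2` isolated vertices, which is at least `suc (suc κ)`. The
  -- order reached is thus one more than `length r`.
  ones-vanish : r' ⊑ r → ∀ κ → length r' + suc κ ≡ length r → Vanishes (length r' + suc (suc κ)) (tally (suc (suc N)) (fits r' 0 x) h)
  ones-vanish q κ e = tally-true (suc (suc κ)) (suc (suc N)) v
    (λ {j} j≤ → dec-true (code r' 0 j ⊑ᶜ? x) (⊑-fewer (≤-trans j≤ (s≤s (s≤s (m≤m*n κ 2))))
                  (⊑-add-ones (suc κ) (≤-reflexive e) (proj₂ cr) q)))
    (s≤s (s≤s (≤-trans (m≤n+m (suc κ) (length r')) (≤-trans (≤-reflexive e) room))))

  -- One of the `suc (suc κ)` free paths is spent on the part 2. The order reached is only
  -- `length r`, and the `sh` in `share` supplies the missing degree.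
  two-vanish : r' ⊑ r → ∀ κ → length r' + suc (suc κ) ≡ length r → Vanishes (length r' + suc (suc κ)) (tally (suc (suc N)) (fits r' 1 x) h)
  two-vanish q κ e = tally-true (suc (suc κ)) (suc (suc N)) v
    (λ {j} j≤ → dec-true (code r' 1 j ⊑ᶜ? x) (⊑-fewer (≤-trans j≤ (s≤s (s≤s (m≤m*n κ 2))))
                  (⊑-add-two (suc κ) (≤-reflexive e) (proj₂ cr) q)))
    (s≤s (≤-trans (≤-trans (m≤n+m (suc (suc κ)) (length r')) (≤-trans (≤-reflexive e) room)) (n≤1+n N)))

  -- Forests with more paths than `r` start in too high a degree, and two or more free paths push
  -- the order beyond `length r`. What remains are equal length and one free path.
  share-low : ∀ n → n ≤ length r →
              share N r' h x n ≡ does (tight? r' r) · h n - does (tight₂? r' r) · sh h n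
  share-low n n≤ = cases (r' ⊑? r)
    where
    cases : Dec (r' ⊑ r) → share N r' h x n ≡ does (tight? r' r) · h n - does (tight₂? r' r) · sh h n
    cases (no r'⋢r) = trans (share-none N h n r'⋢r) (sym (sub-zero
            (·-dead (tight? r' r) (λ (_ , q , _) → r'⋢r q)) (·-dead (tight₂? r' r) (λ (_ , q , _) → r'⋢r (⊑-tail q)))))
    cases (yes q) with <-cmp (length r') (length r)
    ... | tri≈ _ e _ = cong₂ _-_ (tight-term q e n n≤)
            (trans (sh-vanishes (tally-vanishes (suc (suc N)) (fits r' 1 x) v) (s≤s (subst (n ≤_) (sym e) n≤)))
                   (sym (·-dead (tight₂? r' r) (λ (e' , _) → 1+n≢n (trans e' (sym e))))))
    ... | tri> _ _ r<r' = trans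
            (sub-zero (tally-vanishes (suc (suc N)) (fits r' 0 x) v n<s) (sh-vanishes (tally-vanishes (suc (suc N)) (fits r' 1 x) v) (m<n⇒m<1+n n<s)))
            (sym (sub-zero (·-null (does (tight? r' r)) (v n<s)) (·-null (does (tight₂? r' r)) (sh-vanishes v (m<n⇒m<1+n n<s)))))
      where
      n<s : n < s
      n<s = ≤-<-trans n≤ r<r'
    ... | tri< r'<r r'≢r _ with m≤n⇒m<n∨m≡n r'<r
    -- With one free path the terms without a part 2 vanish, since that path holds two isolated
    -- vertices. Only the lowest coefficient of the terms with a part 2 survives.
    ... | inj₂ e = cong₂ _-_
            (trans (ones-vanish q 0 (trans (+-comm s 1) e) (≤-<-trans n≤ (≤-reflexive (trans (cong suc (sym e)) (+-comm 2 s)))))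
                   (sym (·-dead (tight? r' r) (λ (e' , _) → r'≢r e'))))
            (shifted n n≤)
      where
      shifted : ∀ n → n ≤ length r → sh (tally (suc (suc N)) (fits r' 1 x) h) n ≡ does (tight₂? r' r) · sh h n
      shifted zero    _  = sym (·-zero (does (tight₂? r' r)))
      shifted (suc n) n≤ = tight₂-term q e n (s≤s⁻¹ (subst (suc n ≤_) (sym e) n≤))
    ... | inj₁ lt with κ , e ← m≤n⇒∃[o]m+o≡n lt = trans
            (sub-zero (ones-vanish q (suc κ) e' (≤-<-trans n≤ (≤-reflexive (trans (cong suc (sym e')) (sym (+-suc s (suc (suc κ))))))))
                      (sh-vanishes (two-vanish q κ e') (s≤s (≤-trans n≤ (≤-reflexive (sym e'))))))
            (sym (sub-zero (·-dead (tight? r' r) (λ (e'' , _) → r'≢r e''))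
                           (·-dead (tight₂? r' r) (λ (e'' , _) → <⇒≢ lt e''))))
      where
      e' : s + suc (suc κ) ≡ length r
      e' = trans (+-suc s (suc κ)) (trans (cong suc (+-suc s κ)) e)

-- The Möbius function, its model, and the balance of top coefficients

module Mobius (μ : Graph → Graph → ℤ) (isMobius : IsMobius μ) where

  f : Code → Seq
  f x n = μ (Forest (toList (bot n))) (Forest (toList x))

  f-zero : ∀ {x n} → ¬ (bot n ⊑ᶜ x) → f x n ≡ 0ℤ
  f-zero {x} {n} bot⋢x = proj₁ (proj₂ isMobius) _ _
    (λ h → bot⋢x (≤ᴳ⇒⊑ᶜ (bot n) x canonical-[] h))

  module _ (N : ℕ) where

    ideal-sum : (Code → Seq) → Code → Seq
    ideal-sum g x n = ∑ (universe N) (λ y → does (y ⊑ᶜ? x) · g y n)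

    module _ (n : ℕ) {x : Code} (cx : Canonical (large x)) (x≤N : sum (toList x) ≤ N) (x≢bot : x ≢ bot n) where

      private
        Between : Code → Set
        Between y = bot n ⊑ᶜ y × y ⊑ᶜ x × y ≢ x

        between? : ∀ y → Dec (Between y)
        between? y = bot n ⊑ᶜ? y ×-dec y ⊑ᶜ? x ×-dec ¬? (y ≟ᶜ x)

        inner : List Code
        inner = filter between? (universe N)

        G : Code → Graph
        G y = Forest (toList y)

        inner⁻ : ∀ {y} → y ∈ inner → Canonical (large y) × Between y
        inner⁻ y∈ with y∈U , bet ← ∈-filter⁻ between? {xs = universe N} y∈ = ∈-universe⁻ N y∈U , bet

        sound : ∀ H → H ∈ map G inner → G (bot n) ≤ᴳ H × H <ᴳ G x
        sound H H∈ with y , y∈ , refl ← ∈-map⁻ G H∈ with cy , p , q , y≢x ← inner⁻ y∈ =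
          ⊑⇒≤ᴳ p , ⊑⇒≤ᴳ q ,
          λ h → y≢x (⊑-antisym cy cx q (⊑⇒sum-≤ (≤ᴳ⇒⊑ᶜ x y cx h)))

        complete : ∀ H → G (bot n) ≤ᴳ H → H <ᴳ G x → ∃ λ K → K ∈ map G inner × H ≅ K
        complete H lower (upper , strict) with y , cy , iso ← classify {toList x} {H} upper =
          G y , ∈-map⁺ G (∈-filter⁺ between? (∈-universe⁺ N y cy (≤-trans (⊑⇒sum-≤ y⊑x) x≤N)) (bot⊑y , y⊑x , y≢x)) , iso
          where
          H≤Gy = proj₁ (≅⇒≤ᴳ H (G y) iso)
          Gy≤H = proj₂ (≅⇒≤ᴳ H (G y) iso)
          y⊑x : y ⊑ᶜ x
          y⊑x = ≤ᴳ⇒⊑ᶜ y x cy (≤ᴳ-trans {G y} {H} {G x} Gy≤H upper)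
          bot⊑y : bot n ⊑ᶜ y
          bot⊑y = ≤ᴳ⇒⊑ᶜ (bot n) y canonical-[] (≤ᴳ-trans {G (bot n)} {H} {G y} lower H≤Gy)
          y≢x : y ≢ x
          y≢x refl = strict Gy≤H

        irredundant : AllPairs (λ H K → ¬ (H ≅ K)) (map G inner)
        irredundant = AllPairs.map⁺ (allPairs-map distinct
          (All.tabulate (λ y∈ → proj₁ (inner⁻ y∈)))
          (Unique.filter⁺ between? (universe-unique N)))
          where
          distinct : ∀ {y z} → Canonical (large y) → Canonical (large z) → y ≢ z → ¬ (G y ≅ G z)
          distinct {y} {z} cy cz y≢z iso with p , q ← ≅⇒≤ᴳ (G y) (G z) iso =
            y≢z (⊑-antisym cy cz (≤ᴳ⇒⊑ᶜ y z cy p) (⊑⇒sum-≤ (≤ᴳ⇒⊑ᶜ z y cz q)))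

        split-term : ∀ y → y ∈ universe N →
          does (y ⊑ᶜ? x) · f y n ≡ does (y ≟ᶜ x) · f y n ⊹ does (between? y) · f y n
        split-term y y∈ with y ≟ᶜ x | bot n ⊑ᶜ? y
        ... | yes refl | no bot⋢x =
          trans (cong (does (x ⊑ᶜ? x) ·_) (f-zero {x} bot⋢x)) (trans (·-zero (does (x ⊑ᶜ? x))) (sym (trans (ℤ.+-identityʳ _) (f-zero {x} bot⋢x))))
        ... | yes refl | yes p rewrite dec-true (x ⊑ᶜ? x) (⊑-refl (toList-positive x cx)) = sym (ℤ.+-identityʳ _)
        ... | no y≢x | no bot⋢y =
          trans (cong (does (y ⊑ᶜ? x) ·_) (f-zero {y} bot⋢y)) (·-zero (does (y ⊑ᶜ? x)))
        ... | no y≢x | yes p with y ⊑ᶜ? x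
        ... | yes _ = sym (ℤ.+-identityˡ _)
        ... | no _  = refl

      -- `inner` represents the interval from `bot n` to `x` with `x` left out, so the recursion of
      -- `IsMobius` applies to it. `split-term` adds `x` back and discards forests not above
      -- `bot n`, where the value is 0.
      ideal-sum-above : bot n ⊑ᶜ x → ideal-sum f x n ≡ 0ℤ
      ideal-sum-above bot⊑x = begin
        ideal-sum f x n
          ≡⟨ ∑-cong {xs = universe N} (split-term _) ⟩
        ∑ (universe N) (λ y → does (y ≟ᶜ x) · f y n ⊹ does (between? y) · f y n)
          ≡⟨ ∑-+ (universe N) _ _ ⟩
        ∑ (universe N) (λ y → does (y ≟ᶜ x) · f y n) ⊹ ∑ (universe N) (λ y → does (between? y) · f y n)
          ≡⟨ cong₂ _⊹_ at-x (sym (∑-filter between? (universe N) (λ y → f y n))) ⟩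
        f x n ⊹ ∑ inner (λ y → f y n)
          ≡⟨ cong (_⊹ ∑ inner (λ y → f y n)) recursion ⟩
        - ∑ inner (λ y → f y n) ⊹ ∑ inner (λ y → f y n)
          ≡⟨ ℤ.+-inverseˡ (∑ inner (λ y → f y n)) ⟩
        0ℤ ∎
        where
        open ≡-Reasoning
        at-x : ∑ (universe N) (λ y → does (y ≟ᶜ x) · f y n) ≡ f x n
        at-x = trans (∑-single (universe-unique N) (∈-universe⁺ N x cx x≤N)
                       (λ {y} _ y≢x → cong (_· f y n) (dec-false (y ≟ᶜ x) y≢x)))
                     (cong (_· f x n) (dec-true (x ≟ᶜ x) refl))
        strict : G (bot n) <ᴳ G x
        strict = ⊑⇒≤ᴳ bot⊑x , λ h → x≢bot (⊑-antisym cx canonical-[] (≤ᴳ⇒⊑ᶜ x (bot n) cx h) (⊑⇒sum-≤ bot⊑x))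
        recursion : f x n ≡ - ∑ inner (λ y → f y n)
        recursion = trans (proj₂ (proj₂ isMobius) _ _ strict (map G inner) (sound , complete , irredundant))
                          (cong -_ (∑-map inner G (μ (G (bot n)))))

    ideal-sum-f : ∀ {x} → Canonical (large x) → sum (toList x) ≤ N → ∀ n → ideal-sum f x n ≡ δ x n
    ideal-sum-f {x} cx x≤N n with x ≟ᶜ bot n | bot n ⊑ᶜ? x
    ... | no x≢   | yes p = ideal-sum-above n cx x≤N x≢ p
    ... | no x≢   | no bot⋢x = ∑-zero {xs = universe N} vanish
      where
      vanish : ∀ {y} → y ∈ universe N → does (y ⊑ᶜ? x) · f y n ≡ 0ℤ
      vanish {y} _ with y ⊑ᶜ? x
      ... | no _  = refl
      ... | yes q = f-zero {y} (λ p → bot⋢x (⊑-trans p q))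
    ... | yes refl | _ = trans (∑-single (universe-unique N) (∈-universe⁺ N x cx x≤N) vanish)
      (trans (cong (_· f x n) (dec-true (x ⊑ᶜ? x) (⊑-refl (toList-positive x cx))))
             (proj₁ isMobius _ _ (≅-refl {Forest (toList x)})))
      where
      vanish : ∀ {y} → y ∈ universe N → y ≢ x → does (y ⊑ᶜ? x) · f y n ≡ 0ℤ
      vanish {y} y∈ y≢x with y ⊑ᶜ? x
      ... | no _  = refl
      ... | yes q = f-zero {y} (λ p → y≢x (⊑-antisym (∈-universe⁻ N y∈) cx q (⊑⇒sum-≤ p)))

  F : List ℕ → Seq
  F r = f (code r 0 0)

  -- Equal to `f` by definition on codes without ones and twos; the content of `f≡model` is that all
  -- other values are determined by these.
  model : Code → Seq
  model (code r k j) = twist k (ladder j (F r))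

  module _ (N : ℕ) where

    ideal-sum-model : ∀ x n → ideal-sum N model x n ≡ ∑ (larges N) (λ r → share N r (F r) x n)
    ideal-sum-model x n = trans (∑-universe N (λ y → does (y ⊑ᶜ? x) · model y n))
      (∑-cong {xs = larges N} (λ {r} _ → ∑-twist N r (F r) x n))

    ideal-sum-two : ∀ r k j → sum (toList (code r (suc k) j)) ≤ N → ∀ n →
                    ideal-sum N model (code r (suc k) j) n ≡ 0ℤ
    ideal-sum-two r k j x≤N n = trans (ideal-sum-model (code r (suc k) j) n)
      (∑-zero {xs = larges N} (λ {r'} r'∈ → share-two N (F r') r k j n (∈-larges⁻ N r'∈) x≤N))

    ideal-sum-one : ∀ r j → sum (toList (code r 0 j)) ≤ N → ∀ n →
                    ideal-sum N model (code r 0 (suc j)) n ≡ sh (ideal-sum N model (code r 0 j)) n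
    ideal-sum-one r j x≤N n = trans (ideal-sum-model (code r 0 (suc j)) n)
      (trans (∑-cong {xs = larges N} (λ {r'} r'∈ → share-one N (F r') r j n (∈-larges⁻ N r'∈) x≤N))
        (trans (∑-sh n) (sh-cong n (λ n → sym (ideal-sum-model (code r 0 j) n)))))
      where
      ∑-sh : ∀ n → ∑ (larges N) (λ r' → sh (share N r' (F r') (code r 0 j)) n) ≡
                   sh (λ n → ∑ (larges N) (λ r' → share N r' (F r') (code r 0 j) n)) n
      ∑-sh zero    = ∑-zero {xs = larges N} (λ _ → refl)
      ∑-sh (suc n) = refl

    ideal-sum-ones : ∀ r → (∀ n → ideal-sum N model (code r 0 0) n ≡ δ (code r 0 0) n) →
                     ∀ j → sum (toList (code r 0 j)) ≤ N → ∀ n → ideal-sum N model (code r 0 j) n ≡ δ (code r 0 j) n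
    ideal-sum-ones r base zero    _   n = base n
    ideal-sum-ones r base (suc j) x≤N n = trans (ideal-sum-one r j (<⇒≤ x≤N) n)
      (trans (sh-cong n (ideal-sum-ones r base j (<⇒≤ x≤N))) (δ-sh r j n))

    -- Induction on the number of vertices: equal ideal sums at `x` and equal values below `x` force
    -- equal values at `x`. The ideal sum of the model at a code with ones reduces to the one at
    -- `code r 0 0`, where the induction covers everything below. `N` fixes the universe and `s`
    -- carries the induction.
    f≡model-bounded : ∀ s x → sum (toList x) ≤ s → s ≤ N → Canonical (large x) → ∀ n → f x n ≡ model x n
    agree : ∀ s x → sum (toList x) ≤ s → s ≤ N → Canonical (large x) → ∀ n →
            (∀ n → ideal-sum N model x n ≡ δ x n) → f x n ≡ model x n

    f≡model-bounded s       (code r 0 0)       x≤s s≤N cx n = refl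
    f≡model-bounded s       x@(code r (suc k) j) x≤s s≤N cx n = agree s x x≤s s≤N cx n
      (λ n → trans (ideal-sum-two r k j (≤-trans x≤s s≤N) n) (sym (δ-≢ {x} {n} λ ())))
    f≡model-bounded (suc s) x@(code r 0 (suc j)) x≤s s≤N cx n = agree (suc s) x x≤s s≤N cx n
      (ideal-sum-ones r base (suc j) (≤-trans x≤s s≤N))
      where
      r≤s : sum r ≤ s
      r≤s = ≤-trans (sum-++-≥ j 1 r) (s≤s⁻¹ x≤s)
      base : ∀ n → ideal-sum N model (code r 0 0) n ≡ δ (code r 0 0) n
      base n = trans (∑-cong {xs = universe N} same) (ideal-sum-f N cx (≤-trans r≤s (<⇒≤ s≤N)) n)
        where
        same : ∀ {y} → y ∈ universe N → does (y ⊑ᶜ? code r 0 0) · model y n ≡ does (y ⊑ᶜ? code r 0 0) · f y n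
        same {y} y∈ with y ⊑ᶜ? code r 0 0
        ... | no _  = refl
        ... | yes q = sym (f≡model-bounded s y (≤-trans (⊑⇒sum-≤ q) r≤s) (<⇒≤ s≤N) (∈-universe⁻ N y∈) n)

    agree s x x≤s s≤N cx n model-sum = trans (sym (self f)) (trans
      (∑-agree (universe-unique N) (∈-universe⁺ N x cx (≤-trans x≤s s≤N)) (below s x≤s s≤N)
        (trans (ideal-sum-f N cx (≤-trans x≤s s≤N) n) (sym (model-sum n)))) (self model))
      where
      self : ∀ g → does (x ⊑ᶜ? x) · g x n ≡ g x n
      self g = cong (_· g x n) (dec-true (x ⊑ᶜ? x) (⊑-refl (toList-positive x cx)))
      below : ∀ s → sum (toList x) ≤ s → s ≤ N → ∀ {y} → y ∈ universe N → y ≢ x →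
              does (y ⊑ᶜ? x) · f y n ≡ does (y ⊑ᶜ? x) · model y n
      below s x≤s s≤N {y} y∈ y≢x with y ⊑ᶜ? x
      ... | no _  = refl
      ... | yes q with y<x ← ⊑ᶜ-strict cx (∈-universe⁻ N y∈) q y≢x with s | x≤s
      ... | zero  | x≤0 = contradiction (≤-trans y<x x≤0) λ ()
      ... | suc s | x≤s = f≡model-bounded s y (s≤s⁻¹ (≤-trans y<x x≤s)) (<⇒≤ s≤N) (∈-universe⁻ N y∈) n

  f≡model : ∀ x → Canonical (large x) → ∀ n → f x n ≡ model x n
  f≡model x = f≡model-bounded (sum (toList x)) (sum (toList x)) x ≤-refl ≤-refl

  ∑-share : ∀ N {r} → Canonical r → sum r ≤ N → ∀ n → ∑ (larges N) (λ r' → share N r' (F r') (code r 0 0) n) ≡ δ (code r 0 0) n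
  ∑-share N {r} cr r≤N n = begin
    ∑ (larges N) (λ r' → share N r' (F r') (code r 0 0) n) ≡⟨ ideal-sum-model N (code r 0 0) n ⟨
    ideal-sum N model (code r 0 0) n                       ≡⟨ ∑-cong {xs = universe N} (λ {y} y∈ →
      cong (does (y ⊑ᶜ? code r 0 0) ·_) (f≡model y (∈-universe⁻ N y∈) n)) ⟨
    ideal-sum N f (code r 0 0) n                           ≡⟨ ideal-sum-f N cr r≤N n ⟩
    δ (code r 0 0) n                                       ∎
    where open ≡-Reasoning

  -- `∑-share` is solved for the contribution of `r` itself. In the others `share-low` leaves only
  -- tight forests, and by induction their series, after the factor t in the second kind, have no
  -- terms below degree `length r`.
  F-vanishes : ∀ s r → sum r ≤ s → Canonical r → Vanishes (length r) (F r)
  F-vanishes s r r≤s cr {n} n<r = begin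
    F r n                                           ≡⟨ share-self (sum r) (F r) n cr ⟨
    share (sum r) r (F r) x n                       ≡⟨ ∑-single (larges-unique (sum r)) (∈-larges⁺ (sum r) cr ≤-refl) (others s r≤s) ⟨
    ∑ (larges (sum r)) (λ r' → share (sum r) r' (F r') x n) ≡⟨ ∑-share (sum r) cr ≤-refl n ⟩
    δ x n                                           ≡⟨ δ-≢ {x} {n} (λ { refl → n≮0 n<r }) ⟩
    0ℤ                                              ∎
    where
    open ≡-Reasoning
    x = code r 0 0
    others : ∀ s → sum r ≤ s → ∀ {r'} → r' ∈ larges (sum r) → r' ≢ r → share (sum r) r' (F r') x n ≡ 0ℤ
    others' : ∀ s → sum r ≤ s → ∀ {r'} → r' ∈ larges (sum r) → r' ≢ r → Dec (r' ⊑ r) →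
              share (sum r) r' (F r') x n ≡ 0ℤ
    others s r≤s {r'} r'∈ r'≢r = others' s r≤s r'∈ r'≢r (r' ⊑? r)
    others' s r≤s {r'} r'∈ r'≢r (no r'⋢r) = share-none (sum r) (F r') n r'⋢r
    others' s r≤s {r'} r'∈ r'≢r (yes q) with cr' ← ∈-larges⁻ (sum r) r'∈
      with r'<r ← ⊑ᶜ-strict {x} {code r' 0 0} cr cr' q (λ { refl → r'≢r refl })
      with s | r≤s
    ... | zero  | r≤0 = contradiction (≤-trans r'<r r≤0) λ ()
    ... | suc s | r≤s = trans (share-low (sum r) {r} {r'} cr ≤-refl {F r'} v n (<⇒≤ n<r))
            (cong₂ _-_ (first (tight? r' r)) (second (tight₂? r' r)))
      where
      v : Vanishes (length r') (F r')
      v = F-vanishes s r' (s≤s⁻¹ (≤-trans r'<r r≤s)) cr'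
      first : (d : Dec (Tight r' r)) → does d · F r' n ≡ 0ℤ
      first (yes (e , _)) = v (subst (n <_) (sym e) n<r)
      first (no _)        = refl
      second : (d : Dec (Tight₂ r' r)) → does d · sh (F r') n ≡ 0ℤ
      second (yes (e , _)) = sh-vanishes v (subst (n <_) (sym e) n<r)
      second (no _)        = refl

  top : List ℕ → ℤ
  top r = F r (length r)

  -- This is `∑-share` in degree `length r`, where the right side is 0 since a nonempty `r` has only
  -- large parts. Explicit enumerations `X` and `Y` stand in for the filtered universe, so that
  -- applications can read off recursions.
  tight-balance : ∀ {r X Y} → Canonical r → r ≢ [] →
    Unique X → (∀ {r'} → r' ∈ X → Canonical r' × Tight r' r) → (∀ {r'} → Canonical r' → Tight r' r → r' ∈ X) →
    Unique Y → (∀ {r'} → r' ∈ Y → Canonical r' × Tight₂ r' r) → (∀ {r'} → Canonical r' → Tight₂ r' r → r' ∈ Y) →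
    ∑ X top ≡ ∑ Y top
  tight-balance {r} {X} {Y} cr r≢[] uX X⁻ X⁺ uY Y⁻ Y⁺ = ℤ.i-j≡0⇒i≡j (∑ X top) (∑ Y top) (begin
    ∑ X top - ∑ Y top
      ≡⟨ cong₂ _-_ sumX sumY ⟨
    ∑ L (λ r' → does (tight? r' r) · F r' n) - ∑ L (λ r' → does (tight₂? r' r) · sh (F r') n)
      ≡⟨ cong (∑ L (λ r' → does (tight? r' r) · F r' n) ⊹_) (∑-neg L (λ r' → does (tight₂? r' r) · sh (F r') n)) ⟨
    ∑ L (λ r' → does (tight? r' r) · F r' n) ⊹ ∑ L (λ r' → - (does (tight₂? r' r) · sh (F r') n))
      ≡⟨ ∑-+ L _ _ ⟨
    ∑ L (λ r' → does (tight? r' r) · F r' n - does (tight₂? r' r) · sh (F r') n)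
      ≡⟨ ∑-cong {xs = L} (λ {r'} r'∈ → share-low (sum r) {r} {r'} cr ≤-refl
           (F-vanishes (sum r') r' ≤-refl (∈-larges⁻ (sum r) r'∈)) n ≤-refl) ⟨
    ∑ L (λ r' → share (sum r) r' (F r') (code r 0 0) n)
      ≡⟨ ∑-share (sum r) cr ≤-refl n ⟩
    δ (code r 0 0) n
      ≡⟨ δ-≢ {code r 0 0} {n} (λ e → r≢[] (cong large e)) ⟩
    0ℤ ∎)
    where
    open ≡-Reasoning
    L = larges (sum r)
    n = length r
    sumX : ∑ L (λ r' → does (tight? r' r) · F r' n) ≡ ∑ X top
    sumX = trans (sym (∑-filter (λ r' → tight? r' r) L (λ r' → F r' n)))
      (trans (∑-unique (Unique.filter⁺ (λ r' → tight? r' r) (larges-unique (sum r))) uX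
        (λ r'∈ → let r'∈L , t = ∈-filter⁻ (λ r' → tight? r' r) {xs = L} r'∈ in X⁺ (∈-larges⁻ (sum r) r'∈L) t)
        (λ r'∈ → let cr' , t = X⁻ r'∈ in
          ∈-filter⁺ (λ r' → tight? r' r) (∈-larges⁺ (sum r) cr' (⊑⇒sum-≤ (proj₁ (proj₂ t)))) t))
      (∑-cong {xs = X} (λ {r'} r'∈ → cong (F r') (sym (proj₁ (proj₂ (X⁻ r'∈)))))))
    sumY : ∑ L (λ r' → does (tight₂? r' r) · sh (F r') n) ≡ ∑ Y top
    sumY = trans (sym (∑-filter (λ r' → tight₂? r' r) L (λ r' → sh (F r') n)))
      (trans (∑-unique (Unique.filter⁺ (λ r' → tight₂? r' r) (larges-unique (sum r))) uY
        (λ r'∈ → let r'∈L , t = ∈-filter⁻ (λ r' → tight₂? r' r) {xs = L} r'∈ in Y⁺ (∈-larges⁻ (sum r) r'∈L) t)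
        (λ r'∈ → let cr' , t = Y⁻ r'∈ in
          ∈-filter⁺ (λ r' → tight₂? r' r) (∈-larges⁺ (sum r) cr' (⊑⇒sum-≤ (⊑-tail (proj₁ (proj₂ t))))) t))
      (∑-cong {xs = Y} (λ {r'} r'∈ → cong (sh (F r')) (sym (proj₁ (proj₂ (Y⁻ r'∈)))))))

-- Paths with at most five vertices

t : ℕ → ℕ → ℕ → List ℕ
t a b c = replicate c 3 ++ replicate b 4 ++ replicate a 5

all-replicate : ∀ {P : ℕ → Set} n {x} → P x → All P (replicate n x)
all-replicate zero    px = []
all-replicate (suc n) px = px ∷ all-replicate n px

ascending-replicate : ∀ n x → Ascending (replicate n x)
ascending-replicate zero    x = []
ascending-replicate (suc n) x = ascending-∷ (all-replicate n ≤-refl) (ascending-replicate n x)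

t-canonical : ∀ a b c → Canonical (t a b c)
t-canonical a b c =
  ascending-replicate-++ c (all-++-replicate b (n≤1+n 3) (all-replicate a (m≤n+m 3 2)))
    (ascending-replicate-++ b (all-replicate a (n≤1+n 4)) (ascending-replicate a 5)) ,
  all-++-replicate c ≤-refl (all-++-replicate b (n≤1+n 3) (all-replicate a (m≤n+m 3 2)))

t-length : ∀ a b c → length (t a b c) ≡ c + (b + a)
t-length a b c = trans (List.length-++ (replicate c 3)) (cong₂ _+_ (List.length-replicate c)
  (trans (List.length-++ (replicate b 4)) (cong₂ _+_ (List.length-replicate b) (List.length-replicate a))))

no-threes : ∀ a b → All (3 <_) (replicate b 4 ++ replicate a 5)
no-threes a b = all-++-replicate b ≤-refl (all-replicate a (n≤1+n 4))

t-injective : ∀ {a b c a' b' c'} → t a b c ≡ t a' b' c' → a ≡ a' × b ≡ b' × c ≡ c'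
t-injective {a} {b} {c} {a'} {b'} {c'} e
  with e₁ , e₂ ← replicate-++-injective c c' (no-threes a b) (no-threes a' b') e
  with e₃ , e₄ ← replicate-++-injective b b' (all-replicate a ≤-refl) (all-replicate a' ≤-refl) e₂ =
  trans (sym (List.length-replicate a)) (trans (cong length e₄) (List.length-replicate a')) , e₃ , e₁

t-four : ∀ a b c → t a (suc b) c ↭ 4 ∷ t a b c
t-four a b c = shift 4 (replicate c 3) (replicate b 4 ++ replicate a 5)

t-five : ∀ a b c → t (suc a) b c ↭ 5 ∷ t a b c
t-five a b c = ↭-trans (++⁺ˡ (replicate c 3) (shift 5 (replicate b 4) (replicate a 5)))
                       (shift 5 (replicate c 3) (replicate b 4 ++ replicate a 5))

-- The inequalities are Hall's condition for giving every part a path of its own. The largest parts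
-- are matched first, each to a shortest path that holds it.
t-dominates : ∀ a' b' c' a b c → a' ≤ a → b' + a' ≤ b + a → c' + (b' + a') ≤ c + (b + a) →
              t a' b' c' ⊑ t a b c
t-dominates (suc a') b' c' (suc a) b c a≤ b≤ c≤ =
  ⊑-permute (↭-sym (t-five a' b' c')) (⊑-resp-↭ (↭-sym (t-five a b c)) (⊑-∷ z<s ≤-refl
    (t-dominates a' b' c' a b c (s≤s⁻¹ a≤) b≤' (s≤s⁻¹ (subst₂ _≤_ (eq c' b' a') (eq c b a) c≤)))))
  where
  eq : ∀ x y z → x + (y + suc z) ≡ suc (x + (y + z))
  eq = ℕ-Solver.solve-∀
  b≤' = s≤s⁻¹ (subst₂ _≤_ (+-suc b' a') (+-suc b a) b≤)
t-dominates zero (suc b') c' a (suc b) c _ b≤ c≤ =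
  ⊑-permute (↭-sym (t-four 0 b' c')) (⊑-resp-↭ (↭-sym (t-four a b c)) (⊑-∷ z<s ≤-refl
    (t-dominates 0 b' c' a b c z≤n (s≤s⁻¹ b≤) (s≤s⁻¹ (subst₂ _≤_ (+-suc c' _) (+-suc c _) c≤)))))
t-dominates zero (suc b') c' (suc a) zero c _ b≤ c≤ =
  ⊑-permute (↭-sym (t-four 0 b' c')) (⊑-resp-↭ (↭-sym (t-five a 0 c)) (⊑-∷ z<s (n≤1+n 4)
    (t-dominates 0 b' c' a 0 c z≤n (s≤s⁻¹ b≤) (s≤s⁻¹ (subst₂ _≤_ (+-suc c' _) (+-suc c _) c≤)))))
t-dominates zero zero zero     a b c _ _ _ = empty
t-dominates zero zero (suc c') a b (suc c) _ _ c≤ = ⊑-∷ z<s ≤-refl (t-dominates 0 0 c' a b c z≤n z≤n (s≤s⁻¹ c≤))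
t-dominates zero zero (suc c') a (suc b) zero _ _ c≤ = ⊑-∷ z<s (n≤1+n 3) (t-dominates 0 0 c' a b 0 z≤n z≤n (s≤s⁻¹ c≤))
t-dominates zero zero (suc c') (suc a) zero zero _ _ c≤ = ⊑-∷ z<s (m≤n+m 3 2) (t-dominates 0 0 c' a 0 0 z≤n z≤n (s≤s⁻¹ c≤))

⊑-bounded : ∀ {M} → All (_≤ M) b → c ⊑ b → All (_≤ M) c
⊑-bounded h empty = []
⊑-bounded {c = a ∷ _} h (place {m = m} _ e l q) with m≤M ∷ h' ← All-resp-↭ e h =
  ≤-trans l m≤M ∷ ⊑-bounded (≤-trans (m∸n≤m m (suc a)) m≤M ∷ h') q

t-shape : Canonical c → All (_≤ 5) c → ∃ λ a → ∃ λ b' → ∃ λ c' → c ≡ t a b' c'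
t-shape {[]}    _ _ = 0 , 0 , 0 , refl
t-shape {x ∷ c} (s , x≥3 ∷ c≥3) (x≤5 ∷ c≤5) with a , b' , c' , refl ← t-shape {c} (Linked.tail s , c≥3) c≤5 =
  head x≥3 x≤5 a b' c' s
  where
  head : ∀ {x} → 3 ≤ x → x ≤ 5 → ∀ a b c → Ascending (x ∷ t a b c) →
         ∃ λ a' → ∃ λ b' → ∃ λ c' → x ∷ t a b c ≡ t a' b' c'
  head {1} (s≤s ())
  head {2} (s≤s (s≤s ()))
  head {3} _ _ a b c s = a , b , suc c , refl
  head {4} _ _ a b zero s = a , suc b , 0 , refl
  head {4} _ _ a b (suc c) (s≤s (s≤s (s≤s ())) ∷ _)
  head {5} _ _ a zero zero s = suc a , 0 , 0 , refl
  head {5} _ _ a (suc b) zero (s≤s (s≤s (s≤s (s≤s ()))) ∷ _)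
  head {5} _ _ a b (suc c) (s≤s (s≤s (s≤s ())) ∷ _)
  head {suc (suc (suc (suc (suc (suc _)))))} _ (s≤s (s≤s (s≤s (s≤s (s≤s ()))))) a b c s

-- The bins in question have at most five vertices. Continuing the table by the size itself makes
-- superadditivity automatic from 6 on, as long as the table stays below the size; the rest is a
-- finite check.
Tabulated : (ℕ → ℕ) → Set
Tabulated w = ∀ m → w (6 + m) ≡ 6 + m

table? : ∀ (w : ℕ → ℕ) → Dec (∀ (m : Fin 6) → w (toℕ m) ≤ toℕ m ×
                      (∀ (a : Fin 6) → toℕ a ≤ toℕ m → w (toℕ a) + w (toℕ m ∸ suc (toℕ a)) ≤ w (toℕ m)))
table? w = Fin.all? λ m → (w (toℕ m) ≤? toℕ m) ×-dec
  Fin.all? λ a → (toℕ a ≤? toℕ m) →-dec (w (toℕ a) + w (toℕ m ∸ suc (toℕ a)) ≤? w (toℕ m))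

tabulated⇒superadditive : ∀ w → Tabulated w → {True (table? w)} → Superadditive w
tabulated⇒superadditive w tab {ok} a m a≤m with m <? 6
... | yes m<6 = subst₂ (λ a m → w a + w (m ∸ suc a) ≤ w m) (Fin.toℕ-fromℕ< a<6) (Fin.toℕ-fromℕ< m<6)
      (proj₂ (toWitness ok (fromℕ< m<6)) (fromℕ< a<6) (subst₂ _≤_ (sym (Fin.toℕ-fromℕ< a<6)) (sym (Fin.toℕ-fromℕ< m<6)) a≤m))
  where
  a<6 = ≤-<-trans a≤m m<6
... | no m≮6 = begin
  w a + w (m ∸ suc a)   ≤⟨ +-mono-≤ (w≤id a) (w≤id (m ∸ suc a)) ⟩
  a + (m ∸ suc a)       ≤⟨ +-monoʳ-≤ a (∸-monoʳ-≤ m (n≤1+n a)) ⟩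
  a + (m ∸ a)           ≡⟨ m+[n∸m]≡n a≤m ⟩
  m                     ≡⟨ m+[n∸m]≡n (≮⇒≥ m≮6) ⟨
  6 + (m ∸ 6)           ≡⟨ tab (m ∸ 6) ⟨
  w (6 + (m ∸ 6))       ≡⟨ cong w (m+[n∸m]≡n (≮⇒≥ m≮6)) ⟩
  w m                   ∎
  where
  open ≤-Reasoning
  w≤id : ∀ m → w m ≤ m
  w≤id m with m <? 6
  ... | yes m<6 = subst (λ m → w m ≤ m) (Fin.toℕ-fromℕ< m<6) (proj₁ (toWitness ok (fromℕ< m<6)))
  ... | no m≮6  = subst (λ m → w m ≤ m) (m+[n∸m]≡n (≮⇒≥ m≮6)) (≤-reflexive (tab (m ∸ 6)))

table : ℕ → ℕ → ℕ → ℕ → ℕ → ℕ → ℕ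
table w₁ w₂ w₃ w₄ w₅ 0 = 0
table w₁ w₂ w₃ w₄ w₅ 1 = w₁
table w₁ w₂ w₃ w₄ w₅ 2 = w₂
table w₁ w₂ w₃ w₄ w₅ 3 = w₃
table w₁ w₂ w₃ w₄ w₅ 4 = w₄
table w₁ w₂ w₃ w₄ w₅ 5 = w₅
table w₁ w₂ w₃ w₄ w₅ m = m

weight-replicate-++ : ∀ (w : ℕ → ℕ) n x b → sum (map w (replicate n x ++ b)) ≡ n * w x + sum (map w b)
weight-replicate-++ w zero    x b = refl
weight-replicate-++ w (suc n) x b =
  trans (cong (w x +_) (weight-replicate-++ w n x b)) (sym (+-assoc (w x) (n * w x) _))

t-weight : ∀ (w : ℕ → ℕ) a b c → sum (map w (t a b c)) ≡ c * w 3 + (b * w 4 + a * w 5)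
t-weight w a b c = trans (weight-replicate-++ w c 3 _) (cong (c * w 3 +_)
  (trans (weight-replicate-++ w b 4 _) (cong (b * w 4 +_)
    (trans (cong (λ z → sum (map w z)) (sym (List.++-identityʳ (replicate a 5))))
      (trans (weight-replicate-++ w a 5 []) (+-identityʳ _))))))

t-weight-≤ : ∀ w d a b c a' b' c' → Superadditive w → d ++ t a' b' c' ⊑ t a b c →
             sum (map w d) + (c' * w 3 + (b' * w 4 + a' * w 5)) ≤ c * w 3 + (b * w 4 + a * w 5)
t-weight-≤ w d a b c a' b' c' sup q = subst₂ _≤_ (eq d) (t-weight w a b c) (⊑⇒weight-≤ sup q)
  where
  eq : ∀ d → sum (map w (d ++ t a' b' c')) ≡ sum (map w d) + (c' * w 3 + (b' * w 4 + a' * w 5))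
  eq []      = t-weight w a' b' c'
  eq (x ∷ d) = trans (cong (w x +_) (eq d)) (sym (+-assoc (w x) _ _))

t-fives : ∀ a b c a' b' c' → t a' b' c' ⊑ t a b c → a' ≤ a
t-fives a b c a' b' c' q = subst₂ _≤_ (eq c' b' a') (eq c b a)
  (t-weight-≤ (table 0 0 0 0 1) [] a b c a' b' c' (tabulated⇒superadditive _ (λ _ → refl)) q)
  where
  eq : ∀ x y z → x * 0 + (y * 0 + z * 1) ≡ z
  eq = ℕ-Solver.solve-∀

t-fours : ∀ a b c a' b' c' → t a' b' c' ⊑ t a b c → b' + a' ≤ b + a
t-fours a b c a' b' c' q = subst₂ _≤_ (eq c' b' a') (eq c b a)
  (t-weight-≤ (table 0 0 0 1 1) [] a b c a' b' c' (tabulated⇒superadditive _ (λ _ → refl)) q)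
  where
  eq : ∀ x y z → x * 0 + (y * 1 + z * 1) ≡ y + z
  eq = ℕ-Solver.solve-∀

-- The tables are chosen so that the weight of the right-hand side is exhausted by the given paths.

t-no-room-fours : ∀ a b c b' c' → c' + b' ≡ c + b → ¬ (1 ∷ t a b' c' ⊑ t a b c)
t-no-room-fours a b c b' c' e q = 1+n≰n (subst₂ _≤_
  (trans (cong suc (eq c' b' a)) (cong (λ z → suc (z * 2 + a * 3)) e)) (eq c b a)
  (t-weight-≤ (table 1 1 2 2 3) (1 ∷ []) a b c a b' c' (tabulated⇒superadditive _ (λ _ → refl)) q))
  where
  eq : ∀ x y z → x * 2 + (y * 2 + z * 3) ≡ (x + y) * 2 + z * 3
  eq = ℕ-Solver.solve-∀

t-no-room-fives : ∀ a b c a' b' → b' + a' ≡ b + a → ¬ (1 ∷ t a' b' c ⊑ t a b c)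
t-no-room-fives a b c a' b' e q = 1+n≰n (subst₂ _≤_
  (trans (cong suc (eq c b' a')) (cong (λ z → suc (c * 2 + z * 4)) e)) (eq c b a)
  (t-weight-≤ (table 1 2 2 4 4) (1 ∷ []) a b c a' b' c (tabulated⇒superadditive _ (λ _ → refl)) q))
  where
  eq : ∀ x y z → x * 2 + (y * 4 + z * 4) ≡ x * 2 + (y + z) * 4
  eq = ℕ-Solver.solve-∀

-- Parts 2 and 3 weigh the same, as do 4 and 5, so both sides balance before the further vertex is
-- added.
t-no-room-two : ∀ a b c a' b' → b' + a' ≡ b + a → ¬ (1 ∷ 2 ∷ t a' b' c ⊑ t a b (suc c))
t-no-room-two a b c a' b' e q = 1+n≰n (subst₂ _≤_
  (trans (cong (3 +_) (eq c b' a')) (cong (λ z → 3 + (c * 2 + z * 4)) e)) (cong (2 +_) (eq c b a))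
  (t-weight-≤ (table 1 2 2 4 4) (1 ∷ 2 ∷ []) a b (suc c) a' b' c (tabulated⇒superadditive _ (λ _ → refl)) q))
  where
  eq : ∀ x y z → x * 2 + (y * 4 + z * 4) ≡ x * 2 + (y + z) * 4
  eq = ℕ-Solver.solve-∀

-- `upTo b` omits `b' ≡ b` because `t a b c` itself is already listed in `lowerFive`.
lowerFour : ℕ → ℕ → ℕ → List (List ℕ)
lowerFour a b c = map (λ b' → t a b' (c + b ∸ b')) (upTo b)

lowerFive : ℕ → ℕ → ℕ → List (List ℕ)
lowerFive a b c = map (λ a' → t a' (b + a ∸ a') c) (upTo (suc a))

dropThree : ℕ → ℕ → ℕ → List (List ℕ)
dropThree a b zero    = []
dropThree a b (suc c) = lowerFive a b c

lowerFive-unique : ∀ a b c → Unique (lowerFive a b c)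
lowerFive-unique a b c = Unique.map⁺ (λ {x} {y} e → proj₁ (t-injective {x} {b + a ∸ x} {c} {y} {b + a ∸ y} {c} e)) (Unique.upTo⁺ (suc a))

lowered-unique : ∀ a b c → Unique (lowerFour a b c ++ lowerFive a b c)
lowered-unique a b c = Unique.++⁺
  (Unique.map⁺ (λ {x} {y} e → proj₁ (proj₂ (t-injective {a} {x} {c + b ∸ x} {a} {y} {c + b ∸ y} e))) (Unique.upTo⁺ b))
  (lowerFive-unique a b c) disjoint
  where
  disjoint : ∀ {r} → ¬ (r ∈ lowerFour a b c × r ∈ lowerFive a b c)
  disjoint (p , q) with b' , b'∈ , refl ← ∈-map⁻ _ p | a' , _ , e ← ∈-map⁻ (λ a' → t a' (b + a ∸ a') c) {xs = upTo (suc a)} q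
    with refl , refl , _ ← t-injective {a} {b'} {c + b ∸ b'} {a'} {b + a ∸ a'} {c} e =
    <⇒≢ (∈-upTo⁻ b'∈) (m+n∸n≡m b a)

private
  a'≤b+a : ∀ {a a'} b → a' < suc a → a' ≤ b + a
  a'≤b+a {a} b a'<a = ≤-trans (s≤s⁻¹ a'<a) (m≤n+m a b)

lowered-tight : ∀ a b c {r} → r ∈ lowerFour a b c ++ lowerFive a b c → Canonical r × Tight r (t a b c)
lowered-tight a b c r∈ with ∈-++⁻ (lowerFour a b c) r∈
... | inj₁ p with b' , b'∈ , refl ← ∈-map⁻ _ p =
  t-canonical a b' c₁ , trans (t-length a b' c₁) (trans total (sym (t-length a b c))) ,
  t-dominates a b' c₁ a b c ≤-refl (+-monoˡ-≤ a b'≤b) (≤-reflexive total) ,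
  t-no-room-fours a b c b' c₁ e
  where
  c₁ = c + b ∸ b'
  b'≤b = <⇒≤ (∈-upTo⁻ b'∈)
  e : c₁ + b' ≡ c + b
  e = m∸n+n≡m (≤-trans b'≤b (m≤n+m b c))
  total : c₁ + (b' + a) ≡ c + (b + a)
  total = trans (sym (+-assoc c₁ b' a)) (trans (cong (_+ a) e) (+-assoc c b a))
... | inj₂ p with a' , a'∈ , refl ← ∈-map⁻ _ p =
  t-canonical a' b₁ c , trans (t-length a' b₁ c) (trans (cong (c +_) e) (sym (t-length a b c))) ,
  t-dominates a' b₁ c a b c (s≤s⁻¹ (∈-upTo⁻ a'∈)) (≤-reflexive e) (≤-reflexive (cong (c +_) e)) ,
  t-no-room-fives a b c a' b₁ e
  where
  b₁ = b + a ∸ a'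
  e : b₁ + a' ≡ b + a
  e = m∸n+n≡m (a'≤b+a b (∈-upTo⁻ a'∈))

t-bounded : ∀ a b c → All (_≤ 5) (t a b c)
t-bounded a b c = all-++-replicate c (m≤n+m 3 2) (all-++-replicate b (n≤1+n 4) (all-replicate a ≤-refl))

∈-lowerFive : ∀ c {a b a' b'} → a' ≤ a → b' + a' ≡ b + a → t a' b' c ∈ lowerFive a b c
∈-lowerFive c {a} {b} {a'} {b'} a'≤a e =
  subst (λ z → t a' z c ∈ lowerFive a b c) (trans (cong (_∸ a') (sym e)) (m+n∸n≡m b' a'))
    (∈-map⁺ (λ a' → t a' (b + a ∸ a') c) (∈-upTo⁺ (s≤s a'≤a)))

-- If both the number of fives and the number of parts above three drop, a path with five vertices
-- can hold a 3 and a further vertex. Hence either only fours or only fives are lowered.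
tight-lowered : ∀ a b c {r} → Canonical r → Tight r (t a b c) → r ∈ lowerFour a b c ++ lowerFive a b c
tight-lowered a b c cr (len , q , no-room)
  with a' , b' , c' , refl ← t-shape cr (⊑-bounded (t-bounded a b c) q) = cases (m≤n⇒m<n∨m≡n fours) (m≤n⇒m<n∨m≡n fives)
  where
  fives : a' ≤ a
  fives = t-fives a b c a' b' c' q
  fours : b' + a' ≤ b + a
  fours = t-fours a b c a' b' c' q
  total : c' + (b' + a') ≡ c + (b + a)
  total = trans (sym (t-length a' b' c')) (trans len (t-length a b c))
  room : ∀ a b c a' b' c' → a' < a → b' + a' < b + a → c' + (b' + a') ≡ c + (b + a) → 1 ∷ t a' b' c' ⊑ t a b c
  room a b c a' b' zero _ lt e = contradiction (≤-trans lt (≤-trans (m≤n+m (b + a) c) (≤-reflexive (sym e)))) 1+n≰n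
  room (suc a) b c a' b' (suc c') a'<a lt e =
    ⊑-resp-↭ (↭-sym (t-five a b c)) (place z<s ↭-refl (s≤s z≤n) (⊑-∷ z<s ≤-refl
      (t-dominates a' b' c' a b c (s≤s⁻¹ a'<a) (s≤s⁻¹ (subst (b' + a' <_) (+-suc b a) lt))
        (≤-reflexive (suc-injective (trans e (trans (cong (c +_) (+-suc b a)) (+-suc c (b + a)))))))))
  cases : b' + a' < b + a ⊎ b' + a' ≡ b + a → a' < a ⊎ a' ≡ a → t a' b' c' ∈ lowerFour a b c ++ lowerFive a b c
  cases (inj₂ e) _ with refl ← +-cancelʳ-≡ (b + a) c' c (trans (cong (c' +_) (sym e)) total) =
    ∈-++⁺ʳ (lowerFour a b c) (∈-lowerFive c fives e)
  cases (inj₁ lt) (inj₁ a'<a) = contradiction (room a b c a' b' c' a'<a lt total) no-room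
  cases (inj₁ lt) (inj₂ refl) = ∈-++⁺ˡ (subst (λ z → t a b' z ∈ lowerFour a b c) c'-value
    (∈-map⁺ (λ b' → t a b' (c + b ∸ b')) (∈-upTo⁺ (+-cancelʳ-< a b' b lt))))
    where
    c'-value : c + b ∸ b' ≡ c'
    c'-value = trans (cong (_∸ b') (sym (+-cancelʳ-≡ a (c' + b') (c + b)
      (trans (+-assoc c' b' a) (trans total (sym (+-assoc c b a))))))) (m+n∸n≡m c' b')

dropThree-tight : ∀ a b c {r} → r ∈ dropThree a b c → Canonical r × Tight₂ r (t a b c)
dropThree-tight a b (suc c) p with a' , a'∈ , refl ← ∈-map⁻ _ p =
  t-canonical a' b₁ c , cong suc (trans (t-length a' b₁ c) (trans (cong (c +_) e) (sym (t-length a b c)))) ,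
  ⊑-∷ z<s (n≤1+n 2) (t-dominates a' b₁ c a b c (s≤s⁻¹ (∈-upTo⁻ a'∈)) (≤-reflexive e) (≤-reflexive (cong (c +_) e))) ,
  t-no-room-two a b c a' b₁ e
  where
  b₁ = b + a ∸ a'
  e : b₁ + a' ≡ b + a
  e = m∸n+n≡m (a'≤b+a b (∈-upTo⁻ a'∈))

-- If the number of parts above three drops, a path with at least four vertices is free for the 2
-- and a further vertex. So the 2 must stand in for a path with three vertices, and otherwise only
-- fives are lowered.
tight-dropThree : ∀ a b c {r} → Canonical r → Tight₂ r (t a b c) → r ∈ dropThree a b c
tight-dropThree a b c cr (len , q , no-room)
  with a' , b' , c' , refl ← t-shape cr (⊑-bounded (t-bounded a b c) (⊑-tail q)) =
  cases c total (m≤n⇒m<n∨m≡n fours)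
  where
  fives : a' ≤ a
  fives = t-fives a b c a' b' c' (⊑-tail q)
  fours : b' + a' ≤ b + a
  fours = t-fours a b c a' b' c' (⊑-tail q)
  total : suc (c' + (b' + a')) ≡ c + (b + a)
  total = trans (cong suc (sym (t-length a' b' c'))) (trans len (t-length a b c))
  room : ∀ a b → a' ≤ a → b' + a' < b + a → suc (c' + (b' + a')) ≡ c + (b + a) → 1 ∷ 2 ∷ t a' b' c' ⊑ t a b c
  room a (suc b) a'≤a lt e = ⊑-resp-↭ (↭-sym (t-four a b c)) (place z<s ↭-refl (s≤s z≤n) (⊑-∷ z<s ≤-refl
    (t-dominates a' b' c' a b c a'≤a (s≤s⁻¹ lt) (≤-reflexive (suc-injective (trans e (+-suc c (b + a))))))))
  room (suc a) zero a'≤a lt e = ⊑-resp-↭ (↭-sym (t-five a 0 c)) (place z<s ↭-refl (s≤s z≤n) (⊑-∷ z<s (n≤1+n 2)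
    (t-dominates a' b' c' a 0 c (≤-trans (m≤n+m a' b') (s≤s⁻¹ lt)) (s≤s⁻¹ lt) (≤-reflexive (suc-injective (trans e (+-suc c a)))))))
  cases : ∀ c₁ → suc (c' + (b' + a')) ≡ c₁ + (b + a) → b' + a' < b + a ⊎ b' + a' ≡ b + a → t a' b' c' ∈ dropThree a b c₁
  cases c₁ _ (inj₁ lt) = contradiction (room a b fives lt total) no-room
  cases zero e (inj₂ e') = contradiction (≤-trans (s≤s (m≤n+m (b' + a') c')) (≤-reflexive (trans e (sym e')))) 1+n≰n
  cases (suc c₁) e (inj₂ e') with refl ← +-cancelʳ-≡ (b + a) c' c₁ (trans (cong (c' +_) (sym e')) (suc-injective e)) =
    ∈-lowerFive c₁ fives e'

dropThree-unique : ∀ a b c → Unique (dropThree a b c)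
dropThree-unique a b zero    = []
dropThree-unique a b (suc c) = lowerFive-unique a b c

module UpToFive (μ : Graph → Graph → ℤ) (isMobius : IsMobius μ) where

  open Mobius μ isMobius

  T : ℕ → ℕ → ℕ → ℤ
  T a b c = top (t a b c)

  T-sum : ℕ → ℕ → ℕ → ℤ
  T-sum a b c = ∑ (upTo (suc a)) (λ a' → T a' (b + a ∸ a') c)

  T-drop : ℕ → ℕ → ℕ → ℤ
  T-drop a b zero    = 0ℤ
  T-drop a b (suc c) = T-sum a b c

  T-balance : ∀ a b c → 0 < c + (b + a) →
              ∑ (upTo b) (λ b' → T a b' (c + b ∸ b')) ⊹ T-sum a b c ≡ T-drop a b c
  T-balance a b c pos = begin
    ∑ (upTo b) (λ b' → T a b' (c + b ∸ b')) ⊹ T-sum a b c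
      ≡⟨ cong₂ _⊹_ (∑-map (upTo b) (λ b' → t a b' (c + b ∸ b')) top) (∑-map (upTo (suc a)) (λ a' → t a' (b + a ∸ a') c) top) ⟨
    ∑ (lowerFour a b c) top ⊹ ∑ (lowerFive a b c) top
      ≡⟨ ∑-++ (lowerFour a b c) (lowerFive a b c) top ⟨
    ∑ (lowerFour a b c ++ lowerFive a b c) top
      ≡⟨ tight-balance (t-canonical a b c) nonempty (lowered-unique a b c) (lowered-tight a b c) (tight-lowered a b c)
           (dropThree-unique a b c) (dropThree-tight a b c) (tight-dropThree a b c) ⟩
    ∑ (dropThree a b c) top
      ≡⟨ drop c ⟩
    T-drop a b c ∎
    where
    open ≡-Reasoning
    nonempty : t a b c ≢ []
    nonempty e = <⇒≢ pos (trans (sym (cong length e)) (t-length a b c))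
    drop : ∀ c → ∑ (dropThree a b c) top ≡ T-drop a b c
    drop zero    = refl
    drop (suc c) = ∑-map (upTo (suc a)) (λ a' → t a' (b + a ∸ a') c) top

  top-[] : top [] ≡ 1ℤ
  top-[] = proj₁ isMobius _ _ (≅-refl {Forest []})

  T-threes : ∀ c → T 0 0 c ≡ 1ℤ
  T-threes zero    = top-[]
  T-threes (suc c) = begin
    T 0 0 (suc c)                  ≡⟨ pad (T 0 0 (suc c)) ⟩
    0ℤ ⊹ (T 0 0 (suc c) ⊹ 0ℤ)      ≡⟨ T-balance 0 0 (suc c) z<s ⟩
    T 0 0 c ⊹ 0ℤ                   ≡⟨ ℤ.+-identityʳ _ ⟩
    T 0 0 c                        ≡⟨ T-threes c ⟩
    1ℤ                             ∎
    where
    open ≡-Reasoning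
    pad : ∀ z → z ≡ 0ℤ ⊹ (z ⊹ 0ℤ)
    pad = solve-∀

  -- Subtract the balances of P₄ⁿ⁺¹ and P₄ⁿP₃: their left sides differ only in the term
  -- `T 0 (suc n) 0`.
  T-fours : ∀ n → T 0 (suc n) 0 ≡ - T 0 n 0
  T-fours n = combine (T 0 (suc n) 0) (T 0 n 0) (T 0 n 1) S
    (trans (cong₂ (λ u v → u ⊹ (v ⊹ 0ℤ)) (sym (∑-upTo-last' n)) (cong (λ z → T 0 z 0) (sym (+-identityʳ (suc n)))))
      (T-balance 0 (suc n) 0 (s≤s z≤n)))
    (trans (cong (λ z → S ⊹ (T 0 z 1 ⊹ 0ℤ)) (sym (+-identityʳ n)))
      (trans (T-balance 0 n 1 z<s) (cong (λ z → T 0 z 0 ⊹ 0ℤ) (+-identityʳ n))))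
    where
    S = ∑ (upTo n) (λ b' → T 0 b' (suc n ∸ b'))
    ∑-upTo-last' : ∀ n → ∑ (upTo (suc n)) (λ b' → T 0 b' (suc n ∸ b')) ≡ ∑ (upTo n) (λ b' → T 0 b' (suc n ∸ b')) ⊹ T 0 n 1
    ∑-upTo-last' n = trans (∑-upTo-last n (λ b' → T 0 b' (suc n ∸ b')))
      (cong (λ z → ∑ (upTo n) (λ b' → T 0 b' (suc n ∸ b')) ⊹ T 0 n z) (m+n∸n≡m 1 n))
    combine : ∀ x y z s → (s ⊹ z) ⊹ (x ⊹ 0ℤ) ≡ 0ℤ → s ⊹ (z ⊹ 0ℤ) ≡ y ⊹ 0ℤ → x ≡ - y
    combine x y z s e₁ e₂ = trans (rearrange x z s) (trans (cong₂ _-_ e₁ e₂) (simplify y))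
      where
      rearrange : ∀ x z s → x ≡ ((s ⊹ z) ⊹ (x ⊹ 0ℤ)) - (s ⊹ (z ⊹ 0ℤ))
      rearrange = solve-∀
      simplify : ∀ y → 0ℤ - (y ⊹ 0ℤ) ≡ - y
      simplify = solve-∀

  private
    head-fives : ∀ a c → T-sum (suc a) 0 c ≡ T-sum a 1 c ⊹ T (suc a) 0 c
    head-fives a c = trans (∑-upTo-last (suc a) (λ a' → T a' (suc a ∸ a') c))
      (cong (λ z → T-sum a 1 c ⊹ T (suc a) z c) (n∸n≡0 a))

    combine : ∀ s x y d → 0ℤ ⊹ (s ⊹ x) ≡ d → (y ⊹ 0ℤ) ⊹ s ≡ 0ℤ → x ≡ y ⊹ d
    combine s x y d e₁ e₂ = trans (rearrange s x y) (trans (cong₂ (λ u v → y ⊹ u - v) e₁ e₂) (ℤ.+-identityʳ _))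
      where
      rearrange : ∀ s x y → x ≡ y ⊹ (0ℤ ⊹ (s ⊹ x)) - ((y ⊹ 0ℤ) ⊹ s)
      rearrange = solve-∀

  T-fives-zero : ∀ a → T (suc a) 0 0 ≡ T a 0 1
  T-fives-zero a = trans (combine (T-sum a 1 0) (T (suc a) 0 0) (T a 0 1) 0ℤ
    (trans (cong (0ℤ ⊹_) (sym (head-fives a 0))) (T-balance (suc a) 0 0 z<s)) (T-balance a 1 0 z<s)) (ℤ.+-identityʳ _)

  -- Subtract the balance of P₅ᵃP₄P₃ᶜ⁺¹ from that of P₅ᵃ⁺¹P₃ᶜ⁺¹. By `head-fives` the sums over
  -- lowered fives agree up to one term, on the left and on the right.
  T-fives : ∀ a c → T (suc a) 0 (suc c) ≡ T a 0 (suc (suc c)) ⊹ T (suc a) 0 c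
  T-fives a c = combine' (T-sum a 1 (suc c)) (T (suc a) 0 (suc c)) (T a 0 (suc (suc c))) (T (suc a) 0 c) (T-sum a 1 c)
    (trans (cong (0ℤ ⊹_) (sym (head-fives a (suc c)))) (trans (T-balance (suc a) 0 (suc c) z<s) (head-fives a c)))
    (trans (cong (λ z → (T a 0 z ⊹ 0ℤ) ⊹ T-sum a 1 (suc c)) (sym (cong suc (+-comm c 1)))) (T-balance a 1 (suc c) z<s))
    where
    combine' : ∀ s x y d s' → 0ℤ ⊹ (s ⊹ x) ≡ s' ⊹ d → (y ⊹ 0ℤ) ⊹ s ≡ s' → x ≡ y ⊹ d
    combine' s x y d s' e₁ e₂ = trans (rearrange s x y) (trans (cong₂ (λ u v → y ⊹ u - v) e₁ e₂) (simplify y d s'))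
      where
      rearrange : ∀ s x y → x ≡ y ⊹ (0ℤ ⊹ (s ⊹ x)) - ((y ⊹ 0ℤ) ⊹ s)
      rearrange = solve-∀
      simplify : ∀ y d s' → y ⊹ (s' ⊹ d) - s' ≡ y ⊹ d
      simplify = solve-∀

-- One and two paths

-- Counts every nonempty path together with a separator, as if each bin were one vertex longer.
span : ℕ → ℕ
span zero    = 0
span (suc m) = suc (suc m)

span-≤ : ∀ m → span m ≤ suc m
span-≤ zero    = z≤n
span-≤ (suc m) = ≤-refl

span-superadditive : Superadditive span
span-superadditive zero    zero    _ = z≤n
span-superadditive zero    (suc m) _ = ≤-trans (span-≤ m) (n≤1+n _)
span-superadditive (suc a) (suc m) (s≤s a≤m) with m≤n⇒m<n∨m≡n a≤m
... | inj₁ a<m = ≤-trans (+-monoʳ-≤ (2 + a) (span-≤ (m ∸ suc a)))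
  (≤-reflexive (cong (2 +_) (trans (+-suc a (m ∸ suc a)) (m+[n∸m]≡n a<m))))
... | inj₂ refl = ≤-reflexive (trans (cong (λ z → 2 + a + span z) (m≤n⇒m∸n≡0 (n≤1+n a))) (+-identityʳ _))

private variable
  l : List ℕ
  p q x y : ℕ

two-bins : p ∷ l ⊑ y ∷ x ∷ [] → (p ≤ y × l ⊑ y ∸ suc p ∷ x ∷ []) ⊎ (p ≤ x × l ⊑ x ∸ suc p ∷ y ∷ [])
two-bins {y = y} (place _ e le s) with split-↭ e
... | inj₁ (refl , e') = inj₁ (le , ⊑-resp-↭ (↭-prep _ (↭-sym e')) s)
... | inj₂ (f , e' , e'') with split-↭ e'
... | inj₁ (refl , e₀) = inj₂ (le , ⊑-resp-↭ (↭-prep _ (↭-trans e'' (↭-prep y (↭-sym e₀)))) s)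
... | inj₂ (g , e₀ , _) with () ← ↭-length e₀

-- Snug q p y x is equivalent to: q and p fit into y and x, but leave no room for a further vertex.

Near : ℕ → ℕ → Set
Near q y = q ≡ y ⊎ suc q ≡ y

Snug : ℕ → ℕ → ℕ → ℕ → Set
Snug q p y x = Near q y × Near p x × ¬ (p ≤ y × suc q < x)

near-≤ : Near q y → q ≤ y
near-≤ (inj₁ refl) = ≤-refl
near-≤ (inj₂ refl) = n≤1+n _

near : q ≤ y → ¬ (suc q < y) → Near q y
near q≤y q≮ with m≤n⇒m<n∨m≡n q≤y
... | inj₂ refl = inj₁ refl
... | inj₁ q<y with m≤n⇒m<n∨m≡n q<y
... | inj₂ e  = inj₂ e
... | inj₁ lt = contradiction lt q≮

room-first : 0 < q → 0 < p → suc q < y → p ≤ x → 1 ∷ q ∷ p ∷ [] ⊑ y ∷ x ∷ []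
room-first q>0 p>0 q<y p≤x =
  place z<s ↭-refl (≤-trans (s≤s z≤n) q<y) (⊑-∷ q>0 (∸-monoˡ-≤ 2 q<y) (⊑-∷ p>0 p≤x empty))

room-second : 0 < q → 0 < p → q ≤ y → suc p < x → 1 ∷ q ∷ p ∷ [] ⊑ y ∷ x ∷ []
room-second q>0 p>0 q≤y p<x =
  ⊑-permute (↭-prep 1 (↭-swap _ _ ↭-refl)) (⊑-swapBins (room-first p>0 q>0 p<x q≤y))

no-room⇒snug : 0 < q → q ≤ p → 0 < y → y ≤ x → q ∷ p ∷ [] ⊑ y ∷ x ∷ [] → ¬ (1 ∷ q ∷ p ∷ [] ⊑ y ∷ x ∷ []) → Snug q p y x
no-room⇒snug {q} {p} {y} {x} q>0 q≤p y>0 y≤x s no-room with q ≤? y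
-- Neither part fits into `y`, which therefore stays free for the further vertex.
... | no q≰y = contradiction (⊑-∷ z<s y>0 (⊑-dropBin (≰⇒> q≰y ∷ ≤-trans (≰⇒> q≰y) q≤p ∷ []) s)) no-room
... | yes q≤y with _ ∷ p≤x ∷ [] ← ⊑-bounded (y≤x ∷ ≤-refl ∷ []) s =
  near q≤y (λ lt → no-room (room-first q>0 p>0 lt p≤x)) ,
  near p≤x (λ lt → no-room (room-second q>0 p>0 q≤y lt)) ,
  λ (p≤y , lt) → no-room (⊑-swapBins (room-first q>0 p>0 lt p≤y))
  where
  p>0 = ≤-trans q>0 q≤p

snug⇒fits : 0 < q → 0 < p → Snug q p y x → q ∷ p ∷ [] ⊑ y ∷ x ∷ []
snug⇒fits q>0 p>0 (nq , np , _) = ⊑-∷ q>0 (near-≤ nq) (⊑-∷ p>0 (near-≤ np) empty)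

-- Unless both slacks are 1, `span` already exceeds the capacity. If both are 1 it balances exactly,
-- and the place of `p` decides: in `x` it leaves a bin of size 0 and so loses weight, and in `y`
-- the cross condition forces `p` and `q` to be equal.
snug⇒no-room : 0 < q → 0 < p → y ≤ x → Snug q p y x → ¬ (1 ∷ q ∷ p ∷ [] ⊑ y ∷ x ∷ [])
snug⇒no-room {suc q} {suc p} _ _ _ (inj₁ refl , inj₁ refl , _) s = 1+n≰n (≤-trans (n≤1+n _) (⊑⇒weight-≤ span-superadditive s))
snug⇒no-room {suc q} {suc p} _ _ _ (inj₂ refl , inj₁ refl , _) s = 1+n≰n (⊑⇒weight-≤ span-superadditive s)
snug⇒no-room {suc q} {suc p} _ _ _ (inj₁ refl , inj₂ refl , _) s =
  1+n≰n (subst (4 + (q + (2 + p + 0)) ≤_) (eq q p) (⊑⇒weight-≤ span-superadditive s))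
  where
  eq : ∀ q p → 2 + (q + (3 + p + 0)) ≡ 3 + (q + (2 + p + 0))
  eq = ℕ-Solver.solve-∀
snug⇒no-room {q@(suc _)} {p@(suc _)} _ _ y≤x (inj₂ refl , inj₂ refl , ¬cross) s
  with two-bins (⊑-swapParts (⊑-permute (↭-prep 1 (↭-swap q p ↭-refl)) s))
... | inj₂ (_ , s') = full (subst (λ z → 1 ∷ q ∷ [] ⊑ z ∷ suc q ∷ []) (n∸n≡0 (suc p)) s')
  where
  full : ∀ {q} → ¬ (1 ∷ suc q ∷ [] ⊑ 0 ∷ suc (suc q) ∷ [])
  full s = 1+n≰n (⊑⇒weight-≤ span-superadditive s)
... | inj₁ (p≤y , s') with refl ← ≤-antisym (s≤s⁻¹ y≤x) (≮⇒≥ (λ q<p → ¬cross (p≤y , s≤s q<p))) =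
  1+n≰n (⊑⇒weight-≤ span-superadditive (subst (λ z → 1 ∷ q ∷ [] ⊑ z ∷ suc q ∷ []) (n∸n≡0 (suc p)) s'))

singleton-canonical : 3 ≤ x → Canonical (x ∷ [])
singleton-canonical x≥3 = [-] , x≥3 ∷ []

pair-canonical : 3 ≤ y → y ≤ x → Canonical (y ∷ x ∷ [])
pair-canonical y≥3 y≤x = y≤x ∷ [-] , y≥3 ∷ ≤-trans y≥3 y≤x ∷ []

≥3⇒>0 : 3 ≤ x → 0 < x
≥3⇒>0 = ≤-trans (s≤s z≤n)

single-room : 0 < p → suc p < x → 1 ∷ p ∷ [] ⊑ x ∷ []
single-room p>0 p<x = place z<s ↭-refl (≤-trans (s≤s z≤n) p<x) (⊑-∷ p>0 (∸-monoˡ-≤ 2 p<x) empty)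

near⇒no-single-room : 0 < p → Near p x → ¬ (1 ∷ p ∷ [] ⊑ x ∷ [])
near⇒no-single-room {suc p} _ (inj₁ refl) s = 1+n≰n (≤-trans (n≤1+n _) (⊑⇒weight-≤ span-superadditive s))
near⇒no-single-room {suc p} _ (inj₂ refl) s = 1+n≰n (⊑⇒weight-≤ span-superadditive s)

-- Ballot and Catalan numbers

binomial-ratio : ∀ n k → suc k * (n C suc k) + k * (n C k) ≡ n * (n C k)
binomial-ratio zero    zero    = refl
binomial-ratio zero    (suc k) = cong₂ _+_ (*-zeroʳ (suc (suc k))) (*-zeroʳ (suc k))
binomial-ratio (suc n) zero    = trans (+-identityʳ _) (trans (+-identityʳ _) (trans (nC1≡n (suc n)) (sym (*-identityʳ (suc n)))))
binomial-ratio (suc n) (suc k) = begin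
  suc (suc k) * (suc n C suc (suc k)) + suc k * (suc n C suc k)
    ≡⟨ cong₂ (λ u v → suc (suc k) * u + suc k * v) (nCk+nC[k+1]≡[n+1]C[k+1] n (suc k)) (nCk+nC[k+1]≡[n+1]C[k+1] n k) ⟨
  suc (suc k) * (v + w) + suc k * (u + v)
    ≡⟨ expand k u v w ⟩
  (suc (suc k) * w + suc k * v) + (suc k * v + k * u) + (u + v)
    ≡⟨ cong₂ (λ s t → s + t + (u + v)) (binomial-ratio n (suc k)) (binomial-ratio n k) ⟩
  n * v + n * u + (u + v)
    ≡⟨ collect n u v ⟩
  suc n * (u + v)
    ≡⟨ cong (suc n *_) (nCk+nC[k+1]≡[n+1]C[k+1] n k) ⟩
  suc n * (suc n C suc k) ∎
  where
  open ≡-Reasoning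
  u = n C k
  v = n C suc k
  w = n C suc (suc k)
  expand : ∀ k u v w → suc (suc k) * (v + w) + suc k * (u + v) ≡ (suc (suc k) * w + suc k * v) + (suc k * v + k * u) + (u + v)
  expand = ℕ-Solver.solve-∀
  collect : ∀ n u v → n * v + n * u + (u + v) ≡ suc n * (u + v)
  collect = ℕ-Solver.solve-∀

-- n C (k − 1), and 0 for k = 0.

_C⁻_ : ℕ → ℕ → ℕ
n C⁻ zero  = 0
n C⁻ suc k = n C k

C⁻-pascal : ∀ n k → n C⁻ k + n C k ≡ suc n C k
C⁻-pascal n zero    = refl
C⁻-pascal n (suc k) = nCk+nC[k+1]≡[n+1]C[k+1] n k

-- The number of lattice paths with `c + a` up-steps and `a` down-steps that never go below their
-- start, as given by the reflection principle.
ballot : ℕ → ℕ → ℤ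
ballot a c = ℤ.+ ((c + 2 * a) C a) - ℤ.+ ((c + 2 * a) C⁻ a)

private
  pascal-ℤ : ∀ x y {z} → x + y ≡ z → ℤ.+ z ≡ ℤ.+ x ⊹ ℤ.+ y
  pascal-ℤ x y refl = ℤ.pos-+ x y

  ballot-pascal : ∀ n a → ℤ.+ (suc n C suc a) - ℤ.+ (suc n C a) ≡ ℤ.+ (n C suc a) - ℤ.+ (n C⁻ a)
  ballot-pascal n a = trans (cong₂ _-_ (pascal-ℤ (n C a) (n C suc a) (nCk+nC[k+1]≡[n+1]C[k+1] n a)) (pascal-ℤ (n C⁻ a) (n C a) (C⁻-pascal n a)))
    (cancel (ℤ.+ (n C a)) (ℤ.+ (n C suc a)) (ℤ.+ (n C⁻ a)))
    where
    cancel : ∀ u v w → (u ⊹ v) - (w ⊹ u) ≡ v - w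
    cancel = solve-∀

ballot-step : ∀ a c → ballot (suc a) (suc c) ≡ ballot a (suc (suc c)) ⊹ ballot (suc a) c
ballot-step a c = begin
  ballot (suc a) (suc c)
    ≡⟨ ballot-pascal (c + 2 * suc a) a ⟩
  ℤ.+ ((c + 2 * suc a) C suc a) - ℤ.+ ((c + 2 * suc a) C⁻ a)
    ≡⟨ insert (ℤ.+ ((c + 2 * suc a) C suc a)) (ℤ.+ ((c + 2 * suc a) C a)) (ℤ.+ ((c + 2 * suc a) C⁻ a)) ⟩
  (ℤ.+ ((c + 2 * suc a) C a) - ℤ.+ ((c + 2 * suc a) C⁻ a)) ⊹ ballot (suc a) c
    ≡⟨ cong (λ n → (ℤ.+ (n C a) - ℤ.+ (n C⁻ a)) ⊹ ballot (suc a) c) (reindex c a) ⟩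
  ballot a (suc (suc c)) ⊹ ballot (suc a) c ∎
  where
  open ≡-Reasoning
  insert : ∀ x y z → x - z ≡ (y - z) ⊹ (x - y)
  insert = solve-∀
  reindex : ∀ c a → c + 2 * suc a ≡ suc (suc c) + 2 * a
  reindex = ℕ-Solver.solve-∀

-- For the odd upper index `1 + 2 * a` the two middle binomial coefficients coincide, which turns
-- the outcome of `ballot-pascal` into a ballot number.
ballot-diagonal : ∀ a → ballot (suc a) 0 ≡ ballot a 1
ballot-diagonal a = begin
  ballot (suc a) 0
    ≡⟨ cong (λ n → ℤ.+ (n C suc a) - ℤ.+ (n C a)) (reindex a) ⟩
  ℤ.+ (suc n C suc a) - ℤ.+ (suc n C a)
    ≡⟨ ballot-pascal n a ⟩
  ℤ.+ (n C suc a) - ℤ.+ (n C⁻ a)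
    ≡⟨ cong (λ z → ℤ.+ z - ℤ.+ (n C⁻ a)) (trans (nCk≡nC[n∸k] (s≤s (m≤m+n a _))) (cong (n C_) (trans (m+n∸m≡n a (a + 0)) (+-identityʳ a)))) ⟩
  ballot a 1 ∎
  where
  open ≡-Reasoning
  n = 1 + 2 * a
  reindex : ∀ a → 2 * suc a ≡ suc (1 + 2 * a)
  reindex = ℕ-Solver.solve-∀

-- `catalan` uses truncating division, so the quotient is exhibited: `n * X ≡ suc n * Y` gives
-- `(X ∸ Y) * suc n ≡ X`.
ballot-catalan : ∀ n → ballot n 0 ≡ ℤ.+ catalan n
ballot-catalan zero    = refl
ballot-catalan (suc m) = begin
  ℤ.+ X - ℤ.+ Y       ≡⟨ ℤ.m-n≡m⊖n X Y ⟩
  X ℤ.⊖ Y             ≡⟨ ℤ.⊖-≥ Y≤X ⟩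
  ℤ.+ (X ∸ Y)         ≡⟨ cong ℤ.+_ (sym (m*n/n≡m (X ∸ Y) (suc n))) ⟩
  ℤ.+ (((X ∸ Y) * suc n) / suc n) ≡⟨ cong ℤ.+_ (/-congˡ {o = suc n} multiple) ⟩
  ℤ.+ catalan n       ∎
  where
  open ≡-Reasoning
  n = suc m
  X = (2 * n) C n
  Y = (2 * n) C m
  ratio : n * X ≡ suc n * Y
  ratio = +-cancelʳ-≡ (m * Y) (n * X) (suc n * Y) (trans (binomial-ratio (2 * n) m) (regroup m Y))
    where
    regroup : ∀ m Y → (2 * suc m) * Y ≡ suc (suc m) * Y + m * Y
    regroup = ℕ-Solver.solve-∀
  Y≤X : Y ≤ X
  Y≤X = *-cancelˡ-≤ n (≤-trans (m≤n+m (n * Y) Y) (≤-reflexive (sym ratio)))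
  multiple : (X ∸ Y) * suc n ≡ X
  multiple = trans (*-distribʳ-∸ (suc n) X Y) (trans
    (cong₂ _∸_ (*-comm X (suc n)) (trans (*-comm Y (suc n)) (sym ratio))) (m+n∸n≡m X (n * X)))

-- Values on powers of paths

module Values (μ : Graph → Graph → ℤ) (isMobius : IsMobius μ) where

  open Mobius μ isMobius
  open UpToFive μ isMobius

  T-ballot : ∀ a c → T a 0 c ≡ ballot a c
  T-ballot zero    c       = T-threes c
  T-ballot (suc a) zero    = trans (T-fives-zero a) (trans (T-ballot a 1) (sym (ballot-diagonal a)))
  T-ballot (suc a) (suc c) = trans (T-fives a c)
    (trans (cong₂ _⊹_ (T-ballot a (suc (suc c))) (T-ballot (suc a) c)) (sym (ballot-step a c)))

  top₁ : ℕ → ℤ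
  top₁ x = top (x ∷ [])

  top₂ : ℕ → ℕ → ℤ
  top₂ y x = top (y ∷ x ∷ [])

  -- A path with at least four vertices holds a 2 and a further vertex, so the right side of the
  -- balance is empty. Tight on the left are the path itself and the path shortened by one vertex.
  top₁-step : ∀ m → 3 ≤ m → top₁ m ⊹ top₁ (suc m) ≡ 0ℤ
  top₁-step m m≥3 = trans (pad (top₁ m) (top₁ (suc m)))
    (tight-balance {suc m ∷ []} {(m ∷ []) ∷ (suc m ∷ []) ∷ []} {[]} (singleton-canonical (m≤n⇒m≤1+n m≥3)) (λ ())
      (((λ ()) ∷ []) ∷ [] ∷ []) X⁻ X⁺ [] (λ ()) Y⁺)
    where
    pad : ∀ y z → y ⊹ z ≡ y ⊹ (z ⊹ 0ℤ)
    pad = solve-∀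
    tight : ∀ {p} → 3 ≤ p → Near p (suc m) → Canonical (p ∷ []) × Tight (p ∷ []) (suc m ∷ [])
    tight p≥3 np = singleton-canonical p≥3 , refl , ⊑-∷ (≥3⇒>0 p≥3) (near-≤ np) empty , near⇒no-single-room (≥3⇒>0 p≥3) np
    X⁻ : ∀ {r} → r ∈ (m ∷ []) ∷ (suc m ∷ []) ∷ [] → Canonical r × Tight r (suc m ∷ [])
    X⁻ (here refl)         = tight m≥3 (inj₂ refl)
    X⁻ (there (here refl)) = tight (m≤n⇒m≤1+n m≥3) (inj₁ refl)
    X⁺ : ∀ {r} → Canonical r → Tight r (suc m ∷ []) → r ∈ (m ∷ []) ∷ (suc m ∷ []) ∷ []
    X⁺ {p ∷ []} (_ , p≥3 ∷ []) (_ , s , no-room)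
      with p≤ ∷ [] ← ⊑-bounded (≤-refl ∷ []) s
      with near p≤ (λ lt → no-room (single-room (≥3⇒>0 p≥3) lt))
    ... | inj₁ refl = there (here refl)
    ... | inj₂ refl = here refl
    Y⁺ : ∀ {r} → Canonical r → Tight₂ r (suc m ∷ []) → r ∈ []
    Y⁺ {[]} _ (_ , _ , no-room) = contradiction (single-room z<s (s≤s m≥3)) no-room

  top₁-value : ∀ k → top₁ (3 + k) ≡ (- 1ℤ) ^ (4 + k)
  top₁-value zero    = T-threes 1
  top₁-value (suc k) = trans (negate (top₁ (3 + k)) (top₁ (4 + k)) (top₁-step (3 + k) (m≤m+n 3 k)))
    (trans (cong -_ (top₁-value k)) (sym (ℤ.-1*i≡-i ((- 1ℤ) ^ (4 + k)))))
    where
    negate : ∀ y z → y ⊹ z ≡ 0ℤ → z ≡ - y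
    negate y z e = trans (shift' y z) (trans (cong (_⊹ - y) e) (ℤ.+-identityˡ _))
      where
      shift' : ∀ y z → z ≡ (y ⊹ z) ⊹ - y
      shift' = solve-∀

  -- A tight forest of the second kind is a part 2 next to one large part, so `Snug` with `q` equal
  -- to 2 describes it as well.
  pair-balance : ∀ {y x X Y} → 3 ≤ y → y ≤ x →
    Unique X → (∀ {q p} → (q , p) ∈ X → 3 ≤ q × q ≤ p × Snug q p y x) →
    (∀ {q p} → 3 ≤ q → q ≤ p → Snug q p y x → (q , p) ∈ X) →
    Unique Y → (∀ {p} → p ∈ Y → 3 ≤ p × Snug 2 p y x) → (∀ {p} → 3 ≤ p → Snug 2 p y x → p ∈ Y) →
    ∑ X (λ (q , p) → top₂ q p) ≡ ∑ Y top₁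
  pair-balance {y} {x} {X} {Y} y≥3 y≤x uX X⁻ X⁺ uY Y⁻ Y⁺ = begin
    ∑ X (λ (q , p) → top₂ q p)   ≡⟨ ∑-map X pair top ⟨
    ∑ (map pair X) top        ≡⟨ tight-balance (pair-canonical y≥3 y≤x) (λ ())
      (Unique.map⁺ (λ { {_ , _} {_ , _} refl → refl }) uX) pairs⁻ pairs⁺
      (Unique.map⁺ (λ { refl → refl }) uY) singles⁻ singles⁺ ⟩
    ∑ (map (_∷ []) Y) top     ≡⟨ ∑-map Y (_∷ []) top ⟩
    ∑ Y top₁                     ∎
    where
    open ≡-Reasoning
    pair : ℕ × ℕ → List ℕ
    pair (q , p) = q ∷ p ∷ []
    pairs⁻ : ∀ {r} → r ∈ map pair X → Canonical r × Tight r (y ∷ x ∷ [])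
    pairs⁻ r∈ with (q , p) , qp∈ , refl ← ∈-map⁻ pair r∈ with q≥3 , q≤p , sn ← X⁻ qp∈ =
      pair-canonical q≥3 q≤p , refl , snug⇒fits (≥3⇒>0 q≥3) (≥3⇒>0 (≤-trans q≥3 q≤p)) sn ,
      snug⇒no-room (≥3⇒>0 q≥3) (≥3⇒>0 (≤-trans q≥3 q≤p)) y≤x sn
    pairs⁺ : ∀ {r} → Canonical r → Tight r (y ∷ x ∷ []) → r ∈ map pair X
    pairs⁺ {q ∷ p ∷ []} (q≤p ∷ [-] , q≥3 ∷ _) (_ , s , no-room) =
      ∈-map⁺ pair (X⁺ q≥3 q≤p (no-room⇒snug (≥3⇒>0 q≥3) q≤p (≥3⇒>0 y≥3) y≤x s no-room))
    singles⁻ : ∀ {r} → r ∈ map (_∷ []) Y → Canonical r × Tight₂ r (y ∷ x ∷ [])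
    singles⁻ r∈ with p , p∈ , refl ← ∈-map⁻ (_∷ []) r∈ with p≥3 , sn ← Y⁻ p∈ =
      singleton-canonical p≥3 , refl , snug⇒fits z<s (≥3⇒>0 p≥3) sn , snug⇒no-room z<s (≥3⇒>0 p≥3) y≤x sn
    singles⁺ : ∀ {r} → Canonical r → Tight₂ r (y ∷ x ∷ []) → r ∈ map (_∷ []) Y
    singles⁺ {p ∷ []} (_ , p≥3 ∷ []) (_ , s , no-room) =
      ∈-map⁺ (_∷ []) (Y⁺ p≥3 (no-room⇒snug z<s (≤-trans (n≤1+n 2) p≥3) (≥3⇒>0 y≥3) y≤x s no-room))

  private
    no-two : ∀ {m} → 3 ≤ m → ¬ Near 2 (suc m)
    no-two (s≤s (s≤s (s≤s _))) (inj₁ ())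
    no-two (s≤s (s≤s (s≤s _))) (inj₂ ())

  top₂-equal : ∀ m → 3 ≤ m → top₂ m m ⊹ (top₂ m (suc m) ⊹ (top₂ (suc m) (suc m) ⊹ 0ℤ)) ≡ 0ℤ
  top₂-equal m m≥3 = pair-balance {suc m} {suc m} {(m , m) ∷ (m , suc m) ∷ (suc m , suc m) ∷ []} {[]}
    (m≤n⇒m≤1+n m≥3) ≤-refl
    (((λ ()) ∷ (λ ()) ∷ []) ∷ ((λ ()) ∷ []) ∷ [] ∷ []) X⁻ X⁺ [] (λ ()) (λ { _ (n2 , _) → contradiction n2 (no-two m≥3) })
    where
    X⁻ : ∀ {q p} → (q , p) ∈ (m , m) ∷ (m , suc m) ∷ (suc m , suc m) ∷ [] → 3 ≤ q × q ≤ p × Snug q p (suc m) (suc m)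
    X⁻ (here refl)                 = m≥3 , ≤-refl , inj₂ refl , inj₂ refl , λ (_ , lt) → 1+n≰n lt
    X⁻ (there (here refl))         = m≥3 , n≤1+n m , inj₂ refl , inj₁ refl , λ (_ , lt) → 1+n≰n lt
    X⁻ (there (there (here refl))) = m≤n⇒m≤1+n m≥3 , ≤-refl , inj₁ refl , inj₁ refl , λ (_ , lt) → 1+n≰n (<⇒≤ lt)
    X⁺ : ∀ {q p} → 3 ≤ q → q ≤ p → Snug q p (suc m) (suc m) → (q , p) ∈ (m , m) ∷ (m , suc m) ∷ (suc m , suc m) ∷ []
    X⁺ _ _   (inj₂ refl , inj₂ refl , _) = here refl
    X⁺ _ _   (inj₂ refl , inj₁ refl , _) = there (here refl)
    X⁺ _ _   (inj₁ refl , inj₁ refl , _) = there (there (here refl))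
    X⁺ _ q≤p (inj₁ refl , inj₂ refl , _) = contradiction q≤p 1+n≰n

  -- The pair `(m , suc m)` is missing: placed crosswise, `suc m` fills the smaller path and `m`
  -- leaves room in the larger one.
  top₂-next : ∀ m → 3 ≤ m → top₂ m (2 + m) ⊹ (top₂ (suc m) (suc m) ⊹ (top₂ (suc m) (2 + m) ⊹ 0ℤ)) ≡ 0ℤ
  top₂-next m m≥3 = pair-balance {suc m} {2 + m} {(m , 2 + m) ∷ (suc m , suc m) ∷ (suc m , 2 + m) ∷ []} {[]}
    (m≤n⇒m≤1+n m≥3) (n≤1+n _)
    (((λ ()) ∷ (λ ()) ∷ []) ∷ ((λ ()) ∷ []) ∷ [] ∷ []) X⁻ X⁺ [] (λ ()) (λ { _ (n2 , _) → contradiction n2 (no-two m≥3) })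
    where
    X⁻ : ∀ {q p} → (q , p) ∈ (m , 2 + m) ∷ (suc m , suc m) ∷ (suc m , 2 + m) ∷ [] → 3 ≤ q × q ≤ p × Snug q p (suc m) (2 + m)
    X⁻ (here refl)                 = m≥3 , m≤n+m m 2 , inj₂ refl , inj₁ refl , λ (le , _) → 1+n≰n le
    X⁻ (there (here refl))         = m≤n⇒m≤1+n m≥3 , ≤-refl , inj₁ refl , inj₂ refl , λ (_ , lt) → 1+n≰n lt
    X⁻ (there (there (here refl))) = m≤n⇒m≤1+n m≥3 , n≤1+n _ , inj₁ refl , inj₁ refl , λ (le , _) → 1+n≰n le
    X⁺ : ∀ {q p} → 3 ≤ q → q ≤ p → Snug q p (suc m) (2 + m) → (q , p) ∈ (m , 2 + m) ∷ (suc m , suc m) ∷ (suc m , 2 + m) ∷ []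
    X⁺ _ _ (inj₂ refl , inj₁ refl , _)      = here refl
    X⁺ _ _ (inj₁ refl , inj₂ refl , _)      = there (here refl)
    X⁺ _ _ (inj₁ refl , inj₁ refl , _)      = there (there (here refl))
    X⁺ _ _ (inj₂ refl , inj₂ refl , ¬cross) = contradiction (≤-refl , ≤-refl) ¬cross

  top₂-far : ∀ m k → 3 ≤ m → 2 + m ≤ k →
          top₂ m k ⊹ (top₂ m (suc k) ⊹ (top₂ (suc m) k ⊹ (top₂ (suc m) (suc k) ⊹ 0ℤ))) ≡ 0ℤ
  top₂-far m k m≥3 m<k = pair-balance {suc m} {suc k} {(m , k) ∷ (m , suc k) ∷ (suc m , k) ∷ (suc m , suc k) ∷ []} {[]}
    (m≤n⇒m≤1+n m≥3) (m≤n⇒m≤1+n (<⇒≤ m<k))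
    (((λ ()) ∷ (λ ()) ∷ (λ ()) ∷ []) ∷ ((λ ()) ∷ (λ ()) ∷ []) ∷ ((λ ()) ∷ []) ∷ [] ∷ [])
    X⁻ X⁺ [] (λ ()) (λ { _ (n2 , _) → contradiction n2 (no-two m≥3) })
    where
    m≤k = ≤-trans (m≤n+m m 2) m<k
    k≰ : ∀ {p q} → k ≤ p → ¬ (p ≤ suc m × suc q < suc k)
    k≰ k≤p (p≤m , _) = 1+n≰n (≤-trans m<k (≤-trans k≤p p≤m))
    X⁻ : ∀ {q p} → (q , p) ∈ (m , k) ∷ (m , suc k) ∷ (suc m , k) ∷ (suc m , suc k) ∷ [] → 3 ≤ q × q ≤ p × Snug q p (suc m) (suc k)
    X⁻ (here refl)                         = m≥3 , m≤k , inj₂ refl , inj₂ refl , k≰ ≤-refl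
    X⁻ (there (here refl))                 = m≥3 , m≤n⇒m≤1+n m≤k , inj₂ refl , inj₁ refl , k≰ (n≤1+n k)
    X⁻ (there (there (here refl)))         = m≤n⇒m≤1+n m≥3 , <⇒≤ m<k , inj₁ refl , inj₂ refl , k≰ ≤-refl
    X⁻ (there (there (there (here refl)))) = m≤n⇒m≤1+n m≥3 , m≤n⇒m≤1+n (<⇒≤ m<k) , inj₁ refl , inj₁ refl , k≰ (n≤1+n k)
    X⁺ : ∀ {q p} → 3 ≤ q → q ≤ p → Snug q p (suc m) (suc k) → (q , p) ∈ (m , k) ∷ (m , suc k) ∷ (suc m , k) ∷ (suc m , suc k) ∷ []
    X⁺ _ _ (inj₂ refl , inj₂ refl , _) = here refl
    X⁺ _ _ (inj₂ refl , inj₁ refl , _) = there (here refl)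
    X⁺ _ _ (inj₁ refl , inj₂ refl , _) = there (there (here refl))
    X⁺ _ _ (inj₁ refl , inj₁ refl , _) = there (there (there (here refl)))

  -- Shortening the path with three vertices would give a part 2, so those cases appear on the right
  -- side of the balance.
  top₂-three-far : ∀ k → 4 ≤ k → top₂ 3 k ⊹ (top₂ 3 (suc k) ⊹ 0ℤ) ≡ top₁ k ⊹ (top₁ (suc k) ⊹ 0ℤ)
  top₂-three-far k k≥4 = pair-balance {3} {suc k} {(3 , k) ∷ (3 , suc k) ∷ []} {k ∷ suc k ∷ []}
    ≤-refl (≤-trans (n≤1+n 3) (m≤n⇒m≤1+n k≥4)) (((λ ()) ∷ []) ∷ [] ∷ []) X⁻ X⁺ (((λ ()) ∷ []) ∷ [] ∷ []) Y⁻ Y⁺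
    where
    k≥3 = ≤-trans (n≤1+n 3) k≥4
    k≰ : ∀ {p q} → k ≤ p → ¬ (p ≤ 3 × suc q < suc k)
    k≰ k≤p (p≤3 , _) = 1+n≰n (≤-trans k≥4 (≤-trans k≤p p≤3))
    X⁻ : ∀ {q p} → (q , p) ∈ (3 , k) ∷ (3 , suc k) ∷ [] → 3 ≤ q × q ≤ p × Snug q p 3 (suc k)
    X⁻ (here refl)         = ≤-refl , k≥3 , inj₁ refl , inj₂ refl , k≰ ≤-refl
    X⁻ (there (here refl)) = ≤-refl , m≤n⇒m≤1+n k≥3 , inj₁ refl , inj₁ refl , k≰ (n≤1+n k)
    X⁺ : ∀ {q p} → 3 ≤ q → q ≤ p → Snug q p 3 (suc k) → (q , p) ∈ (3 , k) ∷ (3 , suc k) ∷ []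
    X⁺ _ _   (inj₁ refl , inj₂ refl , _) = here refl
    X⁺ _ _   (inj₁ refl , inj₁ refl , _) = there (here refl)
    X⁺ q≥3 _ (inj₂ refl , _)             = contradiction q≥3 1+n≰n
    Y⁻ : ∀ {p} → p ∈ k ∷ suc k ∷ [] → 3 ≤ p × Snug 2 p 3 (suc k)
    Y⁻ (here refl)         = k≥3 , inj₂ refl , inj₂ refl , k≰ ≤-refl
    Y⁻ (there (here refl)) = m≤n⇒m≤1+n k≥3 , inj₂ refl , inj₁ refl , k≰ (n≤1+n k)
    Y⁺ : ∀ {p} → 3 ≤ p → Snug 2 p 3 (suc k) → p ∈ k ∷ suc k ∷ []
    Y⁺ _ (_ , inj₂ refl , _) = here refl
    Y⁺ _ (_ , inj₁ refl , _) = there (here refl)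

  top₂-three-four : top₂ 3 3 ⊹ (top₂ 3 4 ⊹ 0ℤ) ≡ top₁ 4 ⊹ 0ℤ
  top₂-three-four = pair-balance {3} {4} {(3 , 3) ∷ (3 , 4) ∷ []} {4 ∷ []}
    ≤-refl (n≤1+n 3) (((λ ()) ∷ []) ∷ [] ∷ []) X⁻ X⁺ ([] ∷ []) Y⁻ Y⁺
    where
    X⁻ : ∀ {q p} → (q , p) ∈ (3 , 3) ∷ (3 , 4) ∷ [] → 3 ≤ q × q ≤ p × Snug q p 3 4
    X⁻ (here refl)         = ≤-refl , ≤-refl , inj₁ refl , inj₂ refl , λ (_ , lt) → 1+n≰n lt
    X⁻ (there (here refl)) = ≤-refl , n≤1+n 3 , inj₁ refl , inj₁ refl , λ (le , _) → 1+n≰n le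
    X⁺ : ∀ {q p} → 3 ≤ q → q ≤ p → Snug q p 3 4 → (q , p) ∈ (3 , 3) ∷ (3 , 4) ∷ []
    X⁺ _ _   (inj₁ refl , inj₂ refl , _) = here refl
    X⁺ _ _   (inj₁ refl , inj₁ refl , _) = there (here refl)
    X⁺ q≥3 _ (inj₂ refl , _)             = contradiction q≥3 1+n≰n
    Y⁻ : ∀ {p} → p ∈ 4 ∷ [] → 3 ≤ p × Snug 2 p 3 4
    Y⁻ (here refl) = n≤1+n 3 , inj₂ refl , inj₁ refl , λ (le , _) → 1+n≰n le
    Y⁺ : ∀ {p} → 3 ≤ p → Snug 2 p 3 4 → p ∈ 4 ∷ []
    Y⁺ _ (_ , inj₁ refl , _)      = here refl
    Y⁺ _ (_ , inj₂ refl , ¬cross) = contradiction (≤-refl , ≤-refl) ¬cross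

  -- Induction on the smaller path: in `top₂-far` the two terms with the shorter first path cancel.
  -- For a first path with three vertices it is the right side of the balance that cancels, by
  -- `top₁-step`.
  top₂-alternates : ∀ j x → 4 + j ≤ x → top₂ (3 + j) (suc x) ≡ - top₂ (3 + j) x
  top₂-alternates zero x x≥4 = solve-for (top₂ 3 x) (top₂ 3 (suc x)) (trans (top₂-three-far x x≥4)
    (trans (unpad (top₁ x) (top₁ (suc x))) (top₁-step x (≤-trans (n≤1+n 3) x≥4))))
    where
    unpad : ∀ y z → y ⊹ (z ⊹ 0ℤ) ≡ y ⊹ z
    unpad = solve-∀
    solve-for : ∀ y z → y ⊹ (z ⊹ 0ℤ) ≡ 0ℤ → z ≡ - y
    solve-for y z e = trans (rearrange y z) (trans (cong (_- y) e) (ℤ.+-identityˡ _))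
      where
      rearrange : ∀ y z → z ≡ (y ⊹ (z ⊹ 0ℤ)) - y
      rearrange = solve-∀
  top₂-alternates (suc j) x x≥ = solve-for (top₂ (3 + j) x) (top₂ (3 + j) (suc x)) (top₂ (4 + j) x) (top₂ (4 + j) (suc x))
    (top₂-alternates j x (<⇒≤ x≥)) (top₂-far (3 + j) x (m≤m+n 3 j) x≥)
    where
    solve-for : ∀ u v y z → v ≡ - u → u ⊹ (v ⊹ (y ⊹ (z ⊹ 0ℤ))) ≡ 0ℤ → z ≡ - y
    solve-for u v y z refl e = trans (rearrange u y z) (trans (cong (_- y) e) (ℤ.+-identityˡ _))
      where
      rearrange : ∀ u y z → z ≡ (u ⊹ (- u ⊹ (y ⊹ (z ⊹ 0ℤ)))) - y
      rearrange = solve-∀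

  private
    fib-ℤ : ∀ n → ℤ.+ fib (2 + n) ≡ ℤ.+ fib (suc n) ⊹ ℤ.+ fib n
    fib-ℤ n = ℤ.pos-+ (fib (suc n)) (fib n)

  -- Equal sizes and sizes differing by one have to be treated together. `top₂-equal` yields the
  -- next value of the first kind and `top₂-next` that of the second, once `top₂-alternates` has
  -- reduced `(m , 2 + m)` to `(m , suc m)`.
  top₂-values : ∀ k → top₂ (3 + k) (3 + k) ≡ ℤ.+ fib (1 + k) × top₂ (3 + k) (4 + k) ≡ - (ℤ.+ fib (3 + k))
  top₂-values zero = T-threes 2 , solve-for (top₂ 3 3) (top₂ 3 4) (top₁ 4) (T-threes 2) (top₁-value 1) top₂-three-four
    where
    solve-for : ∀ x y s → x ≡ 1ℤ → s ≡ - 1ℤ → x ⊹ (y ⊹ 0ℤ) ≡ s ⊹ 0ℤ → y ≡ - (ℤ.+ 2)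
    solve-for x y s refl refl e = trans (rearrange y) (cong (_- 1ℤ) e)
      where
      rearrange : ∀ y → y ≡ (1ℤ ⊹ (y ⊹ 0ℤ)) - 1ℤ
      rearrange = solve-∀
  top₂-values (suc k) with even , odd ← top₂-values k = even' , odd'
    where
    m₀ = 3 + k
    even' : top₂ (4 + k) (4 + k) ≡ ℤ.+ fib (2 + k)
    even' = solve-for (top₂ m₀ m₀) (top₂ m₀ (suc m₀)) (top₂ (suc m₀) (suc m₀)) (ℤ.+ fib (1 + k)) (ℤ.+ fib (2 + k)) even
      (trans odd (cong -_ (fib-ℤ (1 + k)))) (top₂-equal m₀ (m≤m+n 3 k))
      where
      solve-for : ∀ u v w x y → u ≡ x → v ≡ - (y ⊹ x) → u ⊹ (v ⊹ (w ⊹ 0ℤ)) ≡ 0ℤ → w ≡ y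
      solve-for u v w x y refl refl e = trans (rearrange w x y) (trans (cong (_⊹ y) e) (ℤ.+-identityˡ _))
        where
        rearrange : ∀ w x y → w ≡ (x ⊹ (- (y ⊹ x) ⊹ (w ⊹ 0ℤ))) ⊹ y
        rearrange = solve-∀
    odd' : top₂ (4 + k) (5 + k) ≡ - (ℤ.+ fib (4 + k))
    odd' = trans (solve-for (top₂ m₀ (2 + m₀)) (top₂ (suc m₀) (suc m₀)) (top₂ (suc m₀) (2 + m₀)) (ℤ.+ fib (2 + k)) (ℤ.+ fib (3 + k))
        (trans (top₂-alternates k (suc m₀) ≤-refl) (trans (cong -_ odd) (ℤ.neg-involutive _))) even' (top₂-next m₀ (m≤m+n 3 k)))
      (cong -_ (sym (fib-ℤ (2 + k))))
      where
      solve-for : ∀ u v w y z → u ≡ z → v ≡ y → u ⊹ (v ⊹ (w ⊹ 0ℤ)) ≡ 0ℤ → w ≡ - (z ⊹ y)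
      solve-for u v w y z refl refl e = trans (rearrange w y z) (trans (cong (_⊹ - (z ⊹ y)) e) (ℤ.+-identityˡ _))
        where
        rearrange : ∀ w y z → w ≡ (z ⊹ (y ⊹ (w ⊹ 0ℤ))) ⊹ - (z ⊹ y)
        rearrange = solve-∀

  T-fours-value : ∀ n → T 0 n 0 ≡ (- 1ℤ) ^ (4 + n)
  T-fours-value zero    = T-threes 0
  T-fours-value (suc n) = trans (T-fours n) (trans (cong -_ (T-fours-value n)) (sym (ℤ.-1*i≡-i ((- 1ℤ) ^ (4 + n)))))

  PathPow-f : ∀ x n {y} → replicate n x ≡ toList y → μ (PathPow 1 n) (PathPow x n) ≡ f y n
  PathPow-f x n e = cong₂ μ
    (trans (PathPow≡Forest 1 n) (cong Forest (sym (List.++-identityʳ (replicate n 1)))))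
    (trans (PathPow≡Forest x n) (cong Forest e))

  PathPow-top : ∀ x n {r} → replicate n x ≡ r → μ (PathPow 1 n) (PathPow x n) ≡ top r
  PathPow-top x n {r} e = trans (PathPow-f x n {code r 0 0} e)
    (cong (F r) (trans (sym (List.length-replicate n)) (cong length e)))

  PathPow-one : ∀ n → μ (PathPow 1 n) (PathPow 1 n) ≡ 1ℤ
  PathPow-one n = proj₁ isMobius _ _ (≅-refl {PathPow 1 n})

  -- `twist n` is left unevaluated since it reduces by itself for concrete `n`: to the negated
  -- constant coefficient of `F []` for `n ≡ 1`, and to 0 from 2 on.
  PathPow-two : ∀ n → μ (PathPow 1 n) (PathPow 2 n) ≡ twist n (F []) n
  PathPow-two n = trans (PathPow-f 2 n {code [] n 0} (sym (List.++-identityʳ (replicate n 2))))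
                        (f≡model (code [] n 0) canonical-[] n)

  PathPow-three : ∀ n → μ (PathPow 1 n) (PathPow 3 n) ≡ 1ℤ
  PathPow-three n = trans (PathPow-top 3 n (sym (List.++-identityʳ (replicate n 3)))) (T-threes n)

  PathPow-four : ∀ n → μ (PathPow 1 n) (PathPow 4 n) ≡ (- 1ℤ) ^ (4 + n)
  PathPow-four n = trans (PathPow-top 4 n (sym (List.++-identityʳ (replicate n 4)))) (T-fours-value n)

  PathPow-five : ∀ n → μ (PathPow 1 n) (PathPow 5 n) ≡ ℤ.+ catalan n
  PathPow-five n = trans (PathPow-top 5 n refl) (trans (T-ballot n 0) (ballot-catalan n))

  single-path : ∀ x → 1 ≤ x → μ (PathPow 1 1) (PathPow x 1) ≡ (- 1ℤ) ^ (x + 1)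
  single-path 1                   _ = PathPow-one 1
  single-path 2                   _ = trans (PathPow-two 1) (cong -_ top-[])
  single-path (suc (suc (suc k))) _ = trans (PathPow-top (3 + k) 1 refl)
    (trans (top₁-value k) (cong ((- 1ℤ) ^_) (cong (3 +_) (+-comm 1 k))))

  two-paths : ∀ x → 2 ≤ x → μ (PathPow 1 2) (PathPow x 2) ≡ ℤ.+ fib (x ∸ 2)
  two-paths 2                   _ = PathPow-two 2
  two-paths (suc (suc (suc k))) _ = trans (PathPow-top (3 + k) 2 refl) (proj₁ (top₂-values k))
  two-paths 0 ()
  two-paths 1 (s≤s ())

open import Data.Integer using (+_)

theorem4p1 : (μ : Graph → Graph → ℤ) → IsMobius μ →
    (n x : ℕ) → 1 ≤ n → 1 ≤ x →
    ((n ≡ 1 ⊎ x ≡ 4) → μ (PathPow 1 n) (PathPow x n) ≡ (- (+ 1)) ^ (x Data.Nat.+ n)) ×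
    ((x ≡ 1 ⊎ x ≡ 3) → μ (PathPow 1 n) (PathPow x n) ≡ + 1) ×
    ((x ≡ 2 × 2 ≤ n) → μ (PathPow 1 n) (PathPow x n) ≡ + 0) ×
    ((n ≡ 2 × 2 ≤ x) → μ (PathPow 1 n) (PathPow x n) ≡ + fib (x ∸ 2)) ×
    (x ≡ 5 → μ (PathPow 1 n) (PathPow x n) ≡ + catalan n)
theorem4p1 μ isMobius n x _ x≥1 =
  (λ { (inj₁ refl) → single-path x x≥1 ; (inj₂ refl) → PathPow-four n }) ,
  (λ { (inj₁ refl) → PathPow-one n ; (inj₂ refl) → PathPow-three n }) ,
  (λ { (refl , s≤s (s≤s _)) → PathPow-two n }) ,
  (λ { (refl , x≥2) → two-paths x x≥2 }) ,
  (λ { refl → PathPow-five n })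
  where open Values μ isMobius
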